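{- Let $R$ be a finite valuation ring with residue field of odd size $q$ and with uniformizer of nilpotency degree $\ell$. Then: (i) For $n\geq 2$, the bipartite graph $\mathrm{Um}(R^n)$ has half-size $q^{n\ell}-q^{n(\ell-1)}$ and is regular of degree $q^{(n-1)\ell}$; for $n\geq 3$, the bipartite graph $\mathrm{Um}_0(R^n)$ has half-size $q^{(n-1)(\ell-1)}(q^n-1)/(q-1)$ and is regular of degree $q^{(n-2)(\ell-1)}(q^{n-1}-1)/(q-1)$. (ii) Both $\mathrm{Um}(R^n)$ and $\mathrm{Um}_0(R^n)$ are Cayley graphs. (iii) The diameter of $\mathrm{Um}(R^n)$ is $4$, and the diameter of $\mathrm{Um}_0(R^n)$ is $3$.
   Context: Rings are commutative with identity. A finite valuation ring is a finite local principal ring; its maximal ideal is $(\pi)$ for a uniformizer $\pi$, $q=|R/(\pi)|$, and $\ell$ is the smallest positive integer with $\pi^\ell=0$. An $n$-tuple in $R^n$ is unimodular if its entries generate $R$ as an ideal; $R^{n,u}$ denotes the set of unimodular $n$-tuples and $R^\times$ the unit group. Dot product: $a\cdot b=\sum_i a_ib_i$. For $n\geq 2$, $\mathrm{Um}(R^n)$ is the bipartite graph on two copies $\{a_\bullet\},\{b_\circ\}$ of $R^{n,u}$ with $a_\bullet\sim b_\circ$ iff $a\cdot b=1$. For $n\geq3$, $\mathrm{Um}_0(R^n)$ is the bipartite graph on two copies of $R^{n,u}/R^\times$ with $[a]_\bullet\sim[b]_\circ$ iff $a\cdot b=0$. The half-size of such a bipartite graph is the number of vertices in one of the two copies. -}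

module Defs where

open import Level using (0ℓ)
open import Data.Nat as ℕ using (ℕ; zero; suc)
open import Data.Fin using (Fin)
open import Data.Vec using (Vec; []; _∷_; map)
open import Data.Bool using (Bool; true; false)
open import Data.Product using (Σ; ∃; ∃₂; _×_; _,_; proj₁; proj₂)
open import Data.Sum using (_⊎_)
open import Relation.Binary.PropositionalEquality using (_≡_; _≢_)
open import Relation.Nullary using (¬_)
open import Algebra.Core using (Op₁; Op₂)
open import Algebra.Structures using (IsCommutativeRing)
open import Algebra.Bundles using (Group)
open import Function.Bundles using (_⇔_)

-- Finite commutative rings (with identity).  Every finite commutative
-- ring is isomorphic to one whose carrier is  Fin size  with equality _≡_.

record FinCommRing : Set where
  infixl 7 _*_
  infixl 6 _+_
  field
    size : ℕ
    _+_ _*_ : Op₂ (Fin size)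
    -_ : Op₁ (Fin size)
    0# 1# : Fin size
    isCommutativeRing : IsCommutativeRing _≡_ _+_ _*_ -_ 0# 1#

  Carrier : Set
  Carrier = Fin size

  _-_ : Carrier → Carrier → Carrier
  x - y = x + (- y)

  pow : Carrier → ℕ → Carrier
  pow x zero    = 1#
  pow x (suc k) = x * pow x k

-- Counting: "the set {x | P x} modulo the relation _~_ has exactly m
-- elements", witnessed by a system of representatives indexed by Fin m.
-- For _~_ = _≡_ this is the plain cardinality of {x | P x}.

NumClasses : {A : Set} → (A → Set) → (A → A → Set) → ℕ → Set
NumClasses {A} P _~_ m =
  Σ (Fin m → A) λ f →
    (∀ i → P (f i)) ×
    (∀ i j → f i ~ f j → i ≡ j) ×
    (∀ x → P x → ∃ λ i → x ~ f i)

module _ (R : FinCommRing) where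
  open FinCommRing R

  IsIdeal : (Carrier → Set) → Set
  IsIdeal I = I 0# × (∀ x y → I x → I y → I (x + y)) × (∀ r x → I x → I (r * x))

  ⟨_⟩ : Carrier → Carrier → Set
  ⟨ g ⟩ x = ∃ λ r → x ≡ r * g

  IsMaximalIdeal : (Carrier → Set) → Set₁
  IsMaximalIdeal M =
    IsIdeal M × ¬ M 1# ×
    (∀ (J : Carrier → Set) → IsIdeal J → (∀ x → M x → J x) →
       J 1# ⊎ (∀ x → J x → M x))

  IsLocal : Set₁
  IsLocal = Σ (Carrier → Set) λ M → IsMaximalIdeal M ×
              (∀ M' → IsMaximalIdeal M' → ∀ x → M x ⇔ M' x)

  IsPrincipalIdeal : (Carrier → Set) → Set
  IsPrincipalIdeal I = ∃ λ g → ∀ x → I x ⇔ ⟨ g ⟩ x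

  IsPrincipalRing : Set₁
  IsPrincipalRing = ∀ I → IsIdeal I → IsPrincipalIdeal I

  IsFiniteValuationRing : Set₁
  IsFiniteValuationRing = IsLocal × IsPrincipalRing

  IsUniformizer : Carrier → Set₁
  IsUniformizer π = IsMaximalIdeal ⟨ π ⟩

  ResidueSize : Carrier → ℕ → Set
  ResidueSize π q = NumClasses (λ _ → Carrier) (λ x y → ⟨ π ⟩ (x - y)) q

  NilDegree : Carrier → ℕ → Set
  NilDegree π ℓ = 1 ℕ.≤ ℓ × pow π ℓ ≡ 0# × (∀ k → 1 ℕ.≤ k → k ℕ.< ℓ → pow π k ≢ 0#)

  IsUnit : Carrier → Set
  IsUnit u = ∃ λ v → u * v ≡ 1#

  dot : ∀ {n} → Vec Carrier n → Vec Carrier n → Carrier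
  dot []       []       = 0#
  dot (x ∷ xs) (y ∷ ys) = x * y + dot xs ys

  Unimodular : ∀ {n} → Vec Carrier n → Set
  Unimodular {n} a = ∃ λ (c : Vec Carrier n) → dot c a ≡ 1#

  UVec : ℕ → Set
  UVec n = Σ (Vec Carrier n) Unimodular

  Assoc : ∀ {n} → Vec Carrier n → Vec Carrier n → Set
  Assoc a b = ∃ λ u → IsUnit u × b ≡ map (u *_) a

-- Bipartite graphs with a setoid of vertices.  side v says in which of
-- the two copies v lies (true = the •-copy, false = the ∘-copy).

record Graph : Set₁ where
  field
    V    : Set
    _≈_  : V → V → Set
    E    : V → V → Set
    side : V → Bool

module _ (R : FinCommRing) where
  open FinCommRing R

  Um : ℕ → Graph
  Um n = record
    { V    = Bool × UVec R n
    ; _≈_  = λ u v → proj₁ u ≡ proj₁ v × proj₁ (proj₂ u) ≡ proj₁ (proj₂ v)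
    ; E    = λ u v → proj₁ u ≢ proj₁ v × dot R (proj₁ (proj₂ u)) (proj₁ (proj₂ v)) ≡ 1#
    ; side = proj₁
    }

  -- Um₀(R^n): vertices are classes [a] in R^{n,u}/R^×, [a]_• ~ [b]_∘ iff a·b = 0
  Um₀ : ℕ → Graph
  Um₀ n = record
    { V    = Bool × UVec R n
    ; _≈_  = λ u v → proj₁ u ≡ proj₁ v × Assoc R (proj₁ (proj₂ u)) (proj₁ (proj₂ v))
    ; E    = λ u v → proj₁ u ≢ proj₁ v × dot R (proj₁ (proj₂ u)) (proj₁ (proj₂ v)) ≡ 0#
    ; side = proj₁
    }

module _ (G : Graph) where
  open Graph G

  HalfSize : ℕ → Set
  HalfSize h = NumClasses (λ v → side v ≡ true) _≈_ h

  Regular : ℕ → Set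
  Regular d = ∀ v → NumClasses (E v) _≈_ d

  IsCayley : Set₁
  IsCayley =
    Σ (Group 0ℓ 0ℓ) λ Γ → let module Γ = Group Γ in
    Σ (Γ.Carrier → Set) λ S →
    Σ (V → Γ.Carrier) λ φ →
      (∀ x y → x Γ.≈ y → S x → S y) ×
      (∀ x → S x → S (x Γ.⁻¹)) ×
      ¬ S Γ.ε ×
      (∀ u v → u ≈ v → φ u Γ.≈ φ v) ×
      (∀ u v → φ u Γ.≈ φ v → u ≈ v) ×
      (∀ g → ∃ λ u → φ u Γ.≈ g) ×
      (∀ u v → E u v ⇔ S (φ v Γ.∙ (φ u Γ.⁻¹)))

  Reach : ℕ → V → V → Set
  Reach zero    u v = u ≈ v
  Reach (suc k) u v = Reach k u v ⊎ ∃ λ w → E u w × Reach k w v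

  Diameter : ℕ → Set
  Diameter d = (∀ u v → Reach d u v) × ∃₂ λ u v → ¬ Reach (d ℕ.∸ 1) u v

{-# OPTIONS --safe #-}
-- The Cayley property rests on an unramified extension A = R[X]/(f) of degree n:
-- if f is irreducible modulo π, then A ≅ Rⁿ and the unimodular vectors are
-- exactly the units of A.  The form (a, b) ↦ (coefficient of 1 in a b) is perfect,
-- so after a linear relabelling of the ∘-copy adjacency of a• and b∘ depends only
-- on the product a b, and the generalised dihedral group of A^× (or of A^×/R^×)
-- acts regularly.
--
-- A polynomial irreducible modulo π is found inside B = k[X]/(X^N - X), where k
-- has q elements and N = qⁿ.  Every b in B satisfies b^N = b, so each residue
-- field of B has q^d ≤ N elements.  If always d < n, then the product of the
-- X^(q^j) - X with 0 < j < n would vanish in B, although its degree is less than N.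
--
-- For Um the distance between the two sides is at most 3, by solving two linear
-- equations; e₁ and u e₁ with a unit u ≠ 1 have no common neighbour.  In Um₀ any
-- two vectors on the same side have a common unimodular orthogonal vector.
-- Expansions in powers of π count R, and a class in R^{n,u}/R^× is counted by its
-- representative whose first unit entry is 1.
module Submission where

open import Level using (0ℓ)
open import Algebra.Bundles using (AbelianGroup; CommutativeRing; Group)
import Algebra.Construct.Pointwise as Pointwise
open import Data.Bool using (Bool; true; false; not)
open import Data.Empty using (⊥-elim)
open import Data.Fin using (Fin; zero; suc; toℕ; fromℕ; fromℕ<; inject₁; inject≤; punchIn; punchOut; splitAt; join; combine; remQuot; finToFun; funToFin; _↑ˡ_; _↑ʳ_; _≟_)
open import Data.Fin.Permutation using (permutation)
import Data.Fin.Properties as Fin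
open import Data.Fin.Relation.Unary.Top using (View; view; ‵fromℕ; ‵inject₁)
open import Data.Nat as ℕ using (ℕ; zero; suc)
import Data.Nat.Properties as ℕ
open import Data.Product using (Σ; ∃; ∃₂; _×_; _,_; proj₁; proj₂)
open import Data.Sum using (_⊎_; inj₁; inj₂; [_,_]′)
open import Data.Unit using (⊤; tt)
open import Data.Vec as Vec using (Vec; []; _∷_; lookup; tabulate; insertAt; removeAt; zipWith)
open import Data.Vec.Functional using () renaming (_∷_ to _◂_)
import Data.Vec.Properties as Vec
open import Data.Vec.Relation.Unary.All using (All; []; _∷_)
open import Function using (_∘_; id)
open import Function.Bundles using (_⇔_; mk⇔)
open import Relation.Binary.PropositionalEquality as ≡ using (_≡_; _≢_)
open import Relation.Nullary using (¬_; Dec; yes; no; contradiction)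
open import Relation.Nullary.Decidable using (map′)
open import Defs

-- Finite fields

-- Every auxiliary ring is a `CyclicModule`: a quotient of K[X] given only by the operator of
-- multiplication by X, with products computed as Horner evaluations. This covers B, its residue
-- field and the extension of R. Passing to a quotient changes the equality alone, so the
-- coefficients of a polynomial over the residue field are already elements of R and serve as their
-- own lift. A single residue field of B suffices, provided that the product h of the X^(q^j) - X
-- does not vanish in it. For this, h is multiplied up to an element z whose annihilator is maximal.
-- As h divides z and B is reduced, z h ≠ 0, so h survives modulo the annihilator. In that field the
-- degree of X over k is at most n by counting roots of X^N - X, and at least n because h survives.
-- Reflections enter because adjacency prescribes the product of two labels, whereas a Cayley graph
-- prescribes a quotient; inversion by the reflections turns one into the other. Oddness of q
-- excludes q = 2, so a third residue class supplies the unit u ≠ 1 for the diameter of Um.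

record Enumeration {A : Set} (_≈_ : A → A → Set) (m : ℕ) : Set where
  field
    enum       : Fin m → A
    injective  : ∀ {i j} → enum i ≈ enum j → i ≡ j
    index      : A → Fin m
    enum-index : ∀ x → x ≈ enum (index x)

record FiniteField (q : ℕ) : Set₁ where
  field
    commutativeRing : CommutativeRing 0ℓ 0ℓ
  open CommutativeRing commutativeRing public
  field
    enumeration : Enumeration _≈_ q
    1≉0         : ¬ 1# ≈ 0#
    inverse     : ∀ x → ¬ x ≈ 0# → ∃ λ y → x * y ≈ 1#
  open Enumeration enumeration public

module Decide {q} (F : FiniteField q) where
  open FiniteField F hiding (zero)

  index-cong : ∀ {x y} → x ≈ y → index x ≡ index y
  index-cong {x} {y} x≈y = injective (trans (sym (enum-index x)) (trans x≈y (enum-index y)))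

  index-reflects : ∀ {x y} → index x ≡ index y → x ≈ y
  index-reflects {x} {y} eq = trans (enum-index x) (trans (reflexive (≡.cong enum eq)) (sym (enum-index y)))

  infix 4 _≈?_
  _≈?_ : ∀ x y → Dec (x ≈ y)
  x ≈? y = map′ index-reflects index-cong (index x ≟ index y)

  cancelˡ : ∀ {x y z} → ¬ x ≈ 0# → x * y ≈ x * z → y ≈ z
  cancelˡ {x} {y} {z} x≉0 eq with inverse x x≉0
  ... | x⁻¹ , xx⁻¹≈1 = trans (sym (undo y)) (trans (*-congˡ eq) (undo z))
    where
    undo : ∀ w → x⁻¹ * (x * w) ≈ w
    undo w = trans (sym (*-assoc x⁻¹ x w))
      (trans (*-congʳ (trans (*-comm x⁻¹ x) xx⁻¹≈1)) (*-identityˡ w))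

  x*y≉0 : ∀ {x y} → ¬ x ≈ 0# → ¬ y ≈ 0# → ¬ x * y ≈ 0#
  x*y≉0 x≉0 y≉0 xy≈0 = y≉0 (cancelˡ x≉0 (trans xy≈0 (sym (zeroʳ _))))

module Fermat {q} (F : FiniteField q) where
  open FiniteField F hiding (zero)
  open Decide F
  open import Algebra.Properties.CommutativeSemiring.Exp commutativeSemiring using (_^_; ^-congˡ; ^-assocʳ)
  import Algebra.Properties.CommutativeMonoid.Sum *-commutativeMonoid as Π
  open import Relation.Binary.Reasoning.Setoid setoid

  product-≉0 : ∀ {m} (f : Fin m → Carrier) → (∀ i → ¬ f i ≈ 0#) → ¬ Π.sum f ≈ 0#
  product-≉0 {zero}  f f≉0 = 1≉0
  product-≉0 {suc m} f f≉0 = x*y≉0 (f≉0 zero) (product-≉0 (f ∘ suc) (f≉0 ∘ suc))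

  δ : ∀ {m} → Fin m → Carrier → Carrier → Fin m → Carrier
  δ k x y i with i ≟ k
  ... | yes _ = x
  ... | no _  = y

  product-δ : ∀ {m} (k : Fin m) a → Π.sum (δ k a 1#) ≈ a
  product-δ {suc m} k a = begin
    Π.sum (δ k a 1#)                                     ≈⟨ Π.sum-remove {i = k} (δ k a 1#) ⟩
    δ k a 1# k * Π.sum (λ i → δ k a 1# (punchIn k i)) ≈⟨ *-cong δ-hit (Π.sum-cong-≋ δ-miss) ⟩
    a * Π.sum {m} (λ _ → 1#)                             ≈⟨ *-congˡ (Π.sum-replicate-zero m) ⟩
    a * 1#                                               ≈⟨ *-identityʳ a ⟩
    a                                                    ∎
    where
    δ-hit : δ k a 1# k ≈ a
    δ-hit with k ≟ k
    ... | yes _  = refl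
    ... | no k≢k = contradiction ≡.refl k≢k
    δ-miss : ∀ i → δ k a 1# (punchIn k i) ≈ 1#
    δ-miss i with punchIn k i ≟ k
    ... | yes eq = contradiction eq (Fin.punchInᵢ≢i k i)
    ... | no _   = refl

  -- Multiplication by a permutes the nonzero elements.  The product runs over
  -- all of F, with the factor 0 replaced by 1.
  fermat-unit : ∀ a → ¬ a ≈ 0# → a ^ q ≈ a
  fermat-unit a a≉0 with inverse a a≉0
  ... | b , ab≈1 = cancelˡ (product-≉0 nz nz≉0) (begin
    Π.sum nz * a ^ q                            ≈⟨ *-congˡ (sym (Π.sum-replicate q)) ⟩
    Π.sum nz * Π.sum {q} (λ _ → a)              ≈⟨ *-congˡ (Π.sum-cong-≋ split) ⟩
    Π.sum nz * Π.sum (λ i → c i * c′ i)         ≈⟨ *-congˡ (Π.∑-distrib-+ c c′) ⟩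
    Π.sum nz * (Π.sum c * Π.sum c′)             ≈⟨ sym (*-assoc _ _ _) ⟩
    (Π.sum nz * Π.sum c) * Π.sum c′             ≈⟨ *-cong (*-comm _ _) (product-δ i₀ a) ⟩
    (Π.sum c * Π.sum nz) * a                    ≈⟨ *-congʳ (sym (Π.∑-distrib-+ c nz)) ⟩
    Π.sum (λ i → c i * nz i) * a                ≈⟨ *-congʳ (Π.sum-cong-≋ (sym ∘ nz-σ)) ⟩
    Π.sum (nz ∘ σ) * a                          ≈⟨ *-congʳ (sym (Π.sum-permute nz perm)) ⟩
    Π.sum nz * a                                ∎)
    where
    i₀ = index 0#
    nz c c′ : Fin q → Carrier
    nz i = δ i₀ 1# (enum i) i
    -- The constant factor `a` is split as `c i * c′ i`: `c` carries it at the nonzero elements,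
    -- where it turns `nz i` into `nz (σ i)`, and `c′` carries the one left over at 0. Hence a^q = a
    -- results directly, without the exponent q - 1.
    c    = δ i₀ 1# a
    c′   = δ i₀ a 1#

    mul : Carrier → Fin q → Fin q
    mul x i = index (x * enum i)
    σ = mul a

    mul-inverse : ∀ x y → x * y ≈ 1# → ∀ i → mul x (mul y i) ≡ i
    mul-inverse x y xy≈1 i = injective (begin
      enum (mul x (mul y i)) ≈⟨ enum-index _ ⟨
      x * enum (mul y i)     ≈⟨ *-congˡ (enum-index _) ⟨
      x * (y * enum i)       ≈⟨ *-assoc x y _ ⟨
      (x * y) * enum i       ≈⟨ *-congʳ xy≈1 ⟩
      1# * enum i            ≈⟨ *-identityˡ _ ⟩
      enum i                 ∎)

    perm = permutation σ (mul b) (mul-inverse a b ab≈1) (mul-inverse b a (trans (*-comm b a) ab≈1))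

    nonzero : ∀ {i} → ¬ i ≡ i₀ → ¬ enum i ≈ 0#
    nonzero i≢i₀ eq = i≢i₀ (injective (trans eq (enum-index 0#)))

    nz≉0 : ∀ i → ¬ nz i ≈ 0#
    nz≉0 i with i ≟ i₀
    ... | yes _   = 1≉0
    ... | no i≢i₀ = nonzero i≢i₀

    split : ∀ i → a ≈ c i * c′ i
    split i with i ≟ i₀
    ... | yes _ = sym (*-identityˡ a)
    ... | no _  = sym (*-identityʳ a)

    nz-σ : ∀ i → nz (σ i) ≈ c i * nz i
    nz-σ i with σ i ≟ i₀ | i ≟ i₀
    ... | yes _  | yes _   = sym (*-identityˡ 1#)
    ... | no σi≢ | yes ≡.refl =
      contradiction (index-cong (trans (*-congˡ (sym (enum-index 0#))) (zeroʳ a))) σi≢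
    ... | no _   | no _    = sym (enum-index _)
    ... | yes σi≡ | no i≢  = contradiction (index-reflects σi≡) (x*y≉0 a≉0 (nonzero i≢))

  0<q : ∃ λ q′ → q ≡ suc q′
  0<q = go (index 0#)
    where
    go : ∀ {m} → Fin m → ∃ λ m′ → m ≡ suc m′
    go {suc m} _ = m , ≡.refl

  fermat : ∀ a → a ^ q ≈ a
  fermat a with a ≈? 0#
  ... | no a≉0 = fermat-unit a a≉0
  ... | yes a≈0 with 0<q
  ...   | q′ , ≡.refl = trans (*-congʳ a≈0) (trans (zeroˡ _) (sym a≈0))

  fermat-iterated : ∀ n a → a ^ (q ℕ.^ n) ≈ a
  fermat-iterated zero    a = *-identityʳ a
  fermat-iterated (suc n) a = begin
    a ^ (q ℕ.* q ℕ.^ n) ≈⟨ ^-assocʳ a q (q ℕ.^ n) ⟨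
    (a ^ q) ^ (q ℕ.^ n) ≈⟨ ^-congˡ (q ℕ.^ n) (fermat a) ⟩
    a ^ (q ℕ.^ n)       ≈⟨ fermat-iterated n a ⟩
    a                   ∎

-- Polynomial division and counting of roots

module Polynomial (R : CommutativeRing 0ℓ 0ℓ) where
  open CommutativeRing R hiding (zero)
  open import Algebra.Properties.CommutativeSemiring.Exp commutativeSemiring using (_^_)
  open import Relation.Binary.Reasoning.Setoid setoid
  open import Algebra.Solver.Ring.NaturalCoefficients.Default commutativeSemiring

  eval : ∀ {m} → Vec Carrier m → Carrier → Carrier
  eval []      t = 0#
  eval (a ∷ p) t = a + t * eval p t

  -- Horner's scheme: the quotient of a ∷ p by X - r.
  quotient : ∀ {m} → Carrier → Vec Carrier m → Vec Carrier m
  quotient r []      = []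
  quotient r (b ∷ p) = eval (b ∷ p) r ∷ quotient r p

  -- This is (t - r) Q(t) = t p(t) - r p(r) for the quotient Q, written without subtraction so that
  -- it is an identity of semirings.
  eval-quotient : ∀ {m} (p : Vec Carrier m) r t →
    t * eval p t + r * eval (quotient r p) t ≈ r * eval p r + t * eval (quotient r p) t
  eval-quotient []      r t = solve 2 (λ r t → t :* con 0 :+ r :* con 0 := r :* con 0 :+ t :* con 0) refl r t
  eval-quotient (b ∷ p) r t = begin
    t * (b + t * P) + r * ((b + r * S) + t * Q)
      ≈⟨ solve 6 (λ b r t P Q S → t :* (b :+ t :* P) :+ r :* ((b :+ r :* S) :+ t :* Q)
           := t :* b :+ r :* (b :+ r :* S) :+ t :* (t :* P :+ r :* Q)) refl b r t P Q S ⟩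
    t * b + r * (b + r * S) + t * (t * P + r * Q)
      ≈⟨ +-congˡ (*-congˡ (eval-quotient p r t)) ⟩
    t * b + r * (b + r * S) + t * (r * S + t * Q)
      ≈⟨ solve 6 (λ b r t P Q S → t :* b :+ r :* (b :+ r :* S) :+ t :* (r :* S :+ t :* Q)
           := r :* (b :+ r :* S) :+ t :* ((b :+ r :* S) :+ t :* Q)) refl b r t P Q S ⟩
    r * (b + r * S) + t * ((b + r * S) + t * Q) ∎
    where
    P = eval p t
    S = eval p r
    Q = eval (quotient r p) t

  -- The entries of the quotient are the values at `r` of the successive tails of `p`, so two
  -- neighbouring entries determine a coefficient of `p`.
  coefficients-zero : ∀ {m} (p : Vec Carrier m) r → All (_≈ 0#) (quotient r p) → All (_≈ 0#) p
  coefficients-zero []      r []         = []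
  coefficients-zero (b ∷ p) r (z ∷ zs) = b≈0 zs ∷ coefficients-zero p r zs
    where
    S≈0 : ∀ {k} (s : Vec Carrier k) → All (_≈ 0#) (quotient r s) → eval s r ≈ 0#
    S≈0 []      []      = refl
    S≈0 (_ ∷ _) (z ∷ _) = z
    b≈0 : All (_≈ 0#) (quotient r p) → b ≈ 0#
    b≈0 zs = begin
      b                ≈⟨ solve 2 (λ b r → b := b :+ r :* con 0) refl b r ⟩
      b + r * 0#       ≈⟨ +-congˡ (*-congˡ (sym (S≈0 p zs))) ⟩
      b + r * eval p r ≈⟨ z ⟩
      0#               ∎

  monomial : ∀ m → Vec Carrier (suc m)
  monomial zero    = 1# ∷ []
  monomial (suc m) = 0# ∷ monomial m

  eval-monomial : ∀ m t → eval (monomial m) t ≈ t ^ m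
  eval-monomial zero    t = solve 1 (λ t → con 1 :+ t :* con 0 := con 1) refl t
  eval-monomial (suc m) t = trans (+-identityˡ _) (*-congˡ (eval-monomial m t))

  monomial-nonzero : ∀ m → All (_≈ 0#) (monomial m) → 1# ≈ 0#
  monomial-nonzero zero    (z ∷ [])  = z
  monomial-nonzero (suc m) (_ ∷ zs) = monomial-nonzero m zs

module RootCount {q} (F : FiniteField q) where
  open FiniteField F hiding (zero)
  open Decide F
  open Polynomial commutativeRing public
  open import Algebra.Properties.CommutativeSemiring.Exp commutativeSemiring using (_^_)
  open import Algebra.Properties.Group +-group using (∙-cancelˡ)
  open import Algebra.Properties.Ring ring using (-1*x≈-x)
  open import Relation.Binary.Reasoning.Setoid setoid
  open import Algebra.Solver.Ring.NaturalCoefficients.Default commutativeSemiring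

  -- Division by X - f 0 gives a quotient with one coefficient less. By `cross` it vanishes at each
  -- remaining point, because F has no zero divisors, and induction applies.
  vanishing : ∀ {m} (p : Vec Carrier m) (f : Fin m → Carrier) →
    (∀ {i j} → f i ≈ f j → i ≡ j) → (∀ i → eval p (f i) ≈ 0#) → All (_≈ 0#) p
  vanishing []          f inj root = []
  vanishing {suc m} (a ∷ p) f inj root = a≈0 ∷ p≈0
    where
    r = f zero
    Q : Carrier → Carrier
    Q = eval (quotient r p)
    cross : ∀ i → r * Q (f i) ≈ f i * Q (f i)
    cross i = ∙-cancelˡ (a + r * eval p r) _ _ (begin
      (a + r * eval p r) + r * Q t    ≈⟨ +-congʳ (trans (root zero) (sym (root i))) ⟩
      (a + t * eval p t) + r * Q t    ≈⟨ +-assoc _ _ _ ⟩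
      a + (t * eval p t + r * Q t)    ≈⟨ +-congˡ (eval-quotient p r t) ⟩
      a + (r * eval p r + t * Q t)    ≈⟨ +-assoc _ _ _ ⟨
      (a + r * eval p r) + t * Q t    ∎)
      where t = f i
    Q-root : ∀ i → Q (f (suc i)) ≈ 0#
    Q-root i with Q (f (suc i)) ≈? 0#
    ... | yes Q≈0 = Q≈0
    ... | no Q≉0  with inj (cancelˡ Q≉0 (trans (*-comm _ r) (trans (cross (suc i)) (*-comm _ _))))
    ...   | ()
    p≈0 : All (_≈ 0#) p
    p≈0 = coefficients-zero p r (vanishing (quotient r p) (f ∘ suc) (Fin.suc-injective ∘ inj) Q-root)
    eval-zero : ∀ {k} (s : Vec Carrier k) → All (_≈ 0#) s → ∀ t → eval s t ≈ 0#
    eval-zero []      []       t = refl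
    eval-zero (b ∷ s) (z ∷ zs) t = begin
      b + t * eval s t ≈⟨ +-cong z (*-congˡ (eval-zero s zs t)) ⟩
      0# + t * 0#      ≈⟨ solve 1 (λ t → con 0 :+ t :* con 0 := con 0) refl t ⟩
      0#               ∎
    a≈0 : a ≈ 0#
    a≈0 = begin
      a                ≈⟨ solve 2 (λ a r → a := a :+ r :* con 0) refl a r ⟩
      a + r * 0#       ≈⟨ +-congˡ (*-congˡ (sym (eval-zero p p≈0 r))) ⟩
      a + r * eval p r ≈⟨ root zero ⟩
      0#               ∎

  -- If N < q, then X^N - X would have N + 1 coefficients and N + 1 distinct roots, so its leading
  -- coefficient 1 would be 0.
  order-bound : ∀ N → 2 ℕ.≤ N → (∀ t → t ^ N ≈ t) → q ℕ.≤ N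
  order-bound (suc zero) (ℕ.s≤s ())
  order-bound (suc (suc m)) _ fixed with q ℕ.≤? suc (suc m)
  ... | yes q≤N = q≤N
  ... | no q≰N  = ⊥-elim (1≉0 (monomial-nonzero m (zeros (vanishing p f f-inj root))))
    where
    N<q = ℕ.≰⇒> q≰N
    -- X^N - X for N = 2 + m. The bound 2 ≤ N keeps the coefficient of X apart from the leading one.
    p : Vec Carrier (3 ℕ.+ m)
    p = 0# ∷ (- 1#) ∷ monomial m
    f : Fin (3 ℕ.+ m) → Carrier
    f i = enum (inject≤ i N<q)
    f-inj : ∀ {i j} → f i ≈ f j → i ≡ j
    f-inj {i} {j} eq = Fin.inject≤-injective N<q N<q i j (injective eq)
    root : ∀ i → eval p (f i) ≈ 0#
    root i = begin
      0# + t * (- 1# + t * eval (monomial m) t) ≈⟨ +-identityˡ _ ⟩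
      t * (- 1# + t * eval (monomial m) t)      ≈⟨ *-congˡ (+-congˡ (*-congˡ (eval-monomial m t))) ⟩
      t * (- 1# + t * t ^ m)                    ≈⟨ distribˡ _ _ _ ⟩
      t * - 1# + t ^ (2 ℕ.+ m)                  ≈⟨ +-cong (trans (*-comm _ _) (-1*x≈-x t)) (fixed t) ⟩
      - t + t                                   ≈⟨ -‿inverseˡ t ⟩
      0#                                        ∎
      where t = f i
    zeros : All (_≈ 0#) p → All (_≈ 0#) (monomial m)
    zeros (_ ∷ _ ∷ zs) = zs

-- The coefficients of (x + y)^m - x^m.
binomials : ∀ m → Vec ℕ m
binomials zero    = []
binomials (suc m) = Vec.zipWith ℕ._+_ (0 ∷ binomials m) (binomials m Vec.∷ʳ 1)

module Binomial (R : CommutativeRing 0ℓ 0ℓ) where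
  open CommutativeRing R hiding (zero)
  open import Algebra.Properties.CommutativeSemiring.Exp commutativeSemiring using (_^_)
  open import Algebra.Properties.Semiring.Mult semiring using (×-homo-+; ×-comm-*) renaming (_×_ to _·_)
  open import Relation.Binary.Reasoning.Setoid setoid
  open import Algebra.Solver.Ring.NaturalCoefficients.Default commutativeSemiring

  -- The form Σ cᵢ xⁱ y^(m-i) over i < m. The term x^m is absent, in accordance with `binomials`.
  homogeneous : ∀ {m} → Vec ℕ m → Carrier → Carrier → Carrier
  homogeneous             []      x y = 0#
  homogeneous {suc m} (c ∷ r) x y = c · y ^ suc m + x * homogeneous r x y

  homogeneous-+ : ∀ {m} (r s : Vec ℕ m) x y →
    homogeneous (Vec.zipWith ℕ._+_ r s) x y ≈ homogeneous r x y + homogeneous s x y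
  homogeneous-+         []      []      x y = sym (+-identityˡ 0#)
  homogeneous-+ {suc m} (c ∷ r) (d ∷ s) x y = begin
    (c ℕ.+ d) · Y + x * homogeneous (Vec.zipWith ℕ._+_ r s) x y
      ≈⟨ +-cong (×-homo-+ Y c d) (*-congˡ (homogeneous-+ r s x y)) ⟩
    (c · Y + d · Y) + x * (homogeneous r x y + homogeneous s x y)
      ≈⟨ solve 5 (λ a b x p q → (a :+ b) :+ x :* (p :+ q) := (a :+ x :* p) :+ (b :+ x :* q)) refl _ _ _ _ _ ⟩
    (c · Y + x * homogeneous r x y) + (d · Y + x * homogeneous s x y) ∎
    where Y = y ^ suc m

  -- Multiplication by y keeps the list of coefficients, and the appended 1 accounts for y times the
  -- absent term x^m. With the prefixed 0 for multiplication by x this is Pascal's rule as used in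
  -- `binomials`.
  homogeneous-snoc : ∀ {m} (r : Vec ℕ m) x y →
    homogeneous (r Vec.∷ʳ 1) x y ≈ y * homogeneous r x y + y * x ^ m
  homogeneous-snoc         []      x y =
    solve 2 (λ x y → (y :* con 1 :+ con 0) :+ x :* con 0 := y :* con 0 :+ y :* con 1) refl x y
  homogeneous-snoc {suc m} (c ∷ r) x y = begin
    c · (y * Y) + x * homogeneous (r Vec.∷ʳ 1) x y
      ≈⟨ +-cong (sym (×-comm-* c y Y)) (*-congˡ (homogeneous-snoc r x y)) ⟩
    y * (c · Y) + x * (y * H + y * x ^ m)
      ≈⟨ solve 5 (λ y a x h z → y :* a :+ x :* (y :* h :+ y :* z) := y :* (a :+ x :* h) :+ y :* (x :* z)) refl _ _ _ _ _ ⟩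
    y * (c · Y + x * H) + y * (x * x ^ m) ∎
    where
    Y = y ^ suc m
    H = homogeneous r x y

  binomial : ∀ m x y → (x + y) ^ m ≈ x ^ m + homogeneous (binomials m) x y
  binomial zero    x y = sym (+-identityʳ 1#)
  binomial (suc m) x y = begin
    (x + y) * (x + y) ^ m
      ≈⟨ *-congˡ (binomial m x y) ⟩
    (x + y) * (x ^ m + H)
      ≈⟨ solve 4 (λ x y z h → (x :+ y) :* (z :+ h) := x :* z :+ ((con 0 :+ x :* h) :+ (y :* h :+ y :* z))) refl x y (x ^ m) H ⟩
    x ^ suc m + (homogeneous (0 ∷ binomials m) x y + (y * H + y * x ^ m))
      ≈⟨ +-congˡ (+-congˡ (homogeneous-snoc (binomials m) x y)) ⟨
    x ^ suc m + (homogeneous (0 ∷ binomials m) x y + homogeneous (binomials m Vec.∷ʳ 1) x y)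
      ≈⟨ +-congˡ (homogeneous-+ (0 ∷ binomials m) (binomials m Vec.∷ʳ 1) x y) ⟨
    x ^ suc m + homogeneous (binomials (suc m)) x y ∎
    where H = homogeneous (binomials m) x y

-- (X + 1)^q - X^q - 1 has degree less than q and vanishes on all of F, so its
-- coefficients are zero in F.
module FrobeniusCoefficients {q} (F : FiniteField (suc q)) where
  open FiniteField F hiding (zero)
  open Fermat F using (fermat)
  open RootCount F
  open Binomial commutativeRing
  open import Algebra.Properties.CommutativeSemiring.Exp commutativeSemiring using (_^_)
  open import Algebra.Properties.Semiring.Mult semiring using (×-congʳ) renaming (_×_ to _·_)
  open import Algebra.Properties.Group +-group using (∙-cancelˡ)
  open import Relation.Binary.Reasoning.Setoid setoid

  one-pow : ∀ m → 1# ^ m ≈ 1#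
  one-pow zero    = refl
  one-pow (suc m) = trans (*-identityˡ _) (one-pow m)

  scalars : ∀ {m} → Vec ℕ m → Vec Carrier m
  scalars = Vec.map (_· 1#)

  homogeneous-1 : ∀ {m} (r : Vec ℕ m) t → homogeneous r t 1# ≈ eval (scalars r) t
  homogeneous-1         []      t = refl
  homogeneous-1 {suc m} (c ∷ r) t = +-cong (×-congʳ c (one-pow (suc m))) (*-congˡ (homogeneous-1 r t))

  -- The condition concerns multiples of 1 in F itself, so that it passes to every F-algebra: the
  -- coefficient of y^q becomes 1 and the mixed terms disappear.
  Frobenius : Vec ℕ (suc q) → Set
  Frobenius (c ∷ r) = (c · 1# ≈ 1#) × All (λ d → d · 1# ≈ 0#) r

  frobenius-coefficients : Frobenius (binomials (suc q))
  frobenius-coefficients with binomials (suc q) | binomial (suc q)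
  ... | c ∷ r | expand = lemma (vanishing p enum injective root)
    where
    p = (- 1# + c · 1#) ∷ scalars r
    root : ∀ i → eval p (enum i) ≈ 0#
    root i = begin
      (- 1# + c · 1#) + t * eval (scalars r) t ≈⟨ +-assoc _ _ _ ⟩
      - 1# + eval (scalars (c ∷ r)) t          ≈⟨ +-congˡ (homogeneous-1 (c ∷ r) t) ⟨
      - 1# + homogeneous (c ∷ r) t 1#          ≈⟨ +-congˡ (∙-cancelˡ t _ _ (begin
        t + homogeneous (c ∷ r) t 1#             ≈⟨ +-congʳ (fermat t) ⟨
        t ^ suc q + homogeneous (c ∷ r) t 1#     ≈⟨ expand t 1# ⟨
        (t + 1#) ^ suc q                         ≈⟨ fermat (t + 1#) ⟩
        t + 1#                                   ∎)) ⟩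
      - 1# + 1#                                ≈⟨ -‿inverseˡ 1# ⟩
      0#                                       ∎
      where t = enum i
    map⁻ : ∀ {m} (s : Vec ℕ m) → All (_≈ 0#) (scalars s) → All (λ d → d · 1# ≈ 0#) s
    map⁻ []      []       = []
    map⁻ (_ ∷ s) (z ∷ zs) = z ∷ map⁻ s zs
    lemma : All (_≈ 0#) p → Frobenius (c ∷ r)
    lemma (z ∷ zs) = ∙-cancelˡ (- 1#) _ _ (trans z (sym (-‿inverseˡ 1#))) , map⁻ r zs

-- Quotients of polynomial rings

-- Evaluation of a polynomial at the operator C.  It mentions only the raw
-- operations, so that it is unchanged when the equality is made coarser.
horner : {A V : Set} (_•_ : A → V → V) (_⊕_ : V → V → V) (𝟎 : V) (C : V → V) →
  ∀ {m} → (Fin m → A) → V → V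
horner _•_ _⊕_ 𝟎 C {zero}  p v = 𝟎
horner _•_ _⊕_ 𝟎 C {suc m} p v = (p zero • v) ⊕ C (horner _•_ _⊕_ 𝟎 C (p ∘ suc) v)

record OperatorModule (K : CommutativeRing 0ℓ 0ℓ) : Set₁ where
  private module K = CommutativeRing K
  infixr 7 _•_
  field
    abelianGroup : AbelianGroup 0ℓ 0ℓ
  open AbelianGroup abelianGroup public
    renaming (Carrier to V; _∙_ to infixl 6 _⊕_; ε to 𝟎; ∙-cong to ⊕-cong; ∙-congˡ to ⊕-congˡ; ∙-congʳ to ⊕-congʳ)
  field
    _•_         : K.Carrier → V → V
    •-cong      : ∀ {a b v w} → a K.≈ b → v ≈ w → a • v ≈ b • w
    •-distribˡ  : ∀ a v w → a • (v ⊕ w) ≈ a • v ⊕ a • w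
    •-distribʳ  : ∀ a b v → (a K.+ b) • v ≈ a • v ⊕ b • v
    •-assoc     : ∀ a b v → (a K.* b) • v ≈ a • (b • v)
    •-identity  : ∀ v → K.1# • v ≈ v
    C           : V → V
    C-cong      : ∀ {v w} → v ≈ w → C v ≈ C w
    C-⊕         : ∀ v w → C (v ⊕ w) ≈ C v ⊕ C w
    C-•         : ∀ a v → C (a • v) ≈ a • C v
    e           : V

  act : ∀ {m} → (Fin m → K.Carrier) → V → V
  act = horner _•_ _⊕_ 𝟎 C

-- A quotient of K[X], on which X acts as C.
record CyclicModule (K : CommutativeRing 0ℓ 0ℓ) : Set₁ where
  private module K = CommutativeRing K
  field
    operatorModule : OperatorModule K
  open OperatorModule operatorModule public
  field
    rank        : ℕ
    coords      : V → Fin rank → K.Carrier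
    act-coords  : ∀ v → act (coords v) e ≈ v

module CyclicAlgebra {K : CommutativeRing 0ℓ 0ℓ} (M : CyclicModule K) where
  private module K = CommutativeRing K
  open CyclicModule M
  open import Algebra.Properties.Group group using (identityˡ-unique)
  open import Algebra.Properties.CommutativeSemigroup
    (AbelianGroup.commutativeSemigroup abelianGroup) using (interchange)
  open import Relation.Binary.Reasoning.Setoid setoid

  additive-zero : (g : V → V) → (∀ {v w} → v ≈ w → g v ≈ g w) →
    (∀ v w → g (v ⊕ w) ≈ g v ⊕ g w) → g 𝟎 ≈ 𝟎
  additive-zero g g-cong g-⊕ =
    identityˡ-unique _ _ (trans (sym (g-⊕ 𝟎 𝟎)) (g-cong (identityˡ 𝟎)))

  C-𝟎 : C 𝟎 ≈ 𝟎
  C-𝟎 = additive-zero C C-cong C-⊕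

  •-zeroˡ : ∀ v → K.0# • v ≈ 𝟎
  •-zeroˡ v = identityˡ-unique _ _
    (trans (sym (•-distribʳ K.0# K.0# v)) (•-cong (K.+-identityˡ K.0#) refl))

  •-zeroʳ : ∀ a → a • 𝟎 ≈ 𝟎
  •-zeroʳ a = additive-zero (a •_) (•-cong K.refl) (•-distribˡ a)

  act-cong : ∀ {m} {p r : Fin m → K.Carrier} {v w} → (∀ i → p i K.≈ r i) → v ≈ w → act p v ≈ act r w
  act-cong {zero}  p≈r v≈w = refl
  act-cong {suc m} p≈r v≈w = ⊕-cong (•-cong (p≈r zero) v≈w) (C-cong (act-cong (p≈r ∘ suc) v≈w))

  act-congʳ : ∀ {m} (p : Fin m → K.Carrier) {v w} → v ≈ w → act p v ≈ act p w
  act-congʳ p = act-cong {p = p} (λ _ → K.refl)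

  act-⊕ : ∀ {m} (p : Fin m → K.Carrier) v w → act p (v ⊕ w) ≈ act p v ⊕ act p w
  act-⊕ {zero}  p v w = sym (identityˡ 𝟎)
  act-⊕ {suc m} p v w = begin
    p zero • (v ⊕ w) ⊕ C (act (p ∘ suc) (v ⊕ w))
      ≈⟨ ⊕-cong (•-distribˡ _ v w) (trans (C-cong (act-⊕ (p ∘ suc) v w)) (C-⊕ _ _)) ⟩
    (p zero • v ⊕ p zero • w) ⊕ (C (act (p ∘ suc) v) ⊕ C (act (p ∘ suc) w))
      ≈⟨ interchange _ _ _ _ ⟩
    (p zero • v ⊕ C (act (p ∘ suc) v)) ⊕ (p zero • w ⊕ C (act (p ∘ suc) w)) ∎

  act-distribʳ : ∀ {m} (p r : Fin m → K.Carrier) v → act (λ i → p i K.+ r i) v ≈ act p v ⊕ act r v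
  act-distribʳ {zero}  p r v = sym (identityˡ 𝟎)
  act-distribʳ {suc m} p r v = begin
    (p zero K.+ r zero) • v ⊕ C (act (λ i → p (suc i) K.+ r (suc i)) v)
      ≈⟨ ⊕-cong (•-distribʳ _ _ v) (trans (C-cong (act-distribʳ (p ∘ suc) (r ∘ suc) v)) (C-⊕ _ _)) ⟩
    (p zero • v ⊕ r zero • v) ⊕ (C (act (p ∘ suc) v) ⊕ C (act (r ∘ suc) v))
      ≈⟨ interchange _ _ _ _ ⟩
    (p zero • v ⊕ C (act (p ∘ suc) v)) ⊕ (r zero • v ⊕ C (act (r ∘ suc) v)) ∎

  act-scale : ∀ {m} a (p : Fin m → K.Carrier) v → act (λ i → a K.* p i) v ≈ a • act p v
  act-scale {zero}  a p v = sym (•-zeroʳ a)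
  act-scale {suc m} a p v = begin
    (a K.* p zero) • v ⊕ C (act (λ i → a K.* p (suc i)) v)
      ≈⟨ ⊕-cong (•-assoc _ _ v) (trans (C-cong (act-scale a (p ∘ suc) v)) (C-• _ _)) ⟩
    a • (p zero • v) ⊕ a • C (act (p ∘ suc) v) ≈⟨ •-distribˡ a _ _ ⟨
    a • (p zero • v ⊕ C (act (p ∘ suc) v))     ∎

  act-𝟎 : ∀ {m} (p : Fin m → K.Carrier) → act p 𝟎 ≈ 𝟎
  act-𝟎 p = additive-zero (act p) (act-congʳ p) (act-⊕ p)

  act-zero : ∀ {m} {p : Fin m → K.Carrier} {v} → (∀ i → p i K.≈ K.0#) → act p v ≈ 𝟎
  act-zero {zero}          p≈0 = refl
  act-zero {suc m} {v = v} p≈0 = trans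
    (⊕-cong (trans (•-cong (p≈0 zero) refl) (•-zeroˡ v)) (trans (C-cong (act-zero (p≈0 ∘ suc))) C-𝟎))
    (identityˡ 𝟎)

  act-C : ∀ {m} (p : Fin m → K.Carrier) v → act p (C v) ≈ C (act p v)
  act-C {zero}  p v = sym C-𝟎
  act-C {suc m} p v = begin
    p zero • C v ⊕ C (act (p ∘ suc) (C v)) ≈⟨ ⊕-cong (sym (C-• _ v)) (C-cong (act-C (p ∘ suc) v)) ⟩
    C (p zero • v) ⊕ C (C (act (p ∘ suc) v)) ≈⟨ C-⊕ _ _ ⟨
    C (p zero • v ⊕ C (act (p ∘ suc) v))   ∎

  act-• : ∀ {m} (p : Fin m → K.Carrier) a v → act p (a • v) ≈ a • act p v
  act-• {zero}  p a v = sym (•-zeroʳ a)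
  act-• {suc m} p a v = begin
    p zero • (a • v) ⊕ C (act (p ∘ suc) (a • v))
      ≈⟨ ⊕-cong (trans (sym (•-assoc _ _ v)) (•-cong (K.*-comm _ _) refl)) (C-cong (act-• (p ∘ suc) a v)) ⟩
    (a K.* p zero) • v ⊕ C (a • act (p ∘ suc) v)  ≈⟨ ⊕-cong (•-assoc _ _ v) (C-• _ _) ⟩
    a • (p zero • v) ⊕ a • C (act (p ∘ suc) v)    ≈⟨ •-distribˡ a _ _ ⟨
    a • (p zero • v ⊕ C (act (p ∘ suc) v))        ∎

  -- Polynomials in the single operator `C` commute. Commutativity and associativity of the product
  -- below both rest on this.
  act-act : ∀ {m n} (p : Fin m → K.Carrier) (r : Fin n → K.Carrier) v → act p (act r v) ≈ act r (act p v)
  act-act {zero}  p r v = sym (act-𝟎 r)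
  act-act {suc m} p r v = begin
    p zero • act r v ⊕ C (act (p ∘ suc) (act r v))
      ≈⟨ ⊕-cong (sym (act-• r _ v)) (C-cong (act-act (p ∘ suc) r v)) ⟩
    act r (p zero • v) ⊕ C (act r (act (p ∘ suc) v)) ≈⟨ ⊕-congˡ (sym (act-C r _)) ⟩
    act r (p zero • v) ⊕ act r (C (act (p ∘ suc) v)) ≈⟨ act-⊕ r _ _ ⟨
    act r (p zero • v ⊕ C (act (p ∘ suc) v))         ∎

  infixl 7 _*_
  -- `coords` need not respect `≈`, so the left factor acts through a chosen polynomial.
  -- Independence of that choice follows from `*-comm`, which moves the left factor to the right.
  _*_ : V → V → V
  v * w = act (coords v) w

  *-comm : ∀ v w → v * w ≈ w * v
  *-comm v w = begin
    act (coords v) w                      ≈⟨ act-congʳ (coords v) (act-coords w) ⟨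
    act (coords v) (act (coords w) e)     ≈⟨ act-act (coords v) (coords w) e ⟩
    act (coords w) (act (coords v) e)     ≈⟨ act-congʳ (coords w) (act-coords v) ⟩
    act (coords w) v                      ∎

  *-congˡ : ∀ u {v w} → v ≈ w → u * v ≈ u * w
  *-congˡ u = act-congʳ (coords u)

  *-cong : ∀ {u v w x} → u ≈ v → w ≈ x → u * w ≈ v * x
  *-cong {u} {v} {w} {x} u≈v w≈x = begin
    u * w ≈⟨ *-congˡ u w≈x ⟩
    u * x ≈⟨ *-comm u x ⟩
    x * u ≈⟨ *-congˡ x u≈v ⟩
    x * v ≈⟨ *-comm x v ⟩
    v * x ∎

  *-assoc : ∀ u v w → (u * v) * w ≈ u * (v * w)
  *-assoc u v w = begin
    (u * v) * w ≈⟨ *-comm _ w ⟩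
    w * (u * v) ≈⟨ act-act (coords w) (coords u) v ⟩
    u * (w * v) ≈⟨ *-congˡ u (*-comm w v) ⟩
    u * (v * w) ∎

  *-distribˡ : ∀ u v w → u * (v ⊕ w) ≈ u * v ⊕ u * w
  *-distribˡ u = act-⊕ (coords u)

  algebra : CommutativeRing 0ℓ 0ℓ
  algebra = record
    { _+_ = _⊕_ ; _*_ = _*_ ; -_ = _⁻¹ ; 0# = 𝟎 ; 1# = e
    ; isCommutativeRing = record
      { isRing = record
        { +-isAbelianGroup = isAbelianGroup
        ; *-cong = *-cong
        ; *-assoc = *-assoc
        ; *-identity = (λ v → trans (*-comm e v) (act-coords v)) , act-coords
        ; distrib = *-distribˡ , λ u v w →
            trans (*-comm _ u) (trans (*-distribˡ u v w) (⊕-cong (*-comm u v) (*-comm u w)))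
        }
      ; *-comm = *-comm
      }
    }

  act-* : ∀ {m} (p : Fin m → K.Carrier) v → act p v ≈ act p e * v
  act-* p v = begin
    act p v                       ≈⟨ act-congʳ p (act-coords v) ⟨
    act p (act (coords v) e)      ≈⟨ act-act p (coords v) e ⟩
    v * act p e                   ≈⟨ *-comm v _ ⟩
    act p e * v                   ∎

  C-* : ∀ v w → C v * w ≈ C (v * w)
  C-* v w = trans (*-comm _ w) (trans (act-C (coords w) v) (C-cong (*-comm w v)))

  •-* : ∀ a v w → (a • v) * w ≈ a • (v * w)
  •-* a v w = trans (*-comm _ w) (trans (act-• (coords w) a v) (•-cong K.refl (*-comm w v)))

  x : V
  x = C e

  C-x : ∀ v → C v ≈ x * v
  C-x v = sym (trans (C-* e v) (C-cong (trans (*-comm e v) (act-coords v))))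

  open import Algebra.Properties.CommutativeSemiring.Exp
    (CommutativeRing.commutativeSemiring algebra) public using (_^_; ^-congˡ; ^-assocʳ; ^-distrib-*)
  open import Algebra.Properties.CommutativeSemiring.Exp K.commutativeSemiring using () renaming (_^_ to _^ᴷ_)

  •-^ : ∀ a v m → (a • v) ^ m ≈ (a ^ᴷ m) • (v ^ m)
  •-^ a v zero    = sym (•-identity e)
  •-^ a v (suc m) = begin
    (a • v) * (a • v) ^ m           ≈⟨ •-* a v _ ⟩
    a • (v * (a • v) ^ m)           ≈⟨ •-cong K.refl (*-congˡ v (•-^ a v m)) ⟩
    a • (v * ((a ^ᴷ m) • v ^ m))    ≈⟨ •-cong K.refl (act-• (coords v) _ _) ⟩
    a • ((a ^ᴷ m) • (v * v ^ m))    ≈⟨ •-assoc _ _ _ ⟨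
    (a K.* a ^ᴷ m) • (v * v ^ m)    ∎

  -- Horner's form exposes the constant term; linear dependence and reduction by a monic relation
  -- need the top term.
  act-init-last : ∀ {m} (p : Fin (suc m) → K.Carrier) →
    act p e ≈ act (p ∘ inject₁) e ⊕ p (fromℕ m) • x ^ m
  act-init-last {zero}  p = trans (⊕-congˡ C-𝟎) (comm _ _)
  act-init-last {suc m} p = begin
    p zero • e ⊕ C (act (p ∘ suc) e)
      ≈⟨ ⊕-congˡ (trans (C-cong (act-init-last (p ∘ suc))) (C-⊕ _ _)) ⟩
    p zero • e ⊕ (C (act (p ∘ suc ∘ inject₁) e) ⊕ C (l • x ^ m))
      ≈⟨ assoc _ _ _ ⟨
    (p zero • e ⊕ C (act (p ∘ suc ∘ inject₁) e)) ⊕ C (l • x ^ m)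
      ≈⟨ ⊕-congˡ (trans (C-• _ _) (•-cong K.refl (C-x _))) ⟩
    (p zero • e ⊕ C (act (p ∘ suc ∘ inject₁) e)) ⊕ l • (x * x ^ m) ∎
    where l = p (suc (fromℕ m))

module Companion (K : CommutativeRing 0ℓ 0ℓ) {d : ℕ} (c : Fin (suc d) → CommutativeRing.Carrier K) where
  open CommutativeRing K hiding (zero)
  open import Algebra.Properties.CommutativeSemigroup +-commutativeSemigroup using (interchange)
  open import Relation.Binary.Reasoning.Setoid setoid

  Vector : Set
  Vector = Fin (suc d) → Carrier

  shift : Vector → Vector
  shift w i = (0# ◂ w) (inject₁ i)

  -- Multiplication by X modulo X^(d+1) - Σ cᵢ Xⁱ.
  times-x : Vector → Vector
  times-x w i = shift w i + w (fromℕ d) * c i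

  one : Vector
  one = 1# ◂ λ _ → 0#

  private
    raw : CommutativeRing 0ℓ 0ℓ
    raw = Pointwise.commutativeRing (Fin (suc d)) K

    times-x-cong : ∀ {v w} → (∀ i → v i ≈ w i) → ∀ i → times-x v i ≈ times-x w i
    times-x-cong v≈w zero    = +-congˡ (*-congʳ (v≈w _))
    times-x-cong v≈w (suc i) = +-cong (v≈w _) (*-congʳ (v≈w _))

    shift-+ : ∀ v w i → shift (λ j → v j + w j) i ≈ shift v i + shift w i
    shift-+ v w zero    = sym (+-identityˡ 0#)
    shift-+ v w (suc i) = refl

    shift-* : ∀ a w i → shift (λ j → a * w j) i ≈ a * shift w i
    shift-* a w zero    = sym (zeroʳ a)
    shift-* a w (suc i) = refl

  -- Extension by 0 allows polynomials with fewer than d + 1 coefficients to be compared with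
  -- vectors of the module.
  coefficient : ∀ {m} → (Fin m → Carrier) → ℕ → Carrier
  coefficient {zero}  p k       = 0#
  coefficient {suc m} p zero    = p zero
  coefficient {suc m} p (suc k) = coefficient (p ∘ suc) k

  coefficient-toℕ : ∀ {m} (p : Fin m → Carrier) i → coefficient p (toℕ i) ≡ p i
  coefficient-toℕ p zero    = ≡.refl
  coefficient-toℕ p (suc i) = coefficient-toℕ (p ∘ suc) i

  coefficient-≥ : ∀ {m} (p : Fin m → Carrier) k → m ℕ.≤ k → coefficient p k ≡ 0#
  coefficient-≥ {zero}  p k       m≤k = ≡.refl
  coefficient-≥ {suc m} p (suc k) (ℕ.s≤s m≤k) = coefficient-≥ (p ∘ suc) k m≤k

  operator : OperatorModule K
  operator = record
    { abelianGroup = CommutativeRing.+-abelianGroup raw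
    ; _•_ = λ a v i → a * v i
    ; •-cong = λ a≈b v≈w i → *-cong a≈b (v≈w i)
    ; •-distribˡ = λ a v w i → distribˡ a (v i) (w i)
    ; •-distribʳ = λ a b v i → distribʳ (v i) a b
    ; •-assoc = λ a b v i → *-assoc a b (v i)
    ; •-identity = λ v i → *-identityˡ (v i)
    ; C = times-x
    ; C-cong = times-x-cong
    ; C-⊕ = λ v w i → trans (+-cong (shift-+ v w i) (distribʳ (c i) _ _)) (interchange _ _ _ _)
    ; C-• = λ a v i → trans (+-cong (shift-* a v i) (*-assoc a _ (c i))) (sym (distribˡ a _ _))
    ; e = one
    }
  open OperatorModule operator using (act)

  -- No reduction takes place up to degree d: before each multiplication by X the top entry is still
  -- 0, so `times-x` is a mere shift.
  act-one : ∀ {m} → m ℕ.≤ suc d → (p : Fin m → Carrier) → ∀ i → act p one i ≈ coefficient p (toℕ i)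
  act-one {zero}  m≤ p i = refl
  act-one {suc m} (ℕ.s≤s m≤d) p i = go i
    where
    IH : ∀ i → act (p ∘ suc) one i ≈ coefficient (p ∘ suc) (toℕ i)
    IH = act-one (ℕ.m≤n⇒m≤1+n m≤d) (p ∘ suc)
    last≈0 : act (p ∘ suc) one (fromℕ d) ≈ 0#
    last≈0 = trans (IH (fromℕ d)) (reflexive (≡.trans
      (≡.cong (coefficient (p ∘ suc)) (Fin.toℕ-fromℕ d)) (coefficient-≥ (p ∘ suc) d m≤d)))
    no-overflow : ∀ i → times-x (act (p ∘ suc) one) i ≈ shift (act (p ∘ suc) one) i
    no-overflow i = trans (+-congˡ (trans (*-congʳ last≈0) (zeroˡ _))) (+-identityʳ _)
    go : ∀ i → act p one i ≈ coefficient p (toℕ i)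
    go zero    = trans (+-cong (*-identityʳ _) (no-overflow zero)) (+-identityʳ _)
    go (suc i) = begin
      p zero * 0# + times-x (act (p ∘ suc) one) (suc i) ≈⟨ +-cong (zeroʳ _) (no-overflow (suc i)) ⟩
      0# + act (p ∘ suc) one (inject₁ i)                ≈⟨ +-identityˡ _ ⟩
      act (p ∘ suc) one (inject₁ i)                     ≈⟨ IH (inject₁ i) ⟩
      coefficient (p ∘ suc) (toℕ (inject₁ i))            ≡⟨ ≡.cong (coefficient (p ∘ suc)) (Fin.toℕ-inject₁ i) ⟩
      coefficient (p ∘ suc) (toℕ i)                      ∎

  companion : CyclicModule K
  companion = record
    { operatorModule = operator
    ; rank = suc d
    ; coords = λ v → v
    ; act-coords = λ v i → trans (act-one ℕ.≤-refl v i) (reflexive (coefficient-toℕ v i))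
    }

module Frobenius {q} (K : FiniteField (suc q)) (M : CyclicModule (FiniteField.commutativeRing K)) where
  private module K = FiniteField K
  open CyclicModule M
  open CyclicAlgebra M
  private module A = CommutativeRing algebra
  open Binomial algebra
  open FrobeniusCoefficients K using (Frobenius; frobenius-coefficients)
  open Fermat K using (fermat-iterated)
  open import Algebra.Properties.Semiring.Mult K.semiring using () renaming (_×_ to _·ᴷ_)
  open import Algebra.Properties.Semiring.Mult A.semiring using () renaming (_×_ to _·_)
  open import Relation.Binary.Reasoning.Setoid setoid

  Q : ℕ
  Q = suc q

  ·-• : ∀ c v → (c ·ᴷ K.1#) • v ≈ c · v
  ·-• zero    v = •-zeroˡ v
  ·-• (suc c) v = trans (•-distribʳ _ _ v) (⊕-cong (•-identity v) (·-• c v))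

  homogeneous-zero : ∀ {m} (r : Vec ℕ m) → All (λ d → d ·ᴷ K.1# K.≈ K.0#) r → ∀ v w → homogeneous r v w ≈ 𝟎
  homogeneous-zero []      []       v w = refl
  homogeneous-zero (d ∷ r) (z ∷ zs) v w = begin
    d · _ ⊕ v * homogeneous r v w ≈⟨ ⊕-cong (trans (sym (·-• d _)) (trans (•-cong z refl) (•-zeroˡ _)))
                                             (*-congˡ v (homogeneous-zero r zs v w)) ⟩
    𝟎 ⊕ v * 𝟎                     ≈⟨ trans (identityˡ _) (A.zeroʳ v) ⟩
    𝟎                             ∎

  homogeneous-frobenius : ∀ r → Frobenius r → ∀ v w → homogeneous r v w ≈ w ^ Q
  homogeneous-frobenius (c ∷ r) (c≈1 , zs) v w = begin
    c · w ^ Q ⊕ v * homogeneous r v w ≈⟨ ⊕-cong (trans (sym (·-• c _)) (trans (•-cong c≈1 refl) (•-identity _)))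
                                               (*-congˡ v (homogeneous-zero r zs v w)) ⟩
    w ^ Q ⊕ v * 𝟎                     ≈⟨ ⊕-congˡ (A.zeroʳ v) ⟩
    w ^ Q ⊕ 𝟎                         ≈⟨ identityʳ _ ⟩
    w ^ Q                             ∎

  frobenius : ∀ v w → (v ⊕ w) ^ Q ≈ v ^ Q ⊕ w ^ Q
  frobenius v w = trans (binomial Q v w)
    (⊕-congˡ (homogeneous-frobenius (binomials Q) frobenius-coefficients v w))

  frobenius-iterated : ∀ n v w → (v ⊕ w) ^ (Q ℕ.^ n) ≈ v ^ (Q ℕ.^ n) ⊕ w ^ (Q ℕ.^ n)
  frobenius-iterated zero    v w = A.distribʳ e v w
  frobenius-iterated (suc n) v w = begin
    (v ⊕ w) ^ (Q ℕ.* N)         ≈⟨ ^-assocʳ (v ⊕ w) Q N ⟨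
    ((v ⊕ w) ^ Q) ^ N           ≈⟨ ^-congˡ N (frobenius v w) ⟩
    (v ^ Q ⊕ w ^ Q) ^ N         ≈⟨ frobenius-iterated n (v ^ Q) (w ^ Q) ⟩
    (v ^ Q) ^ N ⊕ (w ^ Q) ^ N   ≈⟨ ⊕-cong (^-assocʳ v Q N) (^-assocʳ w Q N) ⟩
    v ^ (Q ℕ.* N) ⊕ w ^ (Q ℕ.* N) ∎
    where N = Q ℕ.^ n

  e-^ : ∀ m → e ^ m ≈ e
  e-^ zero    = refl
  e-^ (suc m) = trans (A.*-identityˡ _) (e-^ m)

  module _ (n : ℕ) (x-fixed : x ^ (Q ℕ.^ n) ≈ x) where

    N : ℕ
    N = Q ℕ.^ n

    -- The map v ↦ v^N is additive and multiplicative, fixes scalars by Fermat's theorem and fixes x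
    -- by assumption, hence it fixes every polynomial in x.
    act-fixed : ∀ {m} (p : Fin m → K.Carrier) → act p e ^ N ≈ act p e
    act-fixed {zero}  p = additive-zero (_^ N) (^-congˡ N) (frobenius-iterated n)
    act-fixed {suc m} p = begin
      (p zero • e ⊕ C u) ^ N              ≈⟨ frobenius-iterated n _ _ ⟩
      (p zero • e) ^ N ⊕ C u ^ N          ≈⟨ ⊕-cong (•-^ _ e N) (trans (^-congˡ N (C-x u)) (^-distrib-* x u N)) ⟩
      _ • e ^ N ⊕ x ^ N * u ^ N           ≈⟨ ⊕-cong (•-cong (fermat-iterated n _) (e-^ N)) (*-cong x-fixed (act-fixed (p ∘ suc))) ⟩
      p zero • e ⊕ x * u                  ≈⟨ ⊕-congˡ (C-x u) ⟨
      p zero • e ⊕ C u                    ∎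
      where u = act (p ∘ suc) e

    all-fixed : ∀ v → v ^ N ≈ v
    all-fixed v = trans (sym (^-congˡ N (act-coords v))) (trans (act-fixed (coords v)) (act-coords v))

least : {P : ℕ → Set} → (∀ k → Dec (P k)) → ∀ n → P n →
  ∃ λ d → P d × (∀ {k} → k ℕ.< d → ¬ P k)
least P? n Pn with P? 0
... | yes P0 = 0 , P0 , λ ()
least P? zero    P0 | no ¬P0 = contradiction P0 ¬P0
least P? (suc n) Pn | no ¬P0 with least (P? ∘ suc) n Pn
... | d , Pd , min = suc d , Pd , λ { {zero} _ → ¬P0 ; {suc k} (ℕ.s≤s k<d) → min k<d }

funToFin-cong : ∀ {m} n {f g : Fin n → Fin m} → (∀ i → f i ≡ g i) → funToFin f ≡ funToFin g
funToFin-cong zero    f≗g = ≡.refl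
funToFin-cong (suc n) f≗g = ≡.cong₂ combine (f≗g zero) (funToFin-cong n (f≗g ∘ suc))

module FieldVectors {q} (K : FiniteField q) where
  private module K = FiniteField K

  vectors : ∀ n → Enumeration {Fin n → K.Carrier} (λ v w → ∀ i → v i K.≈ w i) (q ℕ.^ n)
  vectors n = record
    { enum = λ k i → K.enum (finToFun k i)
    ; injective = λ {k} {l} eq → begin
        k                                ≡⟨ Fin.funToFin-finToFin {n} {q} k ⟨
        funToFin (finToFun {q} {n} k)    ≡⟨ funToFin-cong n (λ i → K.injective (eq i)) ⟩
        funToFin (finToFun {q} {n} l)    ≡⟨ Fin.funToFin-finToFin {n} {q} l ⟩
        l                                ∎
    ; index = λ v → funToFin (K.index ∘ v)
    ; enum-index = λ v i → K.trans (K.enum-index (v i))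
        (K.reflexive (≡.cong K.enum (≡.sym (Fin.finToFun-funToFin (K.index ∘ v) i))))
    }
    where
    open ≡.≡-Reasoning

-- If a cyclic algebra over K is a field, it has q^d elements, where d is least
-- such that x^d is a combination of lower powers.
module SimpleExtension {q} (K : FiniteField q) (M : CyclicModule (FiniteField.commutativeRing K))
  (_≈?_ : ∀ v w → Dec (CyclicModule._≈_ M v w))
  (e≉𝟎 : ¬ CyclicModule._≈_ M (CyclicModule.e M) (CyclicModule.𝟎 M))
  (invert : ∀ v → ¬ CyclicModule._≈_ M v (CyclicModule.𝟎 M) →
     ∃ λ w → CyclicModule._≈_ M (CyclicAlgebra._*_ M v w) (CyclicModule.e M)) where
  private module K = FiniteField K
  open CyclicModule M
  open CyclicAlgebra M
  open FieldVectors K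
  open Decide K using () renaming (_≈?_ to _≈ᴷ?_)
  open import Algebra.Properties.Group group using (inverseˡ-unique; inverseʳ-unique)
  open import Relation.Binary.Reasoning.Setoid setoid

  Dependent : ℕ → Set
  Dependent d = ∃ λ (c : Fin d → K.Carrier) → x ^ d ≈ act c e

  dependent? : ∀ d → Dec (Dependent d)
  dependent? d = map′ (λ { (k , eq) → enum k , eq })
    (λ { (c , eq) → index c , trans eq (act-cong (enum-index c) refl) })
    (Fin.any? (λ k → (x ^ d) ≈? act (enum k) e))
    where open Enumeration (vectors d)

  negate : ∀ a v → (K.- a) • v ≈ (a • v) ⁻¹
  negate a v = inverseˡ-unique _ _
    (trans (sym (•-distribʳ _ _ v)) (trans (•-cong (K.-‿inverseˡ a) refl) (•-zeroˡ v)))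

  -- A nonzero leading coefficient could be divided out and would make a power of x below the
  -- minimal degree dependent. So it is 0, and induction removes it.
  independent : ∀ d → (∀ {k} → k ℕ.< d → ¬ Dependent k) →
    (a : Fin d → K.Carrier) → act a e ≈ 𝟎 → ∀ i → a i K.≈ K.0#
  independent (suc d) min a rel = λ i → case i (view i)
    where
    l = a (fromℕ d)
    Y = act (a ∘ inject₁) e
    split : Y ⊕ l • x ^ d ≈ 𝟎
    split = trans (sym (act-init-last a)) rel
    l≈0 : l K.≈ K.0#
    l≈0 with l ≈ᴷ? K.0#
    ... | yes z  = z
    ... | no l≉0 with K.inverse l l≉0
    ...   | l′ , ll′≈1 = contradiction ((λ i → K.- l′ K.* a (inject₁ i)) , (begin
      x ^ d                                  ≈⟨ inverseʳ-unique _ _ (begin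
        l′ • Y ⊕ x ^ d                         ≈⟨ ⊕-congˡ (begin
          x ^ d                                  ≈⟨ •-identity _ ⟨
          K.1# • x ^ d                           ≈⟨ •-cong (K.trans (K.*-comm l′ l) ll′≈1) refl ⟨
          (l′ K.* l) • x ^ d                     ≈⟨ •-assoc _ _ _ ⟩
          l′ • (l • x ^ d)                       ∎) ⟩
        l′ • Y ⊕ l′ • (l • x ^ d)              ≈⟨ •-distribˡ l′ _ _ ⟨
        l′ • (Y ⊕ l • x ^ d)                   ≈⟨ •-cong K.refl split ⟩
        l′ • 𝟎                                 ≈⟨ •-zeroʳ l′ ⟩
        𝟎                                      ∎) ⟩
      (l′ • Y) ⁻¹                            ≈⟨ negate l′ Y ⟨
      (K.- l′) • Y                           ≈⟨ act-scale (K.- l′) (a ∘ inject₁) e ⟨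
      act (λ i → K.- l′ K.* a (inject₁ i)) e ∎)) (min ℕ.≤-refl)
    Y≈𝟎 : Y ≈ 𝟎
    Y≈𝟎 = begin
      Y                  ≈⟨ identityʳ Y ⟨
      Y ⊕ 𝟎              ≈⟨ ⊕-congˡ (trans (•-cong l≈0 refl) (•-zeroˡ _)) ⟨
      Y ⊕ l • x ^ d      ≈⟨ split ⟩
      𝟎                  ∎
    case : ∀ i → View i → a i K.≈ K.0#
    case _ ‵fromℕ       = l≈0
    case _ (‵inject₁ j) = independent d (min ∘ ℕ.m<n⇒m<1+n) (a ∘ inject₁) Y≈𝟎 j

  -- The search ends at `rank` at the latest, since `coords` writes any vector with `rank`
  -- coefficients. Degree 0 would mean that `e` is zero.
  degree : ∃ λ d → Dependent (suc d) × (∀ {k} → k ℕ.< suc d → ¬ Dependent k)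
  degree with least dependent? rank (coords (x ^ rank) , sym (act-coords _))
  ... | zero  , (c , e≈𝟎) , _   = contradiction e≈𝟎 e≉𝟎
  ... | suc d , dep       , min = d , dep , min

  module Presentation (d : ℕ) (c : Fin (suc d) → K.Carrier) (x^d : x ^ suc d ≈ act c e)
    (minimal : ∀ {k} → k ℕ.< suc d → ¬ Dependent k) where

    open Companion K.commutativeRing c using (Vector; companion; shift; times-x; one)
    module A = CyclicModule companion
    module AA = CyclicAlgebra companion

    -- Evaluation at x, an isomorphism from K[X]/(X^(d+1) - Σ cᵢ Xⁱ): `coords` provides preimages
    -- and minimality of the degree gives injectivity. It transfers the count q^(d+1) in one
    -- direction and the inverses in the other.
    θ : Vector → V
    θ w = act w e

    θ-one : θ one ≈ e
    θ-one = begin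
      K.1# • e ⊕ C (act {d} (λ _ → K.0#) e) ≈⟨ ⊕-cong (•-identity e) (trans (C-cong (act-zero {d} (λ _ → K.refl))) C-𝟎) ⟩
      e ⊕ 𝟎                                 ≈⟨ identityʳ e ⟩
      e                                     ∎

    -- Prefixing 0 multiplies by X, and the new top term is rewritten by the relation for x^(d+1).
    -- This is the recipe of `times-x`.
    θ-C : ∀ w → θ (times-x w) ≈ C (θ w)
    θ-C w = sym (begin
      C (act w e)                               ≈⟨ identityˡ _ ⟨
      𝟎 ⊕ C (act w e)                           ≈⟨ ⊕-congʳ (•-zeroˡ e) ⟨
      act (K.0# ◂ w) e                          ≈⟨ act-init-last (K.0# ◂ w) ⟩
      act (shift w) e ⊕ w (fromℕ d) • x ^ suc d ≈⟨ ⊕-congˡ (•-cong K.refl x^d) ⟩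
      act (shift w) e ⊕ w (fromℕ d) • act c e   ≈⟨ ⊕-congˡ (act-scale _ c e) ⟨
      act (shift w) e ⊕ act (λ i → w (fromℕ d) K.* c i) e ≈⟨ act-distribʳ (shift w) (λ i → w (fromℕ d) K.* c i) e ⟨
      act (times-x w) e                         ∎)

    θ-act : ∀ {m} (p : Fin m → K.Carrier) w → θ (A.act p w) ≈ act p (θ w)
    θ-act {zero}  p w = act-zero {suc d} (λ _ → K.refl)
    θ-act {suc m} p w = begin
      θ (λ i → p zero K.* w i K.+ A.C (A.act (p ∘ suc) w) i) ≈⟨ act-distribʳ (λ i → p zero K.* w i) (A.C (A.act (p ∘ suc) w)) e ⟩
      θ (λ i → p zero K.* w i) ⊕ θ (A.C (A.act (p ∘ suc) w)) ≈⟨ ⊕-cong (act-scale _ w e)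
                                                              (trans (θ-C (A.act (p ∘ suc) w)) (C-cong (θ-act (p ∘ suc) w))) ⟩
      p zero • θ w ⊕ C (act (p ∘ suc) (θ w))                ∎

    θ⁻¹ : V → Vector
    θ⁻¹ v = A.act (coords v) one

    θ-θ⁻¹ : ∀ v → θ (θ⁻¹ v) ≈ v
    θ-θ⁻¹ v = trans (θ-act (coords v) one) (trans (act-congʳ (coords v) θ-one) (act-coords v))

    θ-injective : ∀ {v w} → θ v ≈ θ w → v A.≈ w
    θ-injective {v} {w} eq i = x-y≈0⇒x≈y (v i) (w i) (independent (suc d) minimal (λ i → v i K.+ K.- w i) (begin
      act (λ i → v i K.+ K.- w i) e          ≈⟨ act-distribʳ v (λ i → K.- w i) e ⟩
      θ v ⊕ act (λ i → K.- w i) e            ≈⟨ ⊕-cong eq (act-cong (λ j → K.sym (-1*x≈-x (w j))) refl) ⟩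
      θ w ⊕ act (λ i → K.- K.1# K.* w i) e   ≈⟨ ⊕-congˡ (trans (act-scale _ w e) (trans (negate _ _) (⁻¹-cong (•-identity _)))) ⟩
      θ w ⊕ θ w ⁻¹                           ≈⟨ inverseʳ _ ⟩
      𝟎                                      ∎) i)
      where
      open import Algebra.Properties.Ring K.ring using (-1*x≈-x)
      open import Algebra.Properties.Group K.+-group using () renaming (x∙y⁻¹≈ε⇒x≈y to x-y≈0⇒x≈y)

    companion-field : ∀ w → ¬ w A.≈ A.𝟎 → ∃ λ w′ → (w AA.* w′) A.≈ one
    companion-field w w≉𝟎 with invert (θ w) (λ θw≈𝟎 → w≉𝟎 (θ-injective (trans θw≈𝟎 (sym (act-zero {suc d} (λ _ → K.refl))))))
    ... | v , θw*v≈e = θ⁻¹ v , θ-injective (begin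
      θ (A.act w (θ⁻¹ v))      ≈⟨ θ-act w (θ⁻¹ v) ⟩
      act w (θ (θ⁻¹ v))        ≈⟨ act-* w _ ⟩
      θ w * θ (θ⁻¹ v)          ≈⟨ *-congˡ (θ w) (θ-θ⁻¹ v) ⟩
      θ w * v                  ≈⟨ θw*v≈e ⟩
      e                        ≈⟨ θ-one ⟨
      θ one                    ∎)

    finiteField : FiniteField (q ℕ.^ suc d)
    finiteField = record
      { commutativeRing = algebra
      ; enumeration = record
        { enum = θ ∘ E.enum
        ; injective = E.injective ∘ θ-injective
        ; index = E.index ∘ θ⁻¹
        ; enum-index = λ v → trans (sym (θ-θ⁻¹ v)) (act-cong (E.enum-index (θ⁻¹ v)) refl)
        }
      ; 1≉0 = e≉𝟎
      ; inverse = invert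
      }
      where module E = Enumeration (vectors (suc d))

-- Existence of irreducible polynomials

module AnnihilatorQuotient {K : CommutativeRing 0ℓ 0ℓ} (M : CyclicModule K) (z : CyclicModule.V M) where
  private module K = CommutativeRing K
  open CyclicModule M
  open CyclicAlgebra M
  private module A = CommutativeRing algebra
  open import Algebra.Properties.Ring A.ring using (-‿distribʳ-*)

  -- Equality modulo the annihilator of `z`. It is decidable as soon as `≈` is, and all operations
  -- keep their carrier and their definitions.
  _~_ : V → V → Set
  v ~ w = z * v ≈ z * w

  ≈⇒~ : ∀ {v w} → v ≈ w → v ~ w
  ≈⇒~ = *-congˡ z

  quotient : CyclicModule K
  quotient = record
    { operatorModule = record
      { abelianGroup = record
        { _≈_ = _~_ ; _∙_ = _⊕_ ; ε = 𝟎 ; _⁻¹ = _⁻¹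
        ; isAbelianGroup = record
          { isGroup = record
            { isMonoid = record
              { isSemigroup = record
                { isMagma = record
                  { isEquivalence = record { refl = refl ; sym = sym ; trans = trans }
                  ; ∙-cong = λ p r → trans (*-distribˡ z _ _) (trans (⊕-cong p r) (sym (*-distribˡ z _ _)))
                  }
                ; assoc = λ u v w → ≈⇒~ (assoc u v w)
                }
              ; identity = (λ v → ≈⇒~ (identityˡ v)) , (λ v → ≈⇒~ (identityʳ v))
              }
            ; inverse = (λ v → ≈⇒~ (inverseˡ v)) , (λ v → ≈⇒~ (inverseʳ v))
            ; ⁻¹-cong = λ p → trans (sym (-‿distribʳ-* z _)) (trans (⁻¹-cong p) (-‿distribʳ-* z _))
            }
          ; comm = λ v w → ≈⇒~ (comm v w)
          }
        }
      ; _•_ = _•_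
      ; •-cong = λ a≈b p → trans (act-• (coords z) _ _) (trans (•-cong a≈b p) (sym (act-• (coords z) _ _)))
      ; •-distribˡ = λ a v w → ≈⇒~ (•-distribˡ a v w)
      ; •-distribʳ = λ a b v → ≈⇒~ (•-distribʳ a b v)
      ; •-assoc = λ a b v → ≈⇒~ (•-assoc a b v)
      ; •-identity = λ v → ≈⇒~ (•-identity v)
      ; C = C
      ; C-cong = λ p → trans (act-C (coords z) _) (trans (C-cong p) (sym (act-C (coords z) _)))
      ; C-⊕ = λ v w → ≈⇒~ (C-⊕ v w)
      ; C-• = λ a v → ≈⇒~ (C-• a v)
      ; e = e
      }
    ; rank = rank
    ; coords = coords
    ; act-coords = λ v → ≈⇒~ (act-coords v)
    }

  ^-quotient : ∀ v m → CyclicAlgebra._^_ quotient v m ≡ v ^ m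
  ^-quotient v zero    = ≡.refl
  ^-quotient v (suc m) = ≡.cong (v *_) (^-quotient v m)

module LeadingTerm (K : CommutativeRing 0ℓ 0ℓ) {d : ℕ} (c : Fin (suc d) → CommutativeRing.Carrier K) where
  private module K = CommutativeRing K
  open Companion K c
  open CyclicModule companion
  open CyclicAlgebra companion

  -- Monic of degree D, provided that D ≤ d. For larger D both clauses are vacuous, whence the
  -- bounds required below.
  Leading : ℕ → Vector → Set
  Leading D v = (∀ i → toℕ i ≡ D → v i K.≈ K.1#) × (∀ i → D ℕ.< toℕ i → v i K.≈ K.0#)

  leading-cong : ∀ {D v w} → v ≈ w → Leading D v → Leading D w
  leading-cong v≈w (one , zer) =
    (λ i eq → K.trans (K.sym (v≈w i)) (one i eq)) , (λ i lt → K.trans (K.sym (v≈w i)) (zer i lt))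

  leading-one : Leading 0 one
  leading-one = (λ { zero _ → K.refl }) , λ { (suc i) _ → K.refl }

  leading-C : ∀ {D v} → D ℕ.< d → Leading D v → Leading (suc D) (C v)
  leading-C {D} {v} D<d (one , zer) =
    (λ { (suc i) eq → K.trans (no-overflow (suc i)) (one (inject₁ i) (≡.trans (Fin.toℕ-inject₁ i) (ℕ.suc-injective eq))) }) ,
    (λ { (suc i) (ℕ.s≤s lt) → K.trans (no-overflow (suc i)) (zer (inject₁ i) (≡.subst (D ℕ.<_) (≡.sym (Fin.toℕ-inject₁ i)) lt)) })
    where
    no-overflow : ∀ i → C v i K.≈ shift v i
    no-overflow i = K.trans (K.+-congˡ (K.trans
      (K.*-congʳ (zer (fromℕ d) (≡.subst (D ℕ.<_) (≡.sym (Fin.toℕ-fromℕ d)) D<d))) (K.zeroˡ _))) (K.+-identityʳ _)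

  leading-x^ : ∀ k {D v} → k ℕ.+ D ℕ.≤ d → Leading D v → Leading (k ℕ.+ D) (x ^ k * v)
  leading-x^ zero    {D} {v} _  lead = leading-cong (sym (CommutativeRing.*-identityˡ algebra v)) lead
  leading-x^ (suc k) {D} {v} lt lead = leading-cong
    (trans (C-x _) (sym (*-assoc x (x ^ k) v)))
    (leading-C lt (leading-x^ k (ℕ.<⇒≤ lt) lead))

  leading-minus : ∀ {D D′ v w} → D′ ℕ.< D → Leading D v → Leading D′ w → Leading D (v ⊕ w ⁻¹)
  leading-minus D′<D (one , zer) (_ , zer′) =
    (λ i eq → K.trans (K.+-cong (one i eq) (neg i (≡.subst (_ ℕ.<_) (≡.sym eq) D′<D))) (K.+-identityʳ _)) ,
    (λ i lt → K.trans (K.+-cong (zer i lt) (neg i (ℕ.<-trans D′<D lt))) (K.+-identityʳ _))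
    where
    open import Algebra.Properties.Group K.+-group using () renaming (ε⁻¹≈ε to -0≈0)
    neg : ∀ i → _ ℕ.< toℕ i → _
    neg i lt = K.trans (K.-‿cong (zer′ i lt)) -0≈0

  leading-nonzero : ¬ K.1# K.≈ K.0# → ∀ {D v} → D ℕ.≤ d → Leading D v → ¬ v ≈ 𝟎
  leading-nonzero 1≉0 D≤d (one , _) v≈𝟎 =
    1≉0 (K.trans (K.sym (one (fromℕ< (ℕ.s≤s D≤d)) (Fin.toℕ-fromℕ< (ℕ.s≤s D≤d)))) (v≈𝟎 _))

  lastδ : ∀ {m} → Fin (suc m) → K.Carrier
  lastδ {zero}  zero    = K.1#
  lastδ {suc m} zero    = K.0#
  lastδ {suc m} (suc i) = lastδ i

  lastδ-inject₁ : ∀ {m} (i : Fin m) → lastδ (inject₁ i) ≡ K.0#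
  lastδ-inject₁ {suc m} zero    = ≡.refl
  lastδ-inject₁ {suc m} (suc i) = lastδ-inject₁ i

  lastδ-fromℕ : ∀ m → lastδ (fromℕ m) ≡ K.1#
  lastδ-fromℕ zero    = ≡.refl
  lastδ-fromℕ (suc m) = lastδ-fromℕ m

  x^d≈lastδ : x ^ d ≈ lastδ
  x^d≈lastδ = begin
    x ^ d                                                        ≈⟨ •-identity _ ⟨
    K.1# • x ^ d                                                 ≈⟨ •-cong (K.reflexive (lastδ-fromℕ d)) refl ⟨
    lastδ (fromℕ d) • x ^ d                                      ≈⟨ identityˡ _ ⟨
    𝟎 ⊕ lastδ (fromℕ d) • x ^ d                                  ≈⟨ ⊕-congʳ (act-zero {p = lastδ {d} ∘ inject₁} (K.reflexive ∘ lastδ-inject₁)) ⟨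
    act (lastδ {d} ∘ inject₁) e ⊕ lastδ (fromℕ d) • x ^ d        ≈⟨ act-init-last (lastδ {d}) ⟨
    act (lastδ {d}) e                                            ≈⟨ act-coords lastδ ⟩
    lastδ                                                        ∎
    where open import Relation.Binary.Reasoning.Setoid setoid

  x^[1+d]≈c : x ^ suc d ≈ c
  x^[1+d]≈c = trans (sym (C-x (x ^ d))) (trans (C-cong x^d≈lastδ) C-lastδ)
    where
    C-lastδ : ∀ i → C lastδ i K.≈ c i
    C-lastδ i = K.trans (K.+-cong (shift≈0 i)
      (K.trans (K.*-congʳ (K.reflexive (lastδ-fromℕ d))) (K.*-identityˡ _))) (K.+-identityˡ _)
      where
      shift≈0 : ∀ i → shift lastδ i K.≈ K.0#
      shift≈0 zero    = K.refl
      shift≈0 (suc j) = K.reflexive (lastδ-inject₁ j)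

module IrreducibleExists {q} (K : FiniteField (suc q)) (m : ℕ) where
  private module K = FiniteField K
  Q n N : ℕ
  Q = suc q
  n = suc m
  N = Q ℕ.^ n

  -- Irreducibility of X^(k+1) - Σ cᵢ Xⁱ, expressed by the property that is applied later: the
  -- quotient ring is a field.
  Irreducible : ∀ {k} → (Fin (suc k) → K.Carrier) → Set
  Irreducible c = ∀ w → ¬ w ≈ 𝟎 → ∃ λ w′ → w * w′ ≈ e
    where
    open CyclicModule (Companion.companion K.commutativeRing c)
    open CyclicAlgebra (Companion.companion K.commutativeRing c)

  2≤Q : 2 ℕ.≤ Q
  2≤Q = go K.injective (K.enum-index K.0#) (K.enum-index K.1#)
    where
    go : ∀ {r} {f : Fin (suc r) → K.Carrier} {i j} → (∀ {i j} → f i K.≈ f j → i ≡ j) →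
      K.0# K.≈ f i → K.1# K.≈ f j → 2 ℕ.≤ suc r
    go {zero} {i = zero} {j = zero} _ p r = contradiction (K.trans r (K.sym p)) K.1≉0
    go {suc _} _ _ _ = ℕ.s≤s (ℕ.s≤s ℕ.z≤n)

  deg-h : ℕ → ℕ
  deg-h zero    = 0
  deg-h (suc j) = Q ℕ.^ suc j ℕ.+ deg-h j

  -- A sum q + ... + q^j stays below the next power because q ≥ 2. This is what keeps `h` from being
  -- reduced to 0 in B.
  deg-h-bound : ∀ j → deg-h j ℕ.< Q ℕ.^ suc j
  deg-h-bound zero    = ℕ.s≤s ℕ.z≤n
  deg-h-bound (suc j) = begin-strict
    Q ℕ.^ suc j ℕ.+ deg-h j        <⟨ ℕ.+-monoʳ-< (Q ℕ.^ suc j) (deg-h-bound j) ⟩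
    Q ℕ.^ suc j ℕ.+ Q ℕ.^ suc j    ≡⟨ ≡.cong (Q ℕ.^ suc j ℕ.+_) (≡.sym (ℕ.+-identityʳ _)) ⟩
    2 ℕ.* Q ℕ.^ suc j              ≤⟨ ℕ.*-monoˡ-≤ (Q ℕ.^ suc j) 2≤Q ⟩
    Q ℕ.* Q ℕ.^ suc j              ∎
    where open ℕ.≤-Reasoning

  2≤Q^ : ∀ j → 2 ℕ.≤ Q ℕ.^ suc j
  2≤Q^ j = ℕ.≤-trans 2≤Q (ℕ.m≤m*n Q (Q ℕ.^ j) {{ℕ.m^n≢0 Q j}})

  -- B = K[X]/(X^N - X) and h is the product of X^(Q^j) - X for 1 ≤ j ≤ m; the
  -- exponent N is written 2 + d.
  module Construction (d : ℕ) (N≡ : N ≡ suc (suc d)) where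

    δ₁ : Fin (suc (suc d)) → K.Carrier
    δ₁ zero          = K.0#
    δ₁ (suc zero)    = K.1#
    δ₁ (suc (suc _)) = K.0#

    open Companion K.commutativeRing δ₁
    open LeadingTerm K.commutativeRing δ₁
    open CyclicModule companion
    open CyclicAlgebra companion
    private module B = CommutativeRing algebra
    open Frobenius K companion using (all-fixed)
    open Decide K using () renaming (_≈?_ to _≈ᴷ?_)
    open import Relation.Binary.Reasoning.Setoid setoid

    x≈δ₁ : x ≈ δ₁
    x≈δ₁ zero          = K.trans (K.+-congˡ (K.zeroˡ _)) (K.+-identityʳ _)
    x≈δ₁ (suc zero)    = K.trans (K.+-congˡ (K.zeroˡ _)) (K.+-identityʳ _)
    x≈δ₁ (suc (suc i)) = K.trans (K.+-congˡ (K.zeroˡ _)) (K.+-identityʳ _)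

    fixed : ∀ v → v ^ N ≈ v
    fixed = all-fixed n (≡.subst (λ k → x ^ k ≈ x) (≡.sym N≡) (trans x^[1+d]≈c (sym x≈δ₁)))

    _≈?_ : ∀ v w → Dec (v ≈ w)
    v ≈? w = Fin.all? (λ i → v i ≈ᴷ? w i)

    h : ℕ → V
    h zero    = e
    h (suc j) = (x ^ (Q ℕ.^ suc j) ⊕ x ⁻¹) * h j

    -- Multiplying `h j` by X^k - X gives a difference whose first term has the larger degree, as k
    -- ≥ 2. The bound keeps all degrees below N, where nothing is reduced modulo X^N - X.
    leading-h : ∀ j → deg-h j ℕ.≤ suc d → Leading (deg-h j) (h j)
    leading-h zero    _  = leading-one
    leading-h (suc j) le = leading-cong (begin
        x ^ k * h j ⊕ (x ^ 1 * h j) ⁻¹     ≈⟨ ⊕-congˡ (⁻¹-cong (*-cong (B.*-identityʳ x) refl)) ⟩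
        x ^ k * h j ⊕ (x * h j) ⁻¹         ≈⟨ ⊕-congˡ (-‿distribˡ-* x (h j)) ⟩
        x ^ k * h j ⊕ x ⁻¹ * h j           ≈⟨ B.distribʳ (h j) (x ^ k) (x ⁻¹) ⟨
        (x ^ k ⊕ x ⁻¹) * h j               ∎)
      (leading-minus (ℕ.+-monoˡ-≤ (deg-h j) (2≤Q^ j)) (leading-x^ k le IH)
        (leading-x^ 1 (ℕ.≤-trans (ℕ.+-monoˡ-≤ (deg-h j) (ℕ.<⇒≤ (2≤Q^ j))) le) IH))
      where
      open import Algebra.Properties.Ring B.ring using (-‿distribˡ-*)
      k = Q ℕ.^ suc j
      IH = leading-h j (ℕ.≤-trans (ℕ.m≤n+m (deg-h j) k) le)

    h≉𝟎 : ¬ h m ≈ 𝟎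
    h≉𝟎 = leading-nonzero K.1≉0 bound (leading-h m bound)
      where bound = ℕ.s≤s⁻¹ (≡.subst (deg-h m ℕ.<_) N≡ (deg-h-bound m))

    _∣_ : V → V → Set
    v ∣ w = ∃ λ u → w ≈ v * u

    -- Multiply z₀ by each f i in turn unless the product is 0.  Applied to all of B
    -- this makes Ann(z) a maximal ideal, because v ∣ z and v^N ≈ v give z ≈ z v v^(N-2).
    saturate : ∀ {r} (f : Fin r → V) z₀ → ¬ z₀ ≈ 𝟎 →
      ∃ λ z → ¬ z ≈ 𝟎 × z₀ ∣ z × (∀ i → z * f i ≈ 𝟎 ⊎ f i ∣ z)
    saturate {zero}  f z₀ z₀≉𝟎 = z₀ , z₀≉𝟎 , (e , sym (B.*-identityʳ z₀)) , λ ()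
    saturate {suc r} f z₀ z₀≉𝟎 with (z₀ * f zero) ≈? 𝟎
    ... | yes zero-product with saturate (f ∘ suc) z₀ z₀≉𝟎
    ...   | z , z≉𝟎 , (u , z≈) , good = z , z≉𝟎 , (u , z≈) , λ
      { zero → inj₁ (begin
          z * f zero          ≈⟨ *-cong (trans z≈ (*-comm z₀ u)) refl ⟩
          (u * z₀) * f zero   ≈⟨ *-assoc u z₀ _ ⟩
          u * (z₀ * f zero)   ≈⟨ *-congˡ u zero-product ⟩
          u * 𝟎               ≈⟨ B.zeroʳ u ⟩
          𝟎                   ∎)
      ; (suc i) → good i }
    saturate {suc r} f z₀ z₀≉𝟎 | no nonzero with saturate (f ∘ suc) (z₀ * f zero) nonzero
    ...   | z , z≉𝟎 , (u , z≈) , good = z , z≉𝟎 , (f zero * u , trans z≈ (*-assoc z₀ (f zero) u)) , λ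
      { zero → inj₂ (z₀ * u , trans z≈ (trans (*-cong (*-comm z₀ (f zero)) refl) (*-assoc (f zero) z₀ u)))
      ; (suc i) → good i }

    module Quotient (z : V) (z≉𝟎 : ¬ z ≈ 𝟎) (h∣z : h m ∣ z)
      (prime : ∀ v → z * v ≈ 𝟎 ⊎ v ∣ z) where

      open AnnihilatorQuotient companion z
      private module F = CyclicModule quotient
      private module FA = CyclicAlgebra quotient

      fixed₂ : ∀ v → v * (v * v ^ d) ≈ v
      fixed₂ v = trans (reflexive (≡.cong (v ^_) (≡.sym N≡))) (fixed v)

      -- Since `h m` divides `z`, z h = 0 would give z² = 0, and then z = z^N = 0 because N ≥ 2.
      zh≉𝟎 : ¬ z * h m ≈ 𝟎
      zh≉𝟎 zh≈𝟎 = z≉𝟎 (begin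
        z                    ≈⟨ fixed₂ z ⟨
        z * (z * z ^ d)      ≈⟨ *-assoc z z _ ⟨
        (z * z) * z ^ d      ≈⟨ *-cong (begin
          z * z                  ≈⟨ *-congˡ z (proj₂ h∣z) ⟩
          z * (h m * proj₁ h∣z)  ≈⟨ *-assoc z _ _ ⟨
          (z * h m) * proj₁ h∣z  ≈⟨ *-cong zh≈𝟎 refl ⟩
          𝟎 * proj₁ h∣z          ≈⟨ B.zeroˡ _ ⟩
          𝟎                      ∎) refl ⟩
        𝟎 * z ^ d            ≈⟨ B.zeroˡ _ ⟩
        𝟎                    ∎)

      e≁𝟎 : ¬ e ~ 𝟎
      e≁𝟎 eq = z≉𝟎 (trans (sym (B.*-identityʳ z)) (trans eq (B.zeroʳ z)))

      invert : ∀ v → ¬ v ~ 𝟎 → ∃ λ w → (v * w) ~ e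
      invert v v≁𝟎 with prime v
      ... | inj₁ zv≈𝟎     = contradiction (trans zv≈𝟎 (sym (B.zeroʳ z))) v≁𝟎
      ... | inj₂ (u , z≈) = v ^ d , (begin
        z * (v * v ^ d)         ≈⟨ *-cong (trans z≈ (*-comm v u)) refl ⟩
        (u * v) * (v * v ^ d)   ≈⟨ *-assoc u v _ ⟩
        u * (v * (v * v ^ d))   ≈⟨ *-congˡ u (fixed₂ v) ⟩
        u * v                   ≈⟨ trans (*-comm u v) (sym z≈) ⟩
        z                       ≈⟨ B.*-identityʳ z ⟨
        z * e                   ∎)

      open SimpleExtension K quotient (λ v w → (z * v) ≈? (z * w)) e≁𝟎 invert

      module Identify (d′ : ℕ) (c : Fin (suc d′) → K.Carrier) (x^d : (x FA.^ suc d′) ~ F.act c e)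
        (minimal : ∀ {k} → k ℕ.< suc d′ → ¬ Dependent k) where
        open Presentation d′ c x^d minimal using (finiteField; companion-field)

        -- The quotient is a field with q^(d′+1) elements, all of them roots of X^N - X, so q^(d′+1)
        -- ≤ q^n.
        upper : suc d′ ℕ.≤ n
        upper with suc d′ ℕ.≤? n
        ... | yes le = le
        ... | no nle = contradiction
          (RootCount.order-bound finiteField N (2≤Q^ m)
            (λ t → ≈⇒~ (trans (reflexive (^-quotient t N)) (fixed t))))
          (ℕ.<⇒≱ (ℕ.^-monoʳ-< Q 2≤Q (ℕ.≰⇒> nle)))

        root : (x ^ (Q ℕ.^ suc d′) ⊕ x ⁻¹) ~ 𝟎
        root = F.trans (F.⊕-congʳ (F.trans (F.reflexive (≡.sym (^-quotient x (Q ℕ.^ suc d′))))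
          (Fermat.fermat finiteField x))) (F.inverseʳ x)

        -- The factor with exponent q^(d′+1) occurs in `h j` once j > d′, and it vanishes by
        -- Fermat's theorem for the quotient field.
        h-contains : ∀ j → d′ ℕ.< j → h j ~ 𝟎
        h-contains (suc j) (ℕ.s≤s d′≤j) with ℕ.m≤n⇒m<n∨m≡n d′≤j
        ... | inj₁ d′<j  = F.trans (FA.*-congˡ (x ^ (Q ℕ.^ suc j) ⊕ x ⁻¹) (h-contains j d′<j))
                             (CommutativeRing.zeroʳ FA.algebra (x ^ (Q ℕ.^ suc j) ⊕ x ⁻¹))
        ... | inj₂ ≡.refl = F.trans (FA.*-cong {w = h j} root F.refl) (CommutativeRing.zeroˡ FA.algebra (h j))

        -- Otherwise d′ < m, and `h m` would be 0 in the quotient, that is, z h = 0.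
        lower : n ℕ.≤ suc d′
        lower with n ℕ.≤? suc d′
        ... | yes le = le
        ... | no nle = contradiction (trans (h-contains m (ℕ.s≤s⁻¹ (ℕ.≰⇒> nle))) (B.zeroʳ z)) zh≉𝟎

        degree≡ : suc d′ ≡ n
        degree≡ = ℕ.≤-antisym upper lower

        irreducible : ∃ (Irreducible {m})
        irreducible = transport degree≡ companion-field
          where
          transport : ∀ {k} {c : Fin (suc k) → K.Carrier} → suc k ≡ n → Irreducible c → ∃ (Irreducible {m})
          transport {c = c} ≡.refl irr = c , irr

      irreducible : ∃ (Irreducible {m})
      irreducible = let (d′ , (c , x^d) , minimal) = degree in
        Identify.irreducible d′ c x^d minimal

    exists : ∃ (Irreducible {m})
    exists with saturate (Enumeration.enum (FieldVectors.vectors K (suc (suc d)))) (h m) h≉𝟎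
    ... | z , z≉𝟎 , h∣z , good = Quotient.irreducible z z≉𝟎 h∣z prime
      where
      open Enumeration (FieldVectors.vectors K (suc (suc d)))
      prime : ∀ v → z * v ≈ 𝟎 ⊎ v ∣ z
      prime v with good (index v)
      ... | inj₁ zv≈𝟎     = inj₁ (trans (*-congˡ z (enum-index v)) zv≈𝟎)
      ... | inj₂ (u , z≈) = inj₂ (u , trans z≈ (*-cong (sym (enum-index v)) refl))

  irreducible-exists : ∃ (Irreducible {m})
  irreducible-exists = go N (ℕ.≤-trans 2≤Q (ℕ.m≤m*n Q (Q ℕ.^ m) {{ℕ.m^n≢0 Q m}})) ≡.refl
    where
    -- N is a power and does not reduce to a successor. Replacing it by a variable k exposes the
    -- shape 2 + d, which fixes the rank of B.
    go : ∀ k → 2 ℕ.≤ k → N ≡ k → ∃ (Irreducible {m})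
    go (suc (suc d)) _ N≡ = Construction.exists d N≡
    go (suc zero) (ℕ.s≤s ()) _

open ≡ using (refl; sym; trans; cong; cong₂; subst)

-- Finite valuation rings

module _ (A : CommutativeRing 0ℓ 0ℓ) where
  open CommutativeRing A hiding (zero) renaming (refl to ≈-refl; sym to ≈-sym; trans to ≈-trans)
  open import Algebra.Properties.CommutativeSemiring.Exp commutativeSemiring using (_^_)
  open import Algebra.Properties.Group +-group using (∙-cancelʳ)
  open import Relation.Binary.Reasoning.Setoid setoid

  -- The witness is 1 + s + ... + s^(k-1), with the telescoping identity written without
  -- subtraction.
  geometric : ∀ s k → ∃ λ v → v + s ^ k ≈ 1# + s * v
  geometric s zero    = 0# , ≈-trans (+-comm _ _) (+-congˡ (≈-sym (zeroʳ s)))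
  geometric s (suc k) with geometric s k
  ... | v , eq = 1# + s * v , (begin
    (1# + s * v) + s * s ^ k   ≈⟨ +-assoc _ _ _ ⟩
    1# + (s * v + s * s ^ k)   ≈⟨ +-congˡ (distribˡ s v (s ^ k)) ⟨
    1# + s * (v + s ^ k)       ≈⟨ +-congˡ (*-congˡ eq) ⟩
    1# + s * (1# + s * v)      ∎)

  -- Here a = 1 - s, and the geometric sum is its inverse. This lifts inverses modulo π, both in R
  -- and in the extension.
  nilpotent-complement-invertible : ∀ {a s} k → s ^ k ≈ 0# → a + s ≈ 1# → ∃ λ v → a * v ≈ 1#
  nilpotent-complement-invertible {a} {s} k s^k≈0 a+s≈1 with geometric s k
  ... | v , eq = v , ∙-cancelʳ (s * v) _ _ (begin
    a * v + s * v   ≈⟨ distribʳ v a s ⟨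
    (a + s) * v     ≈⟨ *-congʳ a+s≈1 ⟩
    1# * v          ≈⟨ *-identityˡ v ⟩
    v               ≈⟨ +-identityʳ v ⟨
    v + 0#          ≈⟨ +-congˡ s^k≈0 ⟨
    v + s ^ k       ≈⟨ eq ⟩
    1# + s * v      ∎)

module ValuationRing (R : FinCommRing) (π : FinCommRing.Carrier R) (uniformizer : IsUniformizer R π)
  (ℓ : ℕ) (nilDegree : NilDegree R π ℓ) where
  open FinCommRing R public

  ring : CommutativeRing 0ℓ 0ℓ
  ring = record { isCommutativeRing = isCommutativeRing }

  open CommutativeRing ring public using
    ( +-assoc; +-comm; +-identityˡ; +-identityʳ; *-assoc; *-comm; *-identityˡ; *-identityʳ
    ; distribˡ; distribʳ; zeroˡ; zeroʳ; -‿inverseˡ; -‿inverseʳ; commutativeSemiring; +-group)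
  open import Algebra.Properties.Ring (CommutativeRing.ring ring) public
    using (-‿distribˡ-*; -‿distribʳ-*; -1*x≈-x; -‿+-comm)
  open import Algebra.Properties.Group +-group public using (∙-cancelˡ; ∙-cancelʳ; x∙y⁻¹≈ε⇒x≈y)
  open import Algebra.Properties.CommutativeSemiring.Exp commutativeSemiring using (_^_; ^-distrib-*)
  open import Algebra.Solver.Ring.NaturalCoefficients.Default commutativeSemiring
  open ≡.≡-Reasoning

  π^ℓ≡0 : pow π ℓ ≡ 0#
  π^ℓ≡0 = proj₁ (proj₂ nilDegree)

  1∉⟨π⟩ : ¬ ⟨_⟩ R π 1#
  1∉⟨π⟩ = proj₁ (proj₂ uniformizer)

  1≢0 : 1# ≢ 0#
  1≢0 eq = 1∉⟨π⟩ (0# , trans eq (sym (zeroˡ π)))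

  π^k≢0 : ∀ k → k ℕ.< ℓ → pow π k ≢ 0#
  π^k≢0 zero    _   = 1≢0
  π^k≢0 (suc k) k<ℓ = proj₂ (proj₂ nilDegree) (suc k) (ℕ.s≤s ℕ.z≤n) k<ℓ

  pow≡^ : ∀ x k → pow x k ≡ x ^ k
  pow≡^ x zero    = refl
  pow≡^ x (suc k) = cong (x *_) (pow≡^ x k)

  ⟨π⟩? : ∀ x → Dec (⟨_⟩ R π x)
  ⟨π⟩? x = Fin.any? (λ r → x ≟ r * π)

  ⟨π⟩-* : ∀ r {x} → ⟨_⟩ R π x → ⟨_⟩ R π (r * x)
  ⟨π⟩-* r (s , eq) = r * s , trans (cong (r *_) eq) (sym (*-assoc r s π))

  ⟨π⟩-+ : ∀ {x y} → ⟨_⟩ R π x → ⟨_⟩ R π y → ⟨_⟩ R π (x + y)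
  ⟨π⟩-+ (r , refl) (s , refl) = r + s , sym (distribʳ π r s)

  unit⇒∉⟨π⟩ : ∀ {x} → IsUnit R x → ¬ ⟨_⟩ R π x
  unit⇒∉⟨π⟩ {x} (y , xy≡1) x∈ = 1∉⟨π⟩ (subst (⟨_⟩ R π) (trans (*-comm y x) xy≡1) (⟨π⟩-* y x∈))

  -- Maximality applied to the ideal (π, x) yields 1 = r π + s x. As r π is nilpotent, s x is a
  -- unit, and so is x.
  ∉⟨π⟩⇒unit : ∀ {x} → ¬ ⟨_⟩ R π x → IsUnit R x
  ∉⟨π⟩⇒unit {x} x∉ with proj₂ (proj₂ uniformizer) J J-ideal ⟨π⟩⊆J
    where
    J : Carrier → Set
    J y = ∃ λ r → ∃ λ s → y ≡ r * π + s * x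
    J-ideal : IsIdeal R J
    J-ideal =
      (0# , 0# , solve 2 (λ p x → con 0 := con 0 :* p :+ con 0 :* x) refl π x) ,
      (λ { _ _ (r , s , refl) (r′ , s′ , refl) → r + r′ , s + s′ ,
           solve 6 (λ r s r′ s′ p x → (r :* p :+ s :* x) :+ (r′ :* p :+ s′ :* x)
             := (r :+ r′) :* p :+ (s :+ s′) :* x) refl r s r′ s′ π x }) ,
      (λ { t _ (r , s , refl) → t * r , t * s ,
           solve 5 (λ t r s p x → t :* (r :* p :+ s :* x) := t :* r :* p :+ t :* s :* x) refl t r s π x })
    ⟨π⟩⊆J : ∀ y → ⟨_⟩ R π y → J y
    ⟨π⟩⊆J y (r , eq) = r , 0# , trans eq (solve 3 (λ r p x → r :* p := r :* p :+ con 0 :* x) refl r π x)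
  ... | inj₂ J⊆⟨π⟩ = contradiction
    (J⊆⟨π⟩ x (0# , 1# , solve 2 (λ p x → x := con 0 :* p :+ con 1 :* x) refl π x)) x∉
  ... | inj₁ (r , s , 1≡) with nilpotent-complement-invertible ring {s * x} {r * π} ℓ
      (trans (^-distrib-* r π ℓ) (trans (cong (r ^ ℓ *_) (trans (sym (pow≡^ π ℓ)) π^ℓ≡0)) (zeroʳ _)))
      (trans (+-comm _ _) (sym 1≡))
  ...   | v , eq = s * v , trans (solve 3 (λ x s v → x :* (s :* v) := s :* x :* v) refl x s v) eq

  unit-or-⟨π⟩ : ∀ x → IsUnit R x ⊎ ⟨_⟩ R π x
  unit-or-⟨π⟩ x with ⟨π⟩? x
  ... | yes x∈ = inj₂ x∈
  ... | no x∉  = inj₁ (∉⟨π⟩⇒unit x∉)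

  unit-cancel : ∀ {u x y} → IsUnit R u → u * x ≡ u * y → x ≡ y
  unit-cancel {u} {x} {y} (v , uv≡1) eq = trans (sym (undo x)) (trans (cong (v *_) eq) (undo y))
    where
    undo : ∀ z → v * (u * z) ≡ z
    undo z = trans (solve 3 (λ u v z → v :* (u :* z) := u :* v :* z) refl u v z)
      (trans (cong (_* z) uv≡1) (*-identityˡ z))

  -- Let x = s π^k. If s were a unit, π x = 0 would give π^(k+1) = 0, which is false for k + 1 < ℓ.
  -- So s has another factor π.
  annihilator : ∀ {x} → π * x ≡ 0# → ∀ k → k ℕ.< ℓ → ⟨_⟩ R (pow π k) x
  annihilator {x} πx≡0 zero    _ = x , sym (*-identityʳ x)
  annihilator {x} πx≡0 (suc k) k<ℓ with annihilator πx≡0 k (ℕ.<-trans (ℕ.n<1+n k) k<ℓ)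
  ... | s , refl with unit-or-⟨π⟩ s
  ...   | inj₂ (t , refl) = t , *-assoc t π (pow π k)
  ...   | inj₁ s-unit = contradiction
    (unit-cancel s-unit (trans (solve 3 (λ s p y → s :* (p :* y) := p :* (s :* y)) refl s π (pow π k))
      (trans πx≡0 (sym (zeroʳ s)))))
    (π^k≢0 (suc k) k<ℓ)

  -- Factors π are split off until a unit remains. For k = ℓ the second alternative says that x is
  -- 0.
  factor : ∀ x k → (∃ λ u → ∃ λ j → IsUnit R u × j ℕ.< k × x ≡ u * pow π j) ⊎ ⟨_⟩ R (pow π k) x
  factor x zero    = inj₂ (x , sym (*-identityʳ x))
  factor x (suc k) with factor x k
  ... | inj₁ (u , j , u-unit , j<k , eq) = inj₁ (u , j , u-unit , ℕ.m<n⇒m<1+n j<k , eq)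
  ... | inj₂ (s , refl) with unit-or-⟨π⟩ s
  ...   | inj₁ s-unit     = inj₁ (s , k , s-unit , ℕ.≤-refl , refl)
  ...   | inj₂ (t , refl) = inj₂ (t , *-assoc t π (pow π k))

  pow-+ : ∀ x i j → pow x (i ℕ.+ j) ≡ pow x i * pow x j
  pow-+ x zero    j = sym (*-identityˡ _)
  pow-+ x (suc i) j = trans (cong (x *_) (pow-+ x i j)) (sym (*-assoc x _ _))

  power-divides : ∀ {u v i j x y} → IsUnit R u → i ℕ.≤ j → x ≡ u * pow π i → y ≡ v * pow π j → ∃ λ s → y ≡ s * x
  power-divides {u} {v} {i} {j} (u′ , uu′≡1) i≤j refl refl = v * u′ * pow π (j ℕ.∸ i) , (begin
    v * pow π j                                     ≡⟨ cong (λ k → v * pow π k) (ℕ.m∸n+n≡m i≤j) ⟨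
    v * pow π (j ℕ.∸ i ℕ.+ i)                       ≡⟨ cong (v *_) (pow-+ π (j ℕ.∸ i) i) ⟩
    v * (pow π (j ℕ.∸ i) * pow π i)                 ≡⟨ cong (_* (pow π (j ℕ.∸ i) * pow π i)) (trans (sym (*-identityʳ v)) (cong (v *_) (sym uu′≡1))) ⟩
    v * (u * u′) * (pow π (j ℕ.∸ i) * pow π i)      ≡⟨ solve 5 (λ v u w p r → v :* (u :* w) :* (p :* r) := v :* w :* p :* (u :* r)) refl v u u′ _ _ ⟩
    v * u′ * pow π (j ℕ.∸ i) * (u * pow π i)        ∎)

  -- Two nonzero elements are units times powers of π, and the one with the smaller exponent divides
  -- the other; 0 is a multiple of everything.
  divisibility-total : ∀ x y → (∃ λ s → y ≡ s * x) ⊎ (∃ λ s → x ≡ s * y)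
  divisibility-total x y with factor x ℓ | factor y ℓ
  ... | inj₂ (s , eq) | _ = inj₂ (0# , trans eq (trans (cong (s *_) π^ℓ≡0) (trans (zeroʳ s) (sym (zeroˡ y)))))
  ... | inj₁ _ | inj₂ (s , eq) = inj₁ (0# , trans eq (trans (cong (s *_) π^ℓ≡0) (trans (zeroʳ s) (sym (zeroˡ x)))))
  ... | inj₁ (u , i , u-unit , _ , x≡) | inj₁ (v , j , v-unit , _ , y≡) with ℕ.≤-total i j
  ...   | inj₁ i≤j = inj₁ (power-divides u-unit i≤j x≡ y≡)
  ...   | inj₂ j≤i = inj₂ (power-divides v-unit j≤i y≡ x≡)

  dot-comm : ∀ {n} (a b : Vec Carrier n) → dot R a b ≡ dot R b a
  dot-comm []      []      = refl
  dot-comm (x ∷ a) (y ∷ b) = cong₂ _+_ (*-comm x y) (dot-comm a b)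

  dot-∈⟨π⟩ : ∀ {n} (c a : Vec Carrier n) → (∀ i → ⟨_⟩ R π (lookup a i)) → ⟨_⟩ R π (dot R c a)
  dot-∈⟨π⟩ []      []      all = 0# , sym (zeroˡ π)
  dot-∈⟨π⟩ (x ∷ c) (y ∷ a) all = ⟨π⟩-+ (⟨π⟩-* x (all zero)) (dot-∈⟨π⟩ c a (all ∘ suc))

  dot-zeroˡ : ∀ {n} (a : Vec Carrier n) → dot R (Vec.replicate n 0#) a ≡ 0#
  dot-zeroˡ []      = refl
  dot-zeroˡ (x ∷ a) = trans (cong₂ _+_ (zeroˡ x) (dot-zeroˡ a)) (+-identityˡ 0#)

  unit-coordinate⇒unimodular : ∀ {n} (a : Vec Carrier n) i → IsUnit R (lookup a i) → Unimodular R a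
  unit-coordinate⇒unimodular {suc n} (x ∷ a) zero (y , xy≡1) = y ∷ Vec.replicate n 0# ,
    trans (cong₂ _+_ (trans (*-comm y x) xy≡1) (dot-zeroˡ a)) (+-identityʳ 1#)
  unit-coordinate⇒unimodular {suc n} (x ∷ a) (suc i) ai-unit =
    let (c , eq) = unit-coordinate⇒unimodular a i ai-unit in
    0# ∷ c , trans (cong₂ _+_ (zeroˡ x) eq) (+-identityˡ 1#)

  unimodular⇒unit-coordinate : ∀ {n} {a : Vec Carrier n} → Unimodular R a → ∃ λ i → IsUnit R (lookup a i)
  unimodular⇒unit-coordinate {n} {a} (c , ca≡1) with Fin.¬∀⟶∃¬ n _ (λ i → ⟨π⟩? (lookup a i))
    (λ all → 1∉⟨π⟩ (subst (⟨_⟩ R π) ca≡1 (dot-∈⟨π⟩ c a all)))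
  ... | i , ∉ = i , ∉⟨π⟩⇒unit ∉

  infix 4 _≡ᵖ_
  -- The form without subtraction allows matching on `refl` and leaves mostly semiring identities
  -- for the solver.
  _≡ᵖ_ : Carrier → Carrier → Set
  x ≡ᵖ y = ∃ λ r → x ≡ y + r * π

  ≡⇒≡ᵖ : ∀ {x y} → x ≡ y → x ≡ᵖ y
  ≡⇒≡ᵖ {x} {y} eq = 0# , trans eq (solve 2 (λ y p → y := y :+ con 0 :* p) refl y π)

  difference⇒≡ᵖ : ∀ {x y} → ⟨_⟩ R π (x - y) → x ≡ᵖ y
  difference⇒≡ᵖ {x} {y} (r , eq) = r , (begin
    x                ≡⟨ trans (cong (_+ x) (-‿inverseʳ y)) (+-identityˡ x) ⟨
    y + - y + x      ≡⟨ solve 3 (λ x y z → y :+ z :+ x := y :+ (x :+ z)) refl x y (- y) ⟩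
    y + (x + - y)    ≡⟨ cong (y +_) eq ⟩
    y + r * π        ∎)

  ≡ᵖ⇒difference : ∀ {x y} → x ≡ᵖ y → ⟨_⟩ R π (x - y)
  ≡ᵖ⇒difference {x} {y} (r , refl) = r , (begin
    (y + r * π) + - y   ≡⟨ solve 3 (λ y z t → (y :+ t) :+ z := y :+ z :+ t) refl y (- y) (r * π) ⟩
    y + - y + r * π     ≡⟨ cong (_+ r * π) (-‿inverseʳ y) ⟩
    0# + r * π          ≡⟨ +-identityˡ _ ⟩
    r * π               ∎)

  residueRing : CommutativeRing 0ℓ 0ℓ
  residueRing = record
    { _≈_ = _≡ᵖ_ ; _+_ = _+_ ; _*_ = _*_ ; -_ = -_ ; 0# = 0# ; 1# = 1#
    ; isCommutativeRing = record
      { isRing = record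
        { +-isAbelianGroup = record
          { isGroup = record
            { isMonoid = record
              { isSemigroup = record
                { isMagma = record
                  { isEquivalence = record
                    { refl = ≡⇒≡ᵖ refl
                    ; sym = λ { {_} {y} (r , refl) → - r , (begin
                        y                         ≡⟨ +-identityʳ y ⟨
                        y + 0#                    ≡⟨ cong (y +_) (-‿inverseʳ (r * π)) ⟨
                        y + (r * π + - (r * π))   ≡⟨ +-assoc y _ _ ⟨
                        y + r * π + - (r * π)     ≡⟨ cong (y + r * π +_) (-‿distribˡ-* r π) ⟩
                        y + r * π + - r * π       ∎) }
                    ; trans = λ { {_} {_} {z} (r , refl) (s , refl) → s + r ,
                        solve 4 (λ z r s p → (z :+ s :* p) :+ r :* p := z :+ (s :+ r) :* p) refl z r s π }
                    }
                  ; ∙-cong = λ { {_} {y} {_} {z} (r , refl) (s , refl) → r + s ,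
                      solve 5 (λ y z r s p → (y :+ r :* p) :+ (z :+ s :* p) := (y :+ z) :+ (r :+ s) :* p) refl y z r s π }
                  }
                ; assoc = λ x y z → ≡⇒≡ᵖ (+-assoc x y z)
                }
              ; identity = (λ x → ≡⇒≡ᵖ (+-identityˡ x)) , (λ x → ≡⇒≡ᵖ (+-identityʳ x))
              }
            ; inverse = (λ x → ≡⇒≡ᵖ (-‿inverseˡ x)) , (λ x → ≡⇒≡ᵖ (-‿inverseʳ x))
            ; ⁻¹-cong = λ { {_} {y} (r , refl) → - r , (begin
                - (y + r * π)        ≡⟨ -‿+-comm y (r * π) ⟨
                - y + - (r * π)      ≡⟨ cong (- y +_) (-‿distribˡ-* r π) ⟩
                - y + - r * π        ∎) }
            }
          ; comm = λ x y → ≡⇒≡ᵖ (+-comm x y)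
          }
        ; *-cong = λ { {_} {y} {_} {z} (r , refl) (s , refl) → y * s + r * z + r * s * π ,
            solve 5 (λ y z r s p → (y :+ r :* p) :* (z :+ s :* p)
              := y :* z :+ (y :* s :+ r :* z :+ r :* s :* p) :* p) refl y z r s π }
        ; *-assoc = λ x y z → ≡⇒≡ᵖ (*-assoc x y z)
        ; *-identity = (λ x → ≡⇒≡ᵖ (*-identityˡ x)) , (λ x → ≡⇒≡ᵖ (*-identityʳ x))
        ; distrib = (λ x y z → ≡⇒≡ᵖ (distribˡ x y z)) , (λ x y z → ≡⇒≡ᵖ (distribʳ x y z))
        }
      ; *-comm = λ x y → ≡⇒≡ᵖ (*-comm x y)
      }
    }

  ≡ᵖ0⇒∈ : ∀ {x} → x ≡ᵖ 0# → ⟨_⟩ R π x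
  ≡ᵖ0⇒∈ (r , eq) = r , trans eq (+-identityˡ _)

  ∈⇒≡ᵖ0 : ∀ {x} → ⟨_⟩ R π x → x ≡ᵖ 0#
  ∈⇒≡ᵖ0 (r , eq) = r , trans eq (sym (+-identityˡ _))

  residueField : ∀ {q} → ResidueSize R π q → FiniteField q
  residueField (f , _ , f-injective , f-surjective) = record
    { commutativeRing = residueRing
    ; enumeration = record
      { enum = f
      ; injective = λ {i} {j} eq → f-injective i j (≡ᵖ⇒difference eq)
      ; index = λ x → proj₁ (f-surjective x x)
      ; enum-index = λ x → difference⇒≡ᵖ (proj₂ (f-surjective x x))
      }
    ; 1≉0 = 1∉⟨π⟩ ∘ ≡ᵖ0⇒∈
    ; inverse = λ x x≉0 → let (y , eq) = ∉⟨π⟩⇒unit (x≉0 ∘ ∈⇒≡ᵖ0) in y , ≡⇒≡ᵖ eq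
    }

-- Cayley graphs

-- A missed value could be removed from the codomain by `punchOut`, giving an injection of m + 1
-- elements into m.
injective⇒surjective : ∀ {m} (f : Fin m → Fin m) → (∀ {i j} → f i ≡ f j → i ≡ j) → ∀ j → ∃ λ i → f i ≡ j
injective⇒surjective {suc m} f inj j with Fin.any? (λ i → f i ≟ j)
... | yes found = found
... | no missed = contradiction
  (Fin.injective⇒≤ {f = λ i → punchOut (avoids i)}
    (λ {i} {k} eq → inj (Fin.punchOut-injective (avoids i) (avoids k) eq)))
  ℕ.1+n≰n
  where
  avoids : ∀ i → j ≢ f i
  avoids i eq = missed (i , sym eq)

-- The second component is true on reflections.
module Dihedral (H : AbelianGroup 0ℓ 0ℓ) where
  open AbelianGroup H renaming (refl to ≈-refl; sym to ≈-sym; trans to ≈-trans)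
  open import Algebra.Properties.AbelianGroup H using (⁻¹-∙-comm)
  open import Algebra.Properties.Group group using (⁻¹-involutive)
  open import Relation.Binary.Reasoning.Setoid setoid

  infixl 7 _∘ᴰ_
  _∘ᴰ_ : Carrier × Bool → Carrier × Bool → Carrier × Bool
  (g , false) ∘ᴰ (h , s) = g ∙ h , s
  (g , true)  ∘ᴰ (h , s) = g ∙ h ⁻¹ , not s

  _⁻¹ᴰ : Carrier × Bool → Carrier × Bool
  (g , false) ⁻¹ᴰ = g ⁻¹ , false
  (g , true)  ⁻¹ᴰ = g , true

  _≈ᴰ_ : Carrier × Bool → Carrier × Bool → Set
  (g , s) ≈ᴰ (h , t) = g ≈ h × s ≡ t

  assocᴰ : ∀ x y z → ((x ∘ᴰ y) ∘ᴰ z) ≈ᴰ (x ∘ᴰ (y ∘ᴰ z))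
  assocᴰ (f , false) (g , false) (h , s) = assoc f g h , refl
  assocᴰ (f , false) (g , true)  (h , s) = assoc f g (h ⁻¹) , refl
  assocᴰ (f , true)  (g , false) (h , s) = ≈-trans (assoc f _ _) (∙-congˡ (⁻¹-∙-comm g h)) , refl
  assocᴰ (f , true)  (g , true)  (h , s) = (begin
    (f ∙ g ⁻¹) ∙ h          ≈⟨ assoc f _ h ⟩
    f ∙ (g ⁻¹ ∙ h)          ≈⟨ ∙-congˡ (∙-congˡ (⁻¹-involutive h)) ⟨
    f ∙ (g ⁻¹ ∙ h ⁻¹ ⁻¹)    ≈⟨ ∙-congˡ (⁻¹-∙-comm g (h ⁻¹)) ⟩
    f ∙ (g ∙ h ⁻¹) ⁻¹       ∎) , not-involutive s
    where
    not-involutive : ∀ s → s ≡ not (not s)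
    not-involutive false = refl
    not-involutive true  = refl

  dihedral : Group 0ℓ 0ℓ
  dihedral = record
    { Carrier = Carrier × Bool ; _≈_ = _≈ᴰ_ ; _∙_ = _∘ᴰ_ ; ε = ε , false ; _⁻¹ = _⁻¹ᴰ
    ; isGroup = record
      { isMonoid = record
        { isSemigroup = record
          { isMagma = record
            { isEquivalence = record
              { refl = ≈-refl , refl
              ; sym = λ { (p , r) → ≈-sym p , sym r }
              ; trans = λ { (p , r) (p′ , r′) → ≈-trans p p′ , trans r r′ }
              }
            ; ∙-cong = λ { {_ , false} (p , refl) (p′ , refl) → ∙-cong p p′ , refl
                         ; {_ , true}  (p , refl) (p′ , refl) → ∙-cong p (⁻¹-cong p′) , refl }
            }
          ; assoc = assocᴰ
          }
        ; identity = (λ { (g , s) → identityˡ g , refl })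
                   , (λ { (g , false) → identityʳ g , refl
                        ; (g , true) → ≈-trans (∙-congˡ ε⁻¹≈ε) (identityʳ g) , refl })
        }
      ; inverse = (λ { (g , false) → inverseˡ g , refl ; (g , true) → inverseʳ g , refl })
                , (λ { (g , false) → inverseʳ g , refl ; (g , true) → inverseʳ g , refl })
      ; ⁻¹-cong = λ { {_ , false} (p , refl) → ⁻¹-cong p , refl ; {_ , true} (p , refl) → p , refl }
      }
    }
    where open import Algebra.Properties.Group group using (ε⁻¹≈ε)

  -- If adjacency of a• and b∘ depends only on the product of labels α a and β b,
  -- then labelling a• by a rotation and b∘ by a reflection makes the graph Cayley.
  module _ {U : Set} (_≈ᵁ_ D : U → U → Set) (D-sym : ∀ {a b} → D a b → D b a)
    (α β : U → Carrier)
    (α-cong : ∀ {a b} → a ≈ᵁ b → α a ≈ α b) (α-injective : ∀ {a b} → α a ≈ α b → a ≈ᵁ b)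
    (α-surjective : ∀ g → ∃ λ a → α a ≈ g)
    (β-cong : ∀ {a b} → a ≈ᵁ b → β a ≈ β b) (β-injective : ∀ {a b} → β a ≈ β b → a ≈ᵁ b)
    (β-surjective : ∀ g → ∃ λ a → β a ≈ g)
    (S₀ : Carrier → Set) (S₀-resp : ∀ {g h} → g ≈ h → S₀ g → S₀ h)
    (D⇒S₀ : ∀ {a b} → D a b → S₀ (α a ∙ β b)) (S₀⇒D : ∀ {a b} → S₀ (α a ∙ β b) → D a b)
    where

    bipartite : Graph
    bipartite = record
      { V    = Bool × U
      ; _≈_  = λ u v → proj₁ u ≡ proj₁ v × proj₂ u ≈ᵁ proj₂ v
      ; E    = λ u v → proj₁ u ≢ proj₁ v × D (proj₂ u) (proj₂ v)
      ; side = proj₁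
      }

    private
      S : Carrier × Bool → Set
      S (g , s) = s ≡ true × S₀ g

      φ : Bool × U → Carrier × Bool
      φ (true  , a) = α a , false
      φ (false , b) = β b , true

      -- The right-hand side is what the dihedral product of the reflection `φ (false , b)` and the
      -- inverse of the rotation `φ (true , a)` computes to: the reflection inverts a second time,
      -- so the group quotient is the product of the labels.
      rearrange : ∀ {a b} → α a ∙ β b ≈ β b ∙ α a ⁻¹ ⁻¹
      rearrange {a} {b} = ≈-trans (comm _ _) (∙-congˡ (≈-sym (⁻¹-involutive (α a))))

      edges : ∀ u v → Graph.E bipartite u v ⇔ S (φ v ∘ᴰ (φ u ⁻¹ᴰ))
      edges (true  , a) (true  , b) = mk⇔ (λ { (ne , _) → contradiction refl ne }) (λ { (() , _) })
      edges (false , a) (false , b) = mk⇔ (λ { (ne , _) → contradiction refl ne }) (λ { (() , _) })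
      edges (true  , a) (false , b) = mk⇔ (λ { (_ , d) → refl , S₀-resp rearrange (D⇒S₀ d) })
        (λ { (_ , s) → (λ ()) , S₀⇒D (S₀-resp (≈-sym rearrange) s) })
      edges (false , b) (true  , a) = mk⇔ (λ { (_ , d) → refl , D⇒S₀ (D-sym d) })
        (λ { (_ , s) → (λ ()) , D-sym (S₀⇒D s) })

    bipartite-isCayley : IsCayley bipartite
    bipartite-isCayley = dihedral , S , φ
      , (λ { _ _ (p , refl) (r , s) → r , S₀-resp p s })
      , (λ { (g , true) s → s })
      , (λ { (() , _) })
      , (λ { (true , a) (_ , b) (refl , p) → α-cong p , refl ; (false , a) (_ , b) (refl , p) → β-cong p , refl })
      , (λ { (true  , a) (true  , b) (p , _) → refl , α-injective p
           ; (false , a) (false , b) (p , _) → refl , β-injective p })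
      , (λ { (g , false) → let (a , p) = α-surjective g in (true , a) , p , refl
           ; (g , true)  → let (b , p) = β-surjective g in (false , b) , p , refl })
      , edges

-- The unramified extension of R and its unit group

module Extension (R : FinCommRing) (π : FinCommRing.Carrier R) (uniformizer : IsUniformizer R π)
  (ℓ : ℕ) (nilDegree : NilDegree R π ℓ) {q : ℕ} (residueSize : ResidueSize R π (suc q)) (m : ℕ) where
  open ValuationRing R π uniformizer ℓ nilDegree

  n : ℕ
  n = suc m

  irreducible : ∃ (IrreducibleExists.Irreducible (residueField residueSize) m)
  irreducible = IrreducibleExists.irreducible-exists (residueField residueSize) m

  -- The residue ring has the carrier and the operations of R, so `c` is at once a polynomial over
  -- the residue field and a lift of it, and products in the two companion algebras are the same
  -- vectors up to the equality used.
  module Unramified (c : Fin n → Carrier)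
    (c-irreducible : IrreducibleExists.Irreducible (residueField residueSize) m c) where

    open Companion ring c using (Vector; companion; one)
    open CyclicModule companion using (_≈_; _⊕_; 𝟎; _•_; C; act)
    private module M = CyclicModule companion
    open CyclicAlgebra companion using (algebra; act-C; •-*) renaming (_*_ to _⊛_)
    private module CA = CyclicAlgebra companion
    private module A = CommutativeRing algebra
    open import Algebra.Solver.Ring.NaturalCoefficients.Default commutativeSemiring

    Unit : Vector → Set
    Unit w = ∃ λ w′ → (w ⊛ w′) ≈ one

    ^-• : ∀ s k → ((π • s) CA.^ k) ≈ (pow π k • (s CA.^ k))
    ^-• s k = M.trans (CA.•-^ π s k) (M.•-cong {v = s CA.^ k} (sym (pow≡^ π k)) M.refl)

    -- A vector with a unit entry is nonzero modulo π, hence invertible there by irreducibility.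
    -- Then w w′ differs from 1 by a multiple of π, which is nilpotent.
    unit : ∀ w → (∃ λ i → IsUnit R (w i)) → Unit w
    unit w (i , wi-unit) with c-irreducible w (λ w≈0 → unit⇒∉⟨π⟩ wi-unit (≡ᵖ0⇒∈ (w≈0 i)))
    ... | w′ , ww′≡ᵖe = w′ ⊛ v , M.trans (M.sym (CA.*-assoc w w′ v)) av≈e
      where
      s : Vector
      s i = - proj₁ (ww′≡ᵖe i)
      a+s≈e : ((w ⊛ w′) ⊕ (π • s)) ≈ one
      a+s≈e i = begin
        (w ⊛ w′) i + π * - r       ≡⟨ cong (_+ π * - r) (proj₂ (ww′≡ᵖe i)) ⟩
        one i + r * π + π * - r    ≡⟨ +-assoc _ _ _ ⟩
        one i + (r * π + π * - r)  ≡⟨ cong (λ t → one i + (t + π * - r)) (*-comm r π) ⟩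
        one i + (π * r + π * - r)  ≡⟨ cong (one i +_) (distribˡ π r (- r)) ⟨
        one i + π * (r + - r)      ≡⟨ cong (λ t → one i + π * t) (-‿inverseʳ r) ⟩
        one i + π * 0#             ≡⟨ cong (one i +_) (zeroʳ π) ⟩
        one i + 0#                 ≡⟨ +-identityʳ _ ⟩
        one i                      ∎
        where
        open ≡.≡-Reasoning
        r = proj₁ (ww′≡ᵖe i)
      inverse : ∃ λ v → ((w ⊛ w′) ⊛ v) ≈ one
      inverse = nilpotent-complement-invertible algebra {w ⊛ w′} {π • s} ℓ
        (M.trans (^-• s ℓ) (λ i → trans (cong (_* (s CA.^ ℓ) i) π^ℓ≡0) (zeroˡ _))) a+s≈e
      v = proj₁ inverse
      av≈e = proj₂ inverse

    unit-nonzero : ∀ w → Unit w → ¬ (∀ i → ⟨_⟩ R π (w i))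
    unit-nonzero w (w′ , ww′≈e) all = 1∉⟨π⟩ (_ , trans (sym (ww′≈e zero)) (trans
      (CA.*-cong {w} {π • s} {w′} (λ i → trans (proj₂ (all i)) (*-comm _ π)) M.refl zero)
      (trans (•-* π s w′ zero) (*-comm π _))))
      where
      s : Vector
      s i = proj₁ (all i)

    unit-coordinate : ∀ w → Unit w → ∃ λ i → IsUnit R (w i)
    unit-coordinate w w-unit =
      let (i , ∉) = Fin.¬∀⟶∃¬ n _ (λ i → ⟨π⟩? (w i)) (unit-nonzero w w-unit) in i , ∉⟨π⟩⇒unit ∉

    iterate : ℕ → Vector → Vector
    iterate zero    t = t
    iterate (suc k) t = iterate k (C t)

    iterate-cong : ∀ k {s t} → s ≈ t → iterate k s ≈ iterate k t
    iterate-cong zero    eq = eq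
    iterate-cong (suc k) eq = iterate-cong k (M.C-cong eq)

    iterate-⊕ : ∀ k s t → iterate k (s ⊕ t) ≈ (iterate k s ⊕ iterate k t)
    iterate-⊕ zero    s t = M.refl
    iterate-⊕ (suc k) s t = M.trans (iterate-cong k (M.C-⊕ s t)) (iterate-⊕ k (C s) (C t))

    iterate-• : ∀ k a t → iterate k (a • t) ≈ (a • iterate k t)
    iterate-• zero    a t = M.refl
    iterate-• (suc k) a t = M.trans (iterate-cong k (M.C-• a t)) (iterate-• k a (C t))

    -- The first coordinate is a linear form on the algebra; L t is the functional
    -- a ↦ (a t)₀ in coordinates.
    L : Vector → Vector
    L t i = iterate (toℕ i) t zero

    act-L : ∀ {k} (p : Fin k → Carrier) t →
      act p t zero ≡ dot R (tabulate p) (tabulate (λ i → iterate (toℕ i) t zero))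
    act-L {zero}  p t = refl
    act-L {suc k} p t = cong (p zero * t zero +_)
      (trans (sym (act-C (p ∘ suc) t zero)) (act-L (p ∘ suc) (C t)))

    dot-vanish : ∀ {k} (a : Vec Carrier k) → dot R a (tabulate (λ _ → 0#)) ≡ 0#
    dot-vanish []      = refl
    dot-vanish (x ∷ a) = trans (cong₂ _+_ (zeroʳ x) (dot-vanish a)) (+-identityˡ 0#)

    -- Let t = π^k s. If s had a unit entry, it would have an inverse s′, and π^k = (s′ t)₀ would be
    -- 0 because the functional of t vanishes. So every entry of s has a further factor π; at k = ℓ
    -- this makes t zero.
    L-kernel-step : ∀ t → (∀ i → L t i ≡ 0#) → ∀ k → k ℕ.≤ ℓ → ∃ λ s → t ≈ (pow π k • s)
    L-kernel-step t Lt≡0 zero    _   = t , λ i → sym (*-identityˡ _)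
    L-kernel-step t Lt≡0 (suc k) k<ℓ with L-kernel-step t Lt≡0 k (ℕ.<⇒≤ k<ℓ)
    ... | s , t≈ with Fin.all? (λ i → ⟨π⟩? (s i))
    ...   | yes all = (λ i → proj₁ (all i)) , λ i → trans (t≈ i) (trans (cong (pow π k *_) (proj₂ (all i)))
              (solve 3 (λ p y r → y :* (r :* p) := p :* y :* r) refl π (pow π k) (proj₁ (all i))))
    ...   | no ¬all = contradiction π^k≡0 (π^k≢0 k k<ℓ)
      where
      coordinate = Fin.¬∀⟶∃¬ n _ (λ i → ⟨π⟩? (s i)) ¬all
      s-unit = unit s (proj₁ coordinate , ∉⟨π⟩⇒unit (proj₂ coordinate))
      s′ = proj₁ s-unit
      open ≡.≡-Reasoning
      π^k≡0 : pow π k ≡ 0#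
      π^k≡0 = begin
        pow π k                                ≡⟨ *-identityʳ _ ⟨
        pow π k * 1#                           ≡⟨ cong (pow π k *_) (proj₂ s-unit zero) ⟨
        pow π k * (s ⊛ s′) zero                ≡⟨ cong (pow π k *_) (CA.*-comm s s′ zero) ⟩
        pow π k * (s′ ⊛ s) zero                ≡⟨ CA.act-• s′ (pow π k) s zero ⟨
        (s′ ⊛ (pow π k • s)) zero              ≡⟨ CA.act-congʳ s′ t≈ zero ⟨
        (s′ ⊛ t) zero                          ≡⟨ act-L s′ t ⟩
        dot R (tabulate s′) (tabulate (L t))   ≡⟨ cong (dot R (tabulate s′)) (Vec.tabulate-cong Lt≡0) ⟩
        dot R (tabulate s′) (tabulate {n = n} (λ _ → 0#)) ≡⟨ dot-vanish (tabulate s′) ⟩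
        0#                                     ∎

    L-kernel : ∀ t → (∀ i → L t i ≡ 0#) → t ≈ 𝟎
    L-kernel t Lt≡0 with L-kernel-step t Lt≡0 ℓ ℕ.≤-refl
    ... | s , t≈ = λ i → trans (t≈ i) (trans (cong (_* s i) π^ℓ≡0) (zeroˡ _))

    L-cong : ∀ {s t} → s ≈ t → ∀ i → L s i ≡ L t i
    L-cong s≈t i = iterate-cong (toℕ i) s≈t zero

    L-• : ∀ a t i → L (a • t) i ≡ a * L t i
    L-• a t i = iterate-• (toℕ i) a t zero

    L-injective : ∀ {s t} → (∀ i → L s i ≡ L t i) → s ≈ t
    L-injective {s} {t} eq i = x∙y⁻¹≈ε⇒x≈y (s i) (t i) (trans (cong (s i +_) (sym (-1*x≈-x (t i))))
      (L-kernel (s ⊕ ((- 1#) • t)) (λ j → begin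
        L (s ⊕ ((- 1#) • t)) j        ≡⟨ iterate-⊕ (toℕ j) s _ zero ⟩
        L s j + L ((- 1#) • t) j      ≡⟨ cong₂ _+_ (eq j) (trans (L-• _ t j) (-1*x≈-x _)) ⟩
        L t j + - L t j               ≡⟨ -‿inverseʳ _ ⟩
        0#                            ∎) i))
      where open ≡.≡-Reasoning

    abstract
      -- An injective self-map of the finite set Rⁿ is onto. Of the preimage found by search only
      -- the equation is used, so the search is hidden.
      L-surjective : (b : Vector) → ∃ λ t → ∀ i → L t i ≡ b i
      L-surjective b = finToFun {size} {n} (proj₁ found) , λ i → begin
        L (finToFun (proj₁ found)) i                         ≡⟨ Fin.finToFun-funToFin (L (finToFun (proj₁ found))) i ⟨
        finToFun {size} {n} (code (proj₁ found)) i           ≡⟨ cong (λ k → finToFun {size} {n} k i) (proj₂ found) ⟩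
        finToFun {size} {n} (funToFin b) i                   ≡⟨ Fin.finToFun-funToFin b i ⟩
        b i                                                  ∎
        where
        open ≡.≡-Reasoning
        code : Fin (size ℕ.^ n) → Fin (size ℕ.^ n)
        code k = funToFin (L (finToFun {size} {n} k))
        code-injective : ∀ {k l} → code k ≡ code l → k ≡ l
        code-injective {k} {l} eq = begin
          k                                  ≡⟨ Fin.funToFin-finToFin {n} {size} k ⟨
          funToFin (finToFun {size} {n} k)   ≡⟨ funToFin-cong n (L-injective (λ i → begin
            L (finToFun k) i                     ≡⟨ Fin.finToFun-funToFin (L (finToFun {size} {n} k)) i ⟨
            finToFun {size} {n} (code k) i       ≡⟨ cong (λ k → finToFun {size} {n} k i) eq ⟩
            finToFun {size} {n} (code l) i       ≡⟨ Fin.finToFun-funToFin (L (finToFun {size} {n} l)) i ⟩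
            L (finToFun l) i                     ∎)) ⟩
          funToFin (finToFun {size} {n} l)   ≡⟨ Fin.funToFin-finToFin {n} {size} l ⟩
          l                                  ∎
        found : ∃ λ k → code k ≡ funToFin b
        found = injective⇒surjective code code-injective (funToFin b)

    -- The linear relabelling of the ∘-copy: `T b` is the element of the extension that represents
    -- the functional a ↦ a·b.
    T : Vec Carrier n → Vector
    T b = proj₁ (L-surjective (lookup b))

    L-T : ∀ b i → L (T b) i ≡ lookup b i
    L-T b = proj₂ (L-surjective (lookup b))

    dot-T : ∀ a b → dot R a b ≡ (lookup a ⊛ T b) zero
    dot-T a b = sym (begin
      (lookup a ⊛ T b) zero                                ≡⟨ act-L (lookup a) (T b) ⟩
      dot R (tabulate (lookup a)) (tabulate (L (T b)))     ≡⟨ cong₂ (dot R) (Vec.tabulate∘lookup a)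
                                                               (trans (Vec.tabulate-cong (L-T b)) (Vec.tabulate∘lookup b)) ⟩
      dot R a b                                            ∎)
      where open ≡.≡-Reasoning

    -- A factor π in `T b` would pass to (a T b)₀, which is the dot product of a and b.
    T-not-divisible : ∀ a b → dot R a b ≡ 1# → ¬ (∀ i → ⟨_⟩ R π (T b i))
    T-not-divisible a b ab≡1 all = 1∉⟨π⟩ ((lookup a ⊛ s) zero , (begin
      1#                          ≡⟨ ab≡1 ⟨
      dot R a b                   ≡⟨ dot-T a b ⟩
      (lookup a ⊛ T b) zero       ≡⟨ CA.act-congʳ (lookup a) T≈πs zero ⟩
      (lookup a ⊛ (π • s)) zero   ≡⟨ CA.act-• (lookup a) π s zero ⟩
      π * (lookup a ⊛ s) zero     ≡⟨ *-comm π _ ⟩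
      (lookup a ⊛ s) zero * π     ∎))
      where
      open ≡.≡-Reasoning
      s : Vector
      s i = proj₁ (all i)
      T≈πs : T b ≈ (π • s)
      T≈πs i = trans (proj₂ (all i)) (*-comm _ π)

    T-unit-coordinate : ∀ {b} → Unimodular R b → ∃ λ i → IsUnit R (T b i)
    T-unit-coordinate {b} (a , ab≡1) =
      let (i , ∉) = Fin.¬∀⟶∃¬ n _ (λ i → ⟨π⟩? (T b i)) (T-not-divisible a b ab≡1) in i , ∉⟨π⟩⇒unit ∉

    -- G is trivial for Um and R^× for Um₀.
    module Quotient (G : Carrier → Set) (G-1 : G 1#)
      (G-* : ∀ {u v} → G u → G v → G (u * v))
      (G-inverse : ∀ {u} → G u → ∃ λ v → G v × u * v ≡ 1#) where

      _~_ : Σ Vector Unit → Σ Vector Unit → Set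
      (w , _) ~ (v , _) = ∃ λ u → G u × v ≈ (u • w)

      ≈⇒~ : ∀ {w v} → proj₁ w ≈ proj₁ v → w ~ v
      ≈⇒~ eq = 1# , G-1 , λ i → trans (sym (eq i)) (sym (*-identityˡ _))

      •-⊛ʳ : ∀ a v w → (v ⊛ (a • w)) ≈ (a • (v ⊛ w))
      •-⊛ʳ a v w = CA.act-• v a w

      mul : Σ Vector Unit → Σ Vector Unit → Σ Vector Unit
      mul (w , w′ , p) (v , v′ , r) = w ⊛ v , w′ ⊛ v′ ,
        M.trans (interchange w v w′ v′) (M.trans (A.*-cong p r) (A.*-identityˡ one))
        where open import Algebra.Properties.CommutativeSemigroup A.*-commutativeSemigroup using (interchange)

      inverse-unique : ∀ {w v v′} → (w ⊛ v) ≈ one → (w ⊛ v′) ≈ one → v ≈ v′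
      inverse-unique {w} {v} {v′} p r = M.trans (M.sym (A.*-identityʳ v)) (M.trans (A.*-congˡ {v} (M.sym r))
        (M.trans (M.sym (A.*-assoc v w v′)) (M.trans (A.*-congʳ {v′} (M.trans (A.*-comm v w) p)) (A.*-identityˡ v′))))

      ~-sym : ∀ {w v} → w ~ v → v ~ w
      ~-sym (u , u∈ , eq) with G-inverse u∈
      ... | u′ , u′∈ , uu′≡1 = u′ , u′∈ , λ i → sym (trans (cong (u′ *_) (eq i))
        (trans (sym (*-assoc u′ u _)) (trans (cong (_* _) (trans (*-comm u′ u) uu′≡1)) (*-identityˡ _))))

      ~-trans : ∀ {w v t} → w ~ v → v ~ t → w ~ t
      ~-trans (u , u∈ , eq) (u′ , u′∈ , eq′) = u′ * u , G-* u′∈ u∈ ,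
        λ i → trans (eq′ i) (trans (cong (u′ *_) (eq i)) (sym (*-assoc u′ u _)))

      mul-cong : ∀ {w w′ v v′} → w ~ w′ → v ~ v′ → mul w v ~ mul w′ v′
      mul-cong {w , _} {w′ , _} {v , _} {v′ , _} (u , u∈ , eq) (t , t∈ , eq′) = u * t , G-* u∈ t∈ , (begin
        w′ ⊛ v′                ≈⟨ A.*-cong {w′} {u • w} {v′} {t • v} eq eq′ ⟩
        (u • w) ⊛ (t • v)      ≈⟨ •-* u w (t • v) ⟩
        u • (w ⊛ (t • v))      ≈⟨ M.•-cong {u} {u} refl (•-⊛ʳ t w v) ⟩
        u • (t • (w ⊛ v))      ≈⟨ M.•-assoc u t (w ⊛ v) ⟨
        (u * t) • (w ⊛ v)      ∎)
        where open import Relation.Binary.Reasoning.Setoid M.setoid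

      inv : Σ Vector Unit → Σ Vector Unit
      inv (w , w′ , p) = w′ , w , M.trans (A.*-comm w′ w) p

      inv-cong : ∀ {w v} → w ~ v → inv w ~ inv v
      inv-cong {w , w′ , p} {v , v′ , r} (u , u∈ , eq) with G-inverse u∈
      ... | t , t∈ , ut≡1 = t , t∈ , inverse-unique {v} {v′} {t • w′} r (begin
        v ⊛ (t • w′)           ≈⟨ A.*-congʳ {t • w′} {v} {u • w} eq ⟩
        (u • w) ⊛ (t • w′)     ≈⟨ •-* u w (t • w′) ⟩
        u • (w ⊛ (t • w′))     ≈⟨ M.•-cong {u} {u} refl (•-⊛ʳ t w w′) ⟩
        u • (t • (w ⊛ w′))     ≈⟨ M.•-assoc u t (w ⊛ w′) ⟨
        (u * t) • (w ⊛ w′)     ≈⟨ M.•-cong ut≡1 p ⟩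
        1# • one               ≈⟨ M.•-identity one ⟩
        one                    ∎)
        where open import Relation.Binary.Reasoning.Setoid M.setoid

      unitGroup : AbelianGroup 0ℓ 0ℓ
      unitGroup = record
        { Carrier = Σ Vector Unit ; _≈_ = _~_ ; _∙_ = mul ; ε = one , one , A.*-identityˡ one ; _⁻¹ = inv
        ; isAbelianGroup = record
          { isGroup = record
            { isMonoid = record
              { isSemigroup = record
                { isMagma = record
                  { isEquivalence = record
                    { refl = λ {w} → ≈⇒~ {w} {w} M.refl
                    ; sym = λ {w} {v} → ~-sym {w} {v}
                    ; trans = λ {w} {v} {t} → ~-trans {w} {v} {t}
                    }
                  ; ∙-cong = λ {w} {w′} {v} {v′} → mul-cong {w} {w′} {v} {v′}
                  }
                ; assoc = λ w v t → ≈⇒~ {mul (mul w v) t} {mul w (mul v t)} (A.*-assoc (proj₁ w) (proj₁ v) (proj₁ t))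
                }
              ; identity = (λ w → ≈⇒~ {mul (one , one , A.*-identityˡ one) w} {w} (A.*-identityˡ (proj₁ w)))
                         , (λ w → ≈⇒~ {mul w (one , one , A.*-identityˡ one)} {w} (A.*-identityʳ (proj₁ w)))
              }
            ; inverse = (λ w → ≈⇒~ {mul (inv w) w} {one , one , A.*-identityˡ one} (proj₂ (proj₂ (inv w))))
                      , (λ w → ≈⇒~ {mul w (inv w)} {one , one , A.*-identityˡ one} (proj₂ (proj₂ w)))
            ; ⁻¹-cong = λ {w} {v} → inv-cong {w} {v}
            }
          ; comm = λ w v → ≈⇒~ {mul w v} {mul v w} (A.*-comm (proj₁ w) (proj₁ v))
          }
        }

      -- Adjacency says that the product of the labels has first coordinate `value`. By `G-value`
      -- this condition depends only on the class modulo G: 1 is fixed by the trivial group, 0 by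
      -- all scalars.
      module _ (value : Carrier) (G-value : ∀ {u} → G u → u * value ≡ value)
        (_≈ᵁ_ : UVec R n → UVec R n → Set)
        (≈ᵁ⇒ : ∀ {a b} → a ≈ᵁ b → ∃ λ u → G u × (∀ i → lookup (proj₁ b) i ≡ u * lookup (proj₁ a) i))
        (≈ᵁ⇐ : ∀ {a b} → (∃ λ u → G u × (∀ i → lookup (proj₁ b) i ≡ u * lookup (proj₁ a) i)) → a ≈ᵁ b)
        where

        α β : UVec R n → Σ Vector Unit
        α (a , a-unimodular) = lookup a , unit (lookup a) (unimodular⇒unit-coordinate a-unimodular)
        β (b , b-unimodular) = T b , unit (T b) (T-unit-coordinate b-unimodular)

        isCayley : IsCayley (record
          { V    = Bool × UVec R n
          ; _≈_  = λ u v → proj₁ u ≡ proj₁ v × proj₂ u ≈ᵁ proj₂ v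
          ; E    = λ u v → proj₁ u ≢ proj₁ v × dot R (proj₁ (proj₂ u)) (proj₁ (proj₂ v)) ≡ value
          ; side = proj₁
          })
        isCayley = Dihedral.bipartite-isCayley unitGroup _≈ᵁ_
          (λ a b → dot R (proj₁ a) (proj₁ b) ≡ value)
          (λ {a} {b} eq → trans (dot-comm (proj₁ b) (proj₁ a)) eq)
          α β ≈ᵁ⇒ ≈ᵁ⇐ α-surjective β-cong β-injective β-surjective
          (λ w → proj₁ w zero ≡ value)
          (λ { (u , u∈ , eq) w₀≡ → trans (eq zero) (trans (cong (u *_) w₀≡) (G-value u∈)) })
          (λ {a} {b} eq → trans (sym (dot-T (proj₁ a) (proj₁ b))) eq)
          (λ {a} {b} eq → trans (dot-T (proj₁ a) (proj₁ b)) eq)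
          where
          α-surjective : ∀ w → ∃ λ a → α a ~ w
          α-surjective (w , w-unit) = (tabulate w , unimodular) ,
            ≈⇒~ {α (tabulate w , unimodular)} {w , w-unit} (Vec.lookup∘tabulate w)
            where
            i = proj₁ (unit-coordinate w w-unit)
            unimodular : Unimodular R (tabulate w)
            unimodular = unit-coordinate⇒unimodular (tabulate w) i
              (subst (IsUnit R) (sym (Vec.lookup∘tabulate w i)) (proj₂ (unit-coordinate w w-unit)))

          β-cong : ∀ {a b} → a ≈ᵁ b → β a ~ β b
          β-cong {a} {b} a≈b with ≈ᵁ⇒ a≈b
          ... | u , u∈ , eq = u , u∈ , L-injective (λ i → trans (L-T (proj₁ b) i) (trans (eq i)
            (trans (cong (u *_) (sym (L-T (proj₁ a) i))) (sym (L-• u (T (proj₁ a)) i)))))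

          β-injective : ∀ {a b} → β a ~ β b → a ≈ᵁ b
          β-injective {a} {b} (u , u∈ , eq) = ≈ᵁ⇐ (u , u∈ , λ i → trans (sym (L-T (proj₁ b) i))
            (trans (L-cong eq i) (trans (L-• u (T (proj₁ a)) i) (cong (u *_) (L-T (proj₁ a) i)))))

          β-surjective : ∀ w → ∃ λ b → β b ~ w
          β-surjective (w , w′ , ww′≈e) = (b , tabulate w′ , unimodular) ,
            ≈⇒~ {β (b , tabulate w′ , unimodular)} {w , w′ , ww′≈e}
              (L-injective (λ i → trans (L-T b i) (Vec.lookup∘tabulate (L w) i)))
            where
            b = tabulate (L w)
            -- The inverse of `w` is itself the witness: its dot product with `L w` is (w′ w)₀ = 1.
            unimodular : dot R (tabulate w′) b ≡ 1#
            unimodular = trans (sym (act-L w′ w)) (trans (A.*-comm w′ w zero) (ww′≈e zero))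

-- Paths and diameters

s≢not-s : ∀ s → s ≢ not s
s≢not-s false ()
s≢not-s true  ()

not-s≢s : ∀ s → not s ≢ s
not-s≢s false ()
not-s≢s true  ()

avoid-two : ∀ {k} (i j : Fin (3 ℕ.+ k)) → ∃ λ l → l ≢ i × l ≢ j
avoid-two zero          zero          = suc zero , (λ ()) , (λ ())
avoid-two zero          (suc zero)    = suc (suc zero) , (λ ()) , (λ ())
avoid-two zero          (suc (suc _)) = suc zero , (λ ()) , (λ ())
avoid-two (suc zero)    zero          = suc (suc zero) , (λ ()) , (λ ())
avoid-two (suc (suc _)) zero          = suc zero , (λ ()) , (λ ())
avoid-two (suc _)       (suc _)       = zero , (λ ()) , (λ ())

module Geometry (R : FinCommRing) (π : FinCommRing.Carrier R) (uniformizer : IsUniformizer R π)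
  (ℓ : ℕ) (nilDegree : NilDegree R π ℓ) where
  open ValuationRing R π uniformizer ℓ nilDegree public
  open import Algebra.Solver.Ring.NaturalCoefficients.Default commutativeSemiring
  open ≡.≡-Reasoning

  infixl 6 _⊞_
  _⊞_ : ∀ {n} → Vec Carrier n → Vec Carrier n → Vec Carrier n
  _⊞_ = zipWith _+_

  infixr 7 _·_
  _·_ : ∀ {n} → Carrier → Vec Carrier n → Vec Carrier n
  u · a = Vec.map (u *_) a

  dot-⊞ : ∀ {n} (a b c : Vec Carrier n) → dot R (a ⊞ b) c ≡ dot R a c + dot R b c
  dot-⊞ []      []      []      = sym (+-identityˡ 0#)
  dot-⊞ (x ∷ a) (y ∷ b) (z ∷ c) = trans (cong ((x + y) * z +_) (dot-⊞ a b c))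
    (solve 5 (λ x y z s t → (x :+ y) :* z :+ (s :+ t) := (x :* z :+ s) :+ (y :* z :+ t)) refl x y z _ _)

  dot-· : ∀ {n} u (a c : Vec Carrier n) → dot R (u · a) c ≡ u * dot R a c
  dot-· u []      []      = sym (zeroʳ u)
  dot-· u (x ∷ a) (z ∷ c) = trans (cong (u * x * z +_) (dot-· u a c))
    (solve 4 (λ u x z s → u :* x :* z :+ u :* s := u :* (x :* z :+ s)) refl u x z _)

  dot-·ʳ : ∀ {n} u (a c : Vec Carrier n) → dot R a (u · c) ≡ u * dot R a c
  dot-·ʳ u a c = trans (dot-comm a (u · c)) (trans (dot-· u c a) (cong (u *_) (dot-comm c a)))

  dot-⊞ʳ : ∀ {n} (c a b : Vec Carrier n) → dot R c (a ⊞ b) ≡ dot R c a + dot R c b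
  dot-⊞ʳ c a b = trans (dot-comm c (a ⊞ b)) (trans (dot-⊞ a b c) (cong₂ _+_ (dot-comm a c) (dot-comm b c)))

  dot-zeroʳ : ∀ {n} (a : Vec Carrier n) → dot R a (Vec.replicate n 0#) ≡ 0#
  dot-zeroʳ a = trans (dot-comm a _) (dot-zeroˡ a)

  -- Of the first two entries one divides the other, since R is a chain ring. With quotient s, the
  -- vector (-s, 1, 0, ...) or (1, -s, 0, ...) is orthogonal.
  orthogonal : ∀ {m} (a : Vec Carrier (2 ℕ.+ m)) → ∃ λ c → dot R a c ≡ 0# × Unimodular R c
  orthogonal {m} (x ∷ y ∷ a) with divisibility-total x y
  ... | inj₁ (s , refl) = (- s) ∷ 1# ∷ Vec.replicate m 0# , (begin
      x * - s + (s * x * 1# + dot R a (Vec.replicate m 0#)) ≡⟨ cong (λ t → x * - s + (s * x * 1# + t)) (dot-zeroʳ a) ⟩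
      x * - s + (s * x * 1# + 0#)                           ≡⟨ solve 3 (λ x s s′ → x :* s′ :+ (s :* x :* con 1 :+ con 0) := x :* (s′ :+ s)) refl x s (- s) ⟩
      x * (- s + s)                                         ≡⟨ cong (x *_) (-‿inverseˡ s) ⟩
      x * 0#                                                ≡⟨ zeroʳ x ⟩
      0#                                                    ∎)
    , unit-coordinate⇒unimodular _ (suc zero) (1# , *-identityˡ 1#)
  ... | inj₂ (s , refl) = 1# ∷ (- s) ∷ Vec.replicate m 0# , (begin
      s * y * 1# + (y * - s + dot R a (Vec.replicate m 0#)) ≡⟨ cong (λ t → s * y * 1# + (y * - s + t)) (dot-zeroʳ a) ⟩
      s * y * 1# + (y * - s + 0#)                           ≡⟨ solve 3 (λ x s s′ → s :* x :* con 1 :+ (x :* s′ :+ con 0) := x :* (s′ :+ s)) refl y s (- s) ⟩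
      y * (- s + s)                                         ≡⟨ cong (y *_) (-‿inverseˡ s) ⟩
      y * 0#                                                ≡⟨ zeroʳ y ⟩
      0#                                                    ∎)
    , unit-coordinate⇒unimodular _ zero (1# , *-identityˡ 1#)

  cancel-difference : ∀ x y → x + (y + - x) ≡ y
  cancel-difference x y = begin
    x + (y + - x)   ≡⟨ solve 3 (λ x y z → x :+ (y :+ z) := (x :+ z) :+ y) refl x y (- x) ⟩
    x + - x + y     ≡⟨ cong (_+ y) (-‿inverseʳ x) ⟩
    0# + y          ≡⟨ +-identityˡ y ⟩
    y               ∎

  -- The system is triangular: α s has the right product with c, and adding a multiple of t corrects
  -- the product with d without disturbing c.
  solve-pair : ∀ {n} (s t c d : Vec Carrier n) → dot R s c ≡ 1# → dot R t c ≡ 0# → dot R t d ≡ 1# →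
    ∀ α β → ∃ λ a → dot R a c ≡ α × dot R a d ≡ β
  solve-pair s t c d sc tc td α β = α · s ⊞ k · t
    , (begin
        dot R (α · s ⊞ k · t) c          ≡⟨ value c ⟩
        α * dot R s c + k * dot R t c    ≡⟨ cong₂ (λ x y → α * x + k * y) sc tc ⟩
        α * 1# + k * 0#                  ≡⟨ solve 2 (λ α k → α :* con 1 :+ k :* con 0 := α) refl α k ⟩
        α                                ∎)
    , (begin
        dot R (α · s ⊞ k · t) d          ≡⟨ value d ⟩
        α * dot R s d + k * dot R t d    ≡⟨ cong (λ x → α * dot R s d + k * x) td ⟩
        α * dot R s d + k * 1#           ≡⟨ cong (α * dot R s d +_) (*-identityʳ k) ⟩
        α * dot R s d + k                ≡⟨ cancel-difference _ β ⟩
        β                                ∎)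
    where
    k = β + - (α * dot R s d)
    value : ∀ v → dot R (α · s ⊞ k · t) v ≡ α * dot R s v + k * dot R t v
    value v = trans (dot-⊞ (α · s) (k · t) v) (cong₂ _+_ (dot-· α s v) (dot-· k t v))

  three-path : ∀ {m} (a b : Vec Carrier (2 ℕ.+ m)) → Unimodular R a → Unimodular R b →
    ∃₂ λ b₁ a₁ → dot R a b₁ ≡ 1# × dot R a₁ b₁ ≡ 1# × dot R a₁ b ≡ 1#
  three-path a b (d , da≡1) (s , sb≡1) with unit-or-⟨π⟩ (dot R a b)
  -- Adding to y b a vector c orthogonal to a keeps a·b₁ = 1. It remains to solve a₁·b = 1 and a₁·c
  -- = 1 - y, for which y a is 0 on c and 1 on b, while c has a dual vector by unimodularity.
  ... | inj₁ (y , xy≡1) = b₁ , a₁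
    , (begin
        dot R a (y · b ⊞ c)            ≡⟨ dot-⊞ʳ a (y · b) c ⟩
        dot R a (y · b) + dot R a c    ≡⟨ cong₂ _+_ (trans (dot-·ʳ y a b) (trans (*-comm y _) xy≡1)) ac≡0 ⟩
        1# + 0#                        ≡⟨ +-identityʳ 1# ⟩
        1#                             ∎)
    , (begin
        dot R a₁ (y · b ⊞ c)           ≡⟨ dot-⊞ʳ a₁ (y · b) c ⟩
        dot R a₁ (y · b) + dot R a₁ c  ≡⟨ cong₂ _+_ (trans (dot-·ʳ y a₁ b) (trans (cong (y *_) a₁b≡1) (*-identityʳ y))) a₁c≡ ⟩
        y + (1# + - y)                 ≡⟨ cancel-difference y 1# ⟩
        1#                             ∎)
    , a₁b≡1
    where
    c = proj₁ (orthogonal a)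
    ac≡0 = proj₁ (proj₂ (orthogonal a))
    solution = solve-pair (proj₁ (proj₂ (proj₂ (orthogonal a)))) (y · a) c b (proj₂ (proj₂ (proj₂ (orthogonal a))))
      (trans (dot-· y a c) (trans (cong (y *_) ac≡0) (zeroʳ y)))
      (trans (dot-· y a b) (trans (*-comm y _) xy≡1)) (1# + - y) 1#
    b₁ = y · b ⊞ c
    a₁ = proj₁ solution
    a₁c≡ = proj₁ (proj₂ solution)
    a₁b≡1 = proj₂ (proj₂ solution)
  -- Here b₁ is the witness d with a·d = 1, and a₁ has product 1 with both b and d. The vector t = a
  -- - x s is orthogonal to b, and t·d = 1 - x (s·d) is a unit because x lies in (π).
  ... | inj₂ x∈⟨π⟩ = d , a₁ , trans (dot-comm a d) da≡1 , proj₂ (proj₂ solution) , proj₁ (proj₂ solution)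
    where
    x = dot R a b
    t = a ⊞ (- x) · s
    value : ∀ v → dot R t v ≡ dot R a v + - x * dot R s v
    value v = trans (dot-⊞ a _ v) (cong (dot R a v +_) (dot-· (- x) s v))
    tb≡0 : dot R t b ≡ 0#
    tb≡0 = begin
      dot R t b                ≡⟨ value b ⟩
      x + - x * dot R s b      ≡⟨ cong (λ z → x + - x * z) sb≡1 ⟩
      x + - x * 1#             ≡⟨ cong (x +_) (*-identityʳ (- x)) ⟩
      x + - x                  ≡⟨ -‿inverseʳ x ⟩
      0#                       ∎
    td-unit : IsUnit R (dot R t d)
    td-unit = ∉⟨π⟩⇒unit λ td∈ → 1∉⟨π⟩ (subst (⟨_⟩ R π) (begin
      dot R t d + dot R s d * x                      ≡⟨ cong (_+ dot R s d * x) (value d) ⟩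
      dot R a d + - x * dot R s d + dot R s d * x    ≡⟨ solve 4 (λ p n x s → p :+ n :* s :+ s :* x := p :+ (n :+ x) :* s) refl (dot R a d) (- x) x (dot R s d) ⟩
      dot R a d + (- x + x) * dot R s d              ≡⟨ cong₂ (λ p z → p + z * dot R s d) (trans (dot-comm a d) da≡1) (-‿inverseˡ x) ⟩
      1# + 0# * dot R s d                            ≡⟨ solve 1 (λ s → con 1 :+ con 0 :* s := con 1) refl (dot R s d) ⟩
      1#                                             ∎) (⟨π⟩-+ td∈ (⟨π⟩-* (dot R s d) x∈⟨π⟩)))
    w = proj₁ td-unit
    solution = solve-pair s (w · t) b d sb≡1
      (trans (dot-· w t b) (trans (cong (w *_) tb≡0) (zeroʳ w)))
      (trans (dot-· w t d) (trans (*-comm w _) (proj₂ td-unit))) 1# 1#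
    a₁ = proj₁ solution

  basis : ∀ n → UVec R (suc n)
  basis n = 1# ∷ Vec.replicate n 0# , unit-coordinate⇒unimodular _ zero (1# , *-identityˡ 1#)

  basis-dot : ∀ n → dot R (proj₁ (basis n)) (proj₁ (basis n)) ≡ 1#
  basis-dot n = trans (cong₂ _+_ (*-identityˡ 1#) (dot-zeroˡ (Vec.replicate n 0#))) (+-identityʳ 1#)

  um-path₃ : ∀ {m} s (a b : UVec R (2 ℕ.+ m)) → Reach (Um R (2 ℕ.+ m)) 3 (s , a) (not s , b)
  um-path₃ s (a , a-uni) (b , b-uni) with three-path a b a-uni b-uni
  ... | b₁ , a₁ , ab₁ , a₁b₁ , a₁b =
    inj₂ ((not s , b₁ , a , ab₁) , (s≢not-s s , ab₁) ,
    inj₂ ((s , a₁ , b , trans (dot-comm b a₁) a₁b) , (not-s≢s s , trans (dot-comm b₁ a₁) a₁b₁) ,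
    inj₂ ((not s , b , b-uni) , (s≢not-s s , a₁b) , refl , refl)))

  -- Vertices on one side are joined by one edge followed by a path of length 3. In the other
  -- direction, parity leaves lengths 0 and 2 to be excluded for e₁ and u e₁, and u ≠ 1 excludes
  -- both.
  um-diameter : ∀ {m} u → IsUnit R u → u ≢ 1# → Diameter (Um R (2 ℕ.+ m)) 4
  um-diameter {m} u u-unit u≢1 = reach , (true , e₁) , (true , ue₁ , ue₁-unimodular) , far
    where
    reach : ∀ v w → Reach (Um R (2 ℕ.+ m)) 4 v w
    reach (true  , a) (false , b) = inj₁ (um-path₃ true a b)
    reach (false , a) (true  , b) = inj₁ (um-path₃ false a b)
    reach (true  , a , c , ca) (true  , b) =
      inj₂ ((false , c , a , trans (dot-comm a c) ca) , ((λ ()) , trans (dot-comm a c) ca) , um-path₃ false (c , a , trans (dot-comm a c) ca) b)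
    reach (false , a , c , ca) (false , b) =
      inj₂ ((true , c , a , trans (dot-comm a c) ca) , ((λ ()) , trans (dot-comm a c) ca) , um-path₃ true (c , a , trans (dot-comm a c) ca) b)

    e₁ = basis (suc m)
    ue₁ = u · proj₁ e₁
    ue₁-unimodular : Unimodular R ue₁
    ue₁-unimodular = unit-coordinate⇒unimodular ue₁ zero (subst (IsUnit R) (sym (*-identityʳ u)) u-unit)

    common : ∀ (w : Vec Carrier (2 ℕ.+ m)) → dot R (proj₁ e₁) w ≡ 1# → ¬ dot R w ue₁ ≡ 1#
    common w e₁w wue₁ = u≢1 (begin
      u                        ≡⟨ *-identityʳ u ⟨
      u * 1#                   ≡⟨ cong (u *_) (trans (dot-comm w (proj₁ e₁)) e₁w) ⟨
      u * dot R w (proj₁ e₁)   ≡⟨ dot-·ʳ u w (proj₁ e₁) ⟨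
      dot R w ue₁              ≡⟨ wue₁ ⟩
      1#                       ∎)

    -- `Reach` is cumulative, so paths of length one and two are treated together: the former end on
    -- the wrong side, the latter give a common neighbour.
    one-step : ∀ w → ¬ (Graph.E (Um R (2 ℕ.+ m)) (true , e₁) w × Reach (Um R (2 ℕ.+ m)) 1 w (true , ue₁ , ue₁-unimodular))
    one-step (true  , w) ((ne , _) , _) = ne refl
    one-step (false , w) (_ , inj₁ (() , _))
    one-step (false , w) ((_ , e₁w) , inj₂ ((true , .ue₁ , _) , (_ , ww′) , _ , refl)) = common (proj₁ w) e₁w ww′
    one-step (false , w) ((_ , e₁w) , inj₂ ((false , w′) , (ne , _) , _)) = ne refl

    far : ¬ Reach (Um R (2 ℕ.+ m)) 3 (true , e₁) (true , ue₁ , ue₁-unimodular)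
    far (inj₁ (inj₁ (inj₁ (_ , eq)))) =
      u≢1 (trans (sym (*-identityʳ u)) (sym (proj₁ (Vec.∷-injective eq))))
    far (inj₁ (inj₁ (inj₂ (w , E , w≈)))) = one-step w (E , inj₁ w≈)
    far (inj₁ (inj₂ (w , E , r)))         = one-step w (E , r)
    far (inj₂ (w , E , inj₁ r))           = one-step w (E , r)
    far (inj₂ ((true  , w) , (ne , _) , _)) = ne refl
    far (inj₂ ((false , w) , E , inj₂ ((false , w′) , (ne , _) , _))) = ne refl
    far (inj₂ ((false , w) , E , inj₂ ((true , w′) , E′ , inj₁ w′≈))) =
      one-step (false , w) (E , inj₂ ((true , w′) , E′ , w′≈))
    far (inj₂ ((false , w) , E , inj₂ ((true , w′) , E′ , inj₂ ((true , w″) , (ne , _) , _)))) = ne refl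
    far (inj₂ ((false , w) , E , inj₂ ((true , w′) , E′ , inj₂ ((false , w″) , _ , () , _))))

  dot-insertAt : ∀ {n} (a b : Vec Carrier n) i x y → dot R (insertAt a i x) (insertAt b i y) ≡ x * y + dot R a b
  dot-insertAt a       b       zero    x y = refl
  dot-insertAt (p ∷ a) (r ∷ b) (suc i) x y = trans (cong (p * r +_) (dot-insertAt a b i x y))
    (solve 3 (λ s t d → s :+ (t :+ d) := t :+ (s :+ d)) refl (p * r) (x * y) (dot R a b))

  dot-insertAtʳ : ∀ {n} (a : Vec Carrier (suc n)) b i y →
    dot R a (insertAt b i y) ≡ lookup a i * y + dot R (removeAt a i) b
  dot-insertAtʳ a b i y = trans (cong (λ a → dot R a (insertAt b i y)) (sym (Vec.insertAt-removeAt a i)))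
    (dot-insertAt (removeAt a i) b i (lookup a i) y)

  -- On a·b = t the i-th entry of b is determined by the others, which are free.
  module Hyperplane {n} (a : Vec Carrier (suc n)) (i : Fin (suc n)) (v : Carrier) (av≡1 : lookup a i * v ≡ 1#) (t : Carrier) where
    a′ = removeAt a i

    solved : Vec Carrier n → Carrier
    solved b = v * t + - v * dot R a′ b

    point : Vec Carrier n → Vec Carrier (suc n)
    point b = insertAt b i (solved b)

    dot-point : ∀ b → dot R a (point b) ≡ t
    dot-point b = begin
      dot R a (point b)                                         ≡⟨ dot-insertAtʳ a b i _ ⟩
      lookup a i * (v * t + - v * D) + D                        ≡⟨ cong (λ z → lookup a i * (v * t + z) + D) (-‿distribˡ-* v D) ⟨
      lookup a i * (v * t + - (v * D)) + D                      ≡⟨ cong (λ z → lookup a i * (v * t + z) + D) (-‿distribʳ-* v D) ⟩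
      lookup a i * (v * t + v * - D) + D                        ≡⟨ solve 5 (λ l v t d′ d → l :* (v :* t :+ v :* d′) :+ d := (l :* v) :* (t :+ d′) :+ d) refl (lookup a i) v t (- D) D ⟩
      (lookup a i * v) * (t + - D) + D                          ≡⟨ cong (λ z → z * (t + - D) + D) av≡1 ⟩
      1# * (t + - D) + D                                        ≡⟨ solve 3 (λ t d′ d → con 1 :* (t :+ d′) :+ d := d :+ (t :+ d′)) refl t (- D) D ⟩
      D + (t + - D)                                             ≡⟨ cancel-difference D t ⟩
      t                                                         ∎
      where D = dot R a′ b

    point-removeAt : ∀ b → dot R a b ≡ t → b ≡ point (removeAt b i)
    point-removeAt b ab≡t = trans (sym (Vec.insertAt-removeAt b i)) (cong (insertAt (removeAt b i) i)
      (unit-cancel (v , av≡1) (∙-cancelʳ (dot R a′ (removeAt b i)) _ _ (begin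
        lookup a i * lookup b i + dot R a′ (removeAt b i)               ≡⟨ dot-insertAtʳ a (removeAt b i) i (lookup b i) ⟨
        dot R a (insertAt (removeAt b i) i (lookup b i))                ≡⟨ cong (dot R a) (Vec.insertAt-removeAt b i) ⟩
        dot R a b                                                       ≡⟨ trans ab≡t (sym (dot-point (removeAt b i))) ⟩
        dot R a (point (removeAt b i))                                  ≡⟨ dot-insertAtʳ a (removeAt b i) i _ ⟩
        lookup a i * solved (removeAt b i) + dot R a′ (removeAt b i)    ∎))))

    -- A 0 at position i of the witness makes the solved entry irrelevant.
    point-unimodular : ∀ {b} → Unimodular R b → Unimodular R (point b)
    point-unimodular {b} (c , cb≡1) = insertAt c i 0# ,
      trans (dot-insertAt c b i 0# _) (trans (cong₂ _+_ (zeroˡ _) cb≡1) (+-identityˡ 1#))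

  module LinearHyperplane {n} (a : Vec Carrier (suc n)) (i : Fin (suc n)) (v : Carrier) (av≡1 : lookup a i * v ≡ 1#) where
    open Hyperplane a i v av≡1 0# public

    solved-linear : ∀ b → solved b ≡ - v * dot R a′ b
    solved-linear b = solve 2 (λ v d → v :* con 0 :+ d := d) refl v _

    -- The adjoint of `point`: the functional of c on the hyperplane, expressed in its n free
    -- coordinates.
    restrict : Vec Carrier (suc n) → Vec Carrier n
    restrict c = removeAt c i ⊞ (lookup c i * - v) · a′

    dot-restrict : ∀ c b → dot R c (point b) ≡ dot R (restrict c) b
    dot-restrict c b = begin
      dot R c (point b)                                             ≡⟨ dot-insertAtʳ c b i _ ⟩
      lookup c i * solved b + dot R (removeAt c i) b                ≡⟨ cong (λ z → lookup c i * z + dot R (removeAt c i) b) (solved-linear b) ⟩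
      lookup c i * (- v * dot R a′ b) + dot R (removeAt c i) b      ≡⟨ solve 4 (λ l v d e → l :* (v :* d) :+ e := e :+ l :* v :* d) refl (lookup c i) (- v) (dot R a′ b) _ ⟩
      dot R (removeAt c i) b + lookup c i * - v * dot R a′ b        ≡⟨ cong (dot R (removeAt c i) b +_) (dot-· _ a′ b) ⟨
      dot R (removeAt c i) b + dot R ((lookup c i * - v) · a′) b    ≡⟨ dot-⊞ (removeAt c i) _ b ⟨
      dot R (restrict c) b                                          ∎

  -- The hyperplane orthogonal to a has at least two free coordinates, so the functional of a′
  -- restricted to it has a unimodular orthogonal vector, and `point` preserves unimodularity.
  common-orthogonal : ∀ {m} (a a′ : UVec R (3 ℕ.+ m)) →
    Σ (UVec R (3 ℕ.+ m)) λ b → dot R (proj₁ a) (proj₁ b) ≡ 0# × dot R (proj₁ a′) (proj₁ b) ≡ 0#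
  common-orthogonal (a , a-uni) (a′ , _) =
    let (i , v , av≡1) = unimodular⇒unit-coordinate a-uni
        open LinearHyperplane a i v av≡1 hiding (a′)
        (c , a″c≡0 , c-uni) = orthogonal (restrict a′)
    in (point c , point-unimodular c-uni) , dot-point c , trans (dot-restrict a′ c) a″c≡0

  assoc-refl : ∀ {n} (a : Vec Carrier n) → Assoc R a a
  assoc-refl a = 1# , (1# , *-identityˡ 1#) , sym (trans (Vec.map-cong *-identityˡ a) (Vec.map-id a))

  -- Opposite sides are joined by one edge followed by a path of length 2. The two copies of e₁ have
  -- odd distance and are not adjacent because e₁·e₁ = 1, so they are at distance 3.
  um₀-diameter : ∀ {m} → Diameter (Um₀ R (3 ℕ.+ m)) 3
  um₀-diameter {m} = reach , (true , e₁) , (false , e₁) , far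
    where
    G = Um₀ R (3 ℕ.+ m)
    e₁ = basis (2 ℕ.+ m)

    path₂ : ∀ s a b → Reach G 2 (s , a) (s , b)
    path₂ s a b = let (c , ac , bc) = common-orthogonal a b in inj₂ ((not s , c) , (s≢not-s s , ac) ,
      inj₂ ((s , b) , (not-s≢s s , trans (dot-comm (proj₁ c) (proj₁ b)) bc) , refl , assoc-refl (proj₁ b)))

    path₃ : ∀ s a b → Reach G 3 (s , a) (not s , b)
    path₃ s a b = let (c , ac , _) = common-orthogonal a a in inj₂ ((not s , c) , (s≢not-s s , ac) , path₂ (not s) c b)

    reach : ∀ v w → Reach G 3 v w
    reach (true  , a) (true  , b) = inj₁ (path₂ true a b)
    reach (false , a) (false , b) = inj₁ (path₂ false a b)
    reach (true  , a) (false , b) = path₃ true a b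
    reach (false , a) (true  , b) = path₃ false a b

    not-adjacent : ∀ w → ¬ (Graph.E G (true , e₁) w × Graph._≈_ G w (false , e₁))
    not-adjacent (_ , w , _) ((_ , e₁w≡0) , _ , u , _ , eq) = 1≢0 (begin
      1#                               ≡⟨ basis-dot (2 ℕ.+ m) ⟨
      dot R (proj₁ e₁) (proj₁ e₁)      ≡⟨ cong (dot R (proj₁ e₁)) eq ⟩
      dot R (proj₁ e₁) (u · w)         ≡⟨ dot-·ʳ u (proj₁ e₁) w ⟩
      u * dot R (proj₁ e₁) w           ≡⟨ cong (u *_) e₁w≡0 ⟩
      u * 0#                           ≡⟨ zeroʳ u ⟩
      0#                               ∎)

    far : ¬ Reach G 2 (true , e₁) (false , e₁)
    far (inj₁ (inj₁ (() , _)))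
    far (inj₁ (inj₂ (w , E , w≈)))       = not-adjacent w (E , w≈)
    far (inj₂ (w , E , inj₁ w≈))         = not-adjacent w (E , w≈)
    far (inj₂ ((true  , w) , (ne , _) , inj₂ _)) = ne refl
    far (inj₂ ((false , w) , _ , inj₂ ((false , w′) , (ne , _) , _))) = ne refl
    far (inj₂ ((false , w) , _ , inj₂ ((true , w′) , _ , () , _)))

  lookup-ext : ∀ {n} {a b : Vec Carrier n} → (∀ i → lookup a i ≡ lookup b i) → a ≡ b
  lookup-ext {a = a} {b} eq = trans (sym (Vec.tabulate∘lookup a)) (trans (Vec.tabulate-cong eq) (Vec.tabulate∘lookup b))

  module _ {q : ℕ} (residueSize : ResidueSize R π (suc q)) (m : ℕ) where
    open Extension R π uniformizer ℓ nilDegree residueSize m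

    um-isCayley : IsCayley (Um R (suc m))
    um-isCayley = isCayley 1# (λ { refl → *-identityˡ 1# }) (λ a b → proj₁ a ≡ proj₁ b)
      (λ { refl → 1# , refl , λ i → sym (*-identityˡ _) })
      (λ { (_ , refl , eq) → lookup-ext (λ i → sym (trans (eq i) (*-identityˡ _))) })
      where
      open Unramified (proj₁ irreducible) (proj₂ irreducible)
      trivial-* : ∀ {u v} → u ≡ 1# → v ≡ 1# → u * v ≡ 1#
      trivial-* refl refl = *-identityˡ 1#
      trivial-inverse : ∀ {u} → u ≡ 1# → ∃ λ v → v ≡ 1# × u * v ≡ 1#
      trivial-inverse refl = 1# , refl , *-identityˡ 1#
      open Quotient (_≡ 1#) refl trivial-* trivial-inverse

    um₀-isCayley : IsCayley (Um₀ R (suc m))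
    um₀-isCayley = isCayley 0# (λ _ → zeroʳ _) (λ a b → Assoc R (proj₁ a) (proj₁ b))
      (λ { {a} (u , u-unit , refl) → u , u-unit , λ i → Vec.lookup-map i (u *_) (proj₁ a) })
      (λ { {a} (u , u-unit , eq) → u , u-unit , lookup-ext (λ i → trans (eq i) (sym (Vec.lookup-map i (u *_) (proj₁ a)))) })
      where
      open Unramified (proj₁ irreducible) (proj₂ irreducible)
      units-* : ∀ {u v} → IsUnit R u → IsUnit R v → IsUnit R (u * v)
      units-* {u} {v} (u′ , uu′) (v′ , vv′) = u′ * v′ , trans
        (solve 4 (λ u v u′ v′ → u :* v :* (u′ :* v′) := u :* u′ :* (v :* v′)) refl u v u′ v′)
        (trans (cong₂ _*_ uu′ vv′) (*-identityˡ 1#))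
      units-inverse : ∀ {u} → IsUnit R u → ∃ λ v → IsUnit R v × u * v ≡ 1#
      units-inverse {u} (v , uv) = v , (u , trans (*-comm v u) uv) , uv
      open Quotient (IsUnit R) (1# , *-identityˡ 1#) units-* units-inverse

  -- With three residue classes, one differs from those of 0 and 1. Its representative is a unit by
  -- the first and different from 1 by the second.
  nontrivial-unit : ∀ {q} → ResidueSize R π (3 ℕ.+ q) → ∃ λ u → IsUnit R u × u ≢ 1#
  nontrivial-unit (f , _ , f-injective , f-surjective) with avoid-two (proj₁ (f-surjective 0# 0#)) (proj₁ (f-surjective 1# 1#))
  ... | l , l≢0 , l≢1 = f l
    , ∉⟨π⟩⇒unit (λ fl∈ → l≢0 (f-injective l _ (≡ᵖ⇒difference (K.trans (∈⇒≡ᵖ0 fl∈) (difference⇒≡ᵖ (proj₂ (f-surjective 0# 0#)))))))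
    , λ fl≡1 → l≢1 (f-injective l _ (subst (λ x → ⟨_⟩ R π (x - f (proj₁ (f-surjective 1# 1#)))) (sym fl≡1) (proj₂ (f-surjective 1# 1#))))
    where module K = CommutativeRing residueRing

-- Counting

numClasses-map : ∀ {A B : Set} {P : A → Set} {Q : B → Set} {m} (_~_ : A → A → Set) (_≈_ : B → B → Set) →
  (g : A → B) → (∀ {x} → P x → Q (g x)) → (∀ {x y} → P x → P y → g x ≈ g y → x ~ y) →
  (∀ {x y} → x ~ y → g x ≈ g y) → (∀ {x y z} → x ≈ y → y ≈ z → x ≈ z) →
  (∀ y → Q y → ∃ λ x → P x × y ≈ g x) →
  NumClasses P _~_ m → NumClasses Q _≈_ m
numClasses-map _ _ g g-P g-reflects g-cong ≈-trans g-onto (f , f-P , f-injective , f-onto) =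
  g ∘ f , g-P ∘ f-P ,
  (λ i j eq → f-injective i j (g-reflects (f-P i) (f-P j) eq)) ,
  λ y Qy → let (x , Px , y≈gx) = g-onto y Qy
               (i , x~fi) = f-onto x Px
           in i , ≈-trans y≈gx (g-cong x~fi)

-- The relation is not assumed symmetric, hence the two separation hypotheses.
numClasses-⊎ : ∀ {A : Set} {P Q : A → Set} {m n} (_~_ : A → A → Set) →
  (∀ {x y} → P x → Q y → ¬ x ~ y) → (∀ {x y} → P x → Q y → ¬ y ~ x) →
  NumClasses P _~_ m → NumClasses Q _~_ n → NumClasses (λ x → P x ⊎ Q x) _~_ (m ℕ.+ n)
numClasses-⊎ {P = P} {Q} {m} {n} _~_ apart apart′ (f , f-P , f-injective , f-onto) (g , g-Q , g-injective , g-onto) =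
  h ∘ splitAt m , (λ i → h-PQ (splitAt m i)) ,
  (λ i j eq → trans (sym (Fin.join-splitAt m n i))
    (trans (cong (join m n) (h-injective (splitAt m i) (splitAt m j) eq)) (Fin.join-splitAt m n j))) ,
  onto
  where
  h = [ f , g ]′
  h-PQ : ∀ i → P (h i) ⊎ Q (h i)
  h-PQ (inj₁ i) = inj₁ (f-P i)
  h-PQ (inj₂ i) = inj₂ (g-Q i)
  h-injective : ∀ i j → h i ~ h j → i ≡ j
  h-injective (inj₁ i) (inj₁ j) eq = cong inj₁ (f-injective i j eq)
  h-injective (inj₂ i) (inj₂ j) eq = cong inj₂ (g-injective i j eq)
  h-injective (inj₁ i) (inj₂ j) eq = contradiction eq (apart (f-P i) (g-Q j))
  h-injective (inj₂ i) (inj₁ j) eq = contradiction eq (apart′ (f-P j) (g-Q i))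
  onto : ∀ x → P x ⊎ Q x → ∃ λ i → x ~ h (splitAt m i)
  onto x (inj₁ Px) = let (i , eq) = f-onto x Px in
    i ↑ˡ n , subst (λ j → x ~ h j) (sym (Fin.splitAt-↑ˡ m i n)) eq
  onto x (inj₂ Qx) = let (i , eq) = g-onto x Qx in
    m ↑ʳ i , subst (λ j → x ~ h j) (sym (Fin.splitAt-↑ʳ m n i)) eq

numClasses-× : ∀ {A B : Set} {P : A → Set} {Q : B → Set} {m n} →
  NumClasses P _≡_ m → NumClasses Q _≡_ n → NumClasses {A × B} (λ z → P (proj₁ z) × Q (proj₂ z)) _≡_ (m ℕ.* n)
numClasses-× {m = m} {n} (f , f-P , f-injective , f-onto) (g , g-Q , g-injective , g-onto) =
  pair ∘ remQuot {m} n , (λ i → f-P _ , g-Q _) ,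
  (λ i j eq → trans (sym (Fin.combine-remQuot {m} n i))
    (trans (cong₂ combine (f-injective _ _ (cong proj₁ eq)) (g-injective _ _ (cong proj₂ eq))) (Fin.combine-remQuot {m} n j))) ,
  λ { (x , y) (Px , Qy) → let (i , x≡) = f-onto x Px ; (j , y≡) = g-onto y Qy in
      combine i j , trans (cong₂ _,_ x≡ y≡) (cong pair (sym (Fin.remQuot-combine i j))) }
  where pair = λ (k : Fin m × Fin n) → f (proj₁ k) , g (proj₂ k)

numClasses-Vec : ∀ {A : Set} {P : A → Set} {m} → NumClasses P _≡_ m →
  ∀ n → NumClasses {Vec A n} (λ a → ∀ i → P (lookup a i)) _≡_ (m ℕ.^ n)
numClasses-Vec cP zero    = (λ _ → []) , (λ _ ()) , (λ { zero zero _ → refl }) , λ { [] _ → zero , refl }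
numClasses-Vec cP (suc n) = numClasses-map _≡_ _≡_ (λ { (x , a) → x ∷ a })
  (λ { (Px , Pa) zero → Px ; (Px , Pa) (suc i) → Pa i })
  (λ _ _ eq → cong₂ _,_ (proj₁ (Vec.∷-injective eq)) (proj₂ (Vec.∷-injective eq)))
  (λ { refl → refl }) trans
  (λ { (x ∷ a) Pxa → (x , a) , (Pxa zero , Pxa ∘ suc) , refl })
  (numClasses-× cP (numClasses-Vec cP n))

numClasses-≤ : ∀ {A : Set} {P : A → Set} {m n} → NumClasses P _≡_ m → NumClasses P _≡_ n → m ℕ.≤ n
numClasses-≤ (f , f-P , f-injective , _) (g , _ , _ , g-onto) =
  Fin.injective⇒≤ {f = λ i → proj₁ (g-onto (f i) (f-P i))} (λ {i} {j} eq → f-injective i j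
    (trans (proj₂ (g-onto (f i) (f-P i))) (trans (cong g eq) (sym (proj₂ (g-onto (f j) (f-P j)))))))

numClasses-unique : ∀ {A : Set} {P : A → Set} {m n} → NumClasses P _≡_ m → NumClasses P _≡_ n → m ≡ n
numClasses-unique cm cn = ℕ.≤-antisym (numClasses-≤ cm cn) (numClasses-≤ cn cm)

numClasses-extend : ∀ {n} {Q : Fin (suc n) → Set} {k} → Q zero → NumClasses (Q ∘ suc) _≡_ k → NumClasses Q _≡_ (suc k)
numClasses-extend Q0 (f , f-Q , f-injective , f-onto) =
  (λ { zero → zero ; (suc i) → suc (f i) }) , (λ { zero → Q0 ; (suc i) → f-Q i }) ,
  (λ { zero zero _ → refl ; (suc i) (suc j) eq → cong suc (f-injective i j (Fin.suc-injective eq)) }) ,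
  λ { zero _ → zero , refl ; (suc x) Qx → let (i , eq) = f-onto x Qx in suc i , cong suc eq }

numClasses-skip : ∀ {n} {Q : Fin (suc n) → Set} {k} → ¬ Q zero → NumClasses (Q ∘ suc) _≡_ k → NumClasses Q _≡_ k
numClasses-skip ¬Q0 (f , f-Q , f-injective , f-onto) = suc ∘ f , f-Q ,
  (λ i j eq → f-injective i j (Fin.suc-injective eq)) ,
  λ { zero Q0 → contradiction Q0 ¬Q0 ; (suc x) Qx → let (i , eq) = f-onto x Qx in i , cong suc eq }

numClasses-filter : ∀ {n} {P : Fin n → Set} → (∀ i → Dec (P i)) →
  ∃₂ λ k k′ → NumClasses P _≡_ k × NumClasses (¬_ ∘ P) _≡_ k′ × k ℕ.+ k′ ≡ n
numClasses-filter {zero} P? = 0 , 0 , ((λ ()) , (λ ()) , (λ ()) , λ ()) , ((λ ()) , (λ ()) , (λ ()) , λ ()) , refl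
numClasses-filter {suc n} {P} P? with numClasses-filter (P? ∘ suc) | P? zero
... | k , k′ , cP , cN , k+k′≡n | yes P0 = suc k , k′ , numClasses-extend P0 cP , numClasses-skip (λ ¬P0 → ¬P0 P0) cN , cong suc k+k′≡n
... | k , k′ , cP , cN , k+k′≡n | no ¬P0 = k , suc k′ , numClasses-skip ¬P0 cP , numClasses-extend ¬P0 cN , trans (ℕ.+-suc k k′) (cong suc k+k′≡n)

-- Filtering the enumeration by P gives two counts with sum m. Uniqueness of cardinality identifies
-- the first with n, and so the second with the difference.
numClasses-complement : ∀ {A : Set} {P : A → Set} {m n} → NumClasses {A} (λ _ → ⊤) _≡_ m →
  (∀ x → Dec (P x)) → NumClasses P _≡_ n → NumClasses (¬_ ∘ P) _≡_ (m ℕ.∸ n)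
numClasses-complement {A} {P} {m} {n} (f , _ , f-injective , f-onto) P? cP with numClasses-filter {m} {P ∘ f} (P? ∘ f)
... | k , k′ , cPf , cNf , k+k′≡m = subst (NumClasses (¬_ ∘ P) _≡_) k′≡ (along cNf)
  where
  along : ∀ {Q : A → Set} {k} → NumClasses (Q ∘ f) _≡_ k → NumClasses Q _≡_ k
  along {Q} = numClasses-map _≡_ _≡_ f id (λ {i} {j} _ _ → f-injective i j) (cong f) trans
    (λ y Qy → let (i , y≡) = f-onto y tt in i , subst Q y≡ Qy , y≡)
  k′≡ : k′ ≡ m ℕ.∸ n
  k′≡ = trans (sym (ℕ.m+n∸m≡n k k′)) (cong₂ ℕ._∸_ k+k′≡m (numClasses-unique (along {P} cPf) cP))

-- Cardinalities over the valuation ring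

module Counting (R : FinCommRing) (π : FinCommRing.Carrier R) (uniformizer : IsUniformizer R π)
  (l : ℕ) (nilDegree : NilDegree R π (suc l)) {q : ℕ} (residueSize : ResidueSize R π q) where
  open Geometry R π uniformizer (suc l) nilDegree
  open import Algebra.Solver.Ring.NaturalCoefficients.Default commutativeSemiring
  open ≡.≡-Reasoning

  ρ μ : ℕ
  ρ = q ℕ.^ suc l
  μ = q ℕ.^ l

  _≡[_]_ : Carrier → ℕ → Carrier → Set
  x ≡[ k ] y = ∃ λ r → x ≡ y + r * pow π k

  -- Expansion in powers of π, with digits in a system of residues.
  digits : ∀ k → k ℕ.≤ suc l → Enumeration (λ x y → x ≡[ k ] y) (q ℕ.^ k)
  digits zero    _   = record
    { enum = λ _ → 0# ; injective = λ { {zero} {zero} _ → refl } ; index = λ _ → zero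
    ; enum-index = λ x → x , solve 1 (λ x → x := con 0 :+ x :* con 1) refl x }
  digits (suc k) k<ℓ = record
    { enum = value ∘ remQuot {q} (q ℕ.^ k)
    ; injective = λ {i} {j} eq → trans (sym (Fin.combine-remQuot {q} (q ℕ.^ k) i))
        (trans (cong₂ combine (proj₁ (value-injective eq)) (proj₂ (value-injective eq))) (Fin.combine-remQuot {q} (q ℕ.^ k) j))
    ; index = λ x → combine (F.index x) (D.index (proj₁ (F.enum-index x)))
    ; enum-index = λ x → let (r , x≡) = F.enum-index x ; (s , r≡) = D.enum-index r in s , (begin
        x                                                       ≡⟨ x≡ ⟩
        F.enum (F.index x) + r * π                              ≡⟨ cong (λ z → F.enum (F.index x) + z * π) r≡ ⟩
        F.enum (F.index x) + (D.enum (D.index r) + s * pow π k) * π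
          ≡⟨ solve 5 (λ a b s p y → a :+ (b :+ s :* y) :* p := (a :+ p :* b) :+ s :* (p :* y)) refl _ _ s π (pow π k) ⟩
        F.enum (F.index x) + π * D.enum (D.index r) + s * pow π (suc k)
          ≡⟨ cong (λ z → value z + s * pow π (suc k)) (Fin.remQuot-combine (F.index x) (D.index r)) ⟨
        value (remQuot {q} (q ℕ.^ k) (combine (F.index x) (D.index r))) + s * pow π (suc k) ∎)
    }
    where
    module F = FiniteField (residueField residueSize)
    module D = Enumeration (digits k (ℕ.<⇒≤ k<ℓ))
    value : Fin q × Fin (q ℕ.^ k) → Carrier
    value (i , j) = F.enum i + π * D.enum j
    value-injective : ∀ {z w} → value z ≡[ suc k ] value w → proj₁ z ≡ proj₁ w × proj₂ z ≡ proj₂ w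
    value-injective {i , j} {i′ , j′} (r , eq) = i≡i′ , second i≡i′
      where
      digit : ∀ i j → value (i , j) F.≈ F.enum i
      digit i j = D.enum j , cong (F.enum i +_) (*-comm π _)
      i≡i′ : i ≡ i′
      i≡i′ = F.injective (F.trans (F.sym (digit i j)) (F.trans
        (r * pow π k , trans eq (cong (value (i′ , j′) +_)
          (solve 3 (λ r p y → r :* (p :* y) := r :* y :* p) refl r π (pow π k))))
        (digit i′ j′)))
      second : i ≡ i′ → j ≡ j′
      second refl = D.injective (r + proj₁ difference , (begin
        D.enum j                                                 ≡⟨ cancel-difference y (D.enum j) ⟨
        y + (D.enum j + - y)                                     ≡⟨ cong (y +_) (proj₂ difference) ⟩
        y + proj₁ difference * pow π k                           ≡⟨ solve 4 (λ d r s y → (d :+ r :* y) :+ s :* y := d :+ (r :+ s) :* y) refl (D.enum j′) r _ (pow π k) ⟩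
        D.enum j′ + (r + proj₁ difference) * pow π k             ∎))
        where
        y = D.enum j′ + r * pow π k
        -- After the lowest digit is cancelled, π can be removed only up to its annihilator. For k <
        -- ℓ this lies in (π^k), which is the precision of the remaining digits.
        same : π * D.enum j ≡ π * y
        same = ∙-cancelˡ (F.enum i) _ _ (trans eq
          (solve 5 (λ a p b r z → (a :+ p :* b) :+ r :* (p :* z) := a :+ p :* (b :+ r :* z)) refl (F.enum i) π (D.enum j′) r (pow π k)))
        difference : ⟨_⟩ R (pow π k) (D.enum j + - y)
        difference = annihilator (begin
          π * (D.enum j + - y)          ≡⟨ distribˡ π _ _ ⟩
          π * D.enum j + π * - y        ≡⟨ cong₂ _+_ same (sym (-‿distribʳ-* π y)) ⟩
          π * y + - (π * y)             ≡⟨ -‿inverseʳ _ ⟩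
          0#                            ∎) k k<ℓ

  count-all : NumClasses {Carrier} (λ _ → ⊤) _≡_ ρ
  count-all = D.enum , (λ _ → tt) , (λ i j eq → D.injective (weaken eq)) ,
    λ x _ → D.index x , (let (r , x≡) = D.enum-index x in
      trans x≡ (trans (cong (λ z → D.enum (D.index x) + r * z) π^ℓ≡0)
        (solve 2 (λ d r → d :+ r :* con 0 := d) refl _ r)))
    where
    module D = Enumeration (digits (suc l) ℕ.≤-refl)
    weaken : ∀ {x y} → x ≡ y → x ≡[ suc l ] y
    weaken {x} {y} eq = 0# , trans eq (solve 2 (λ y z → y := y :+ con 0 :* z) refl y _)

  -- Multiplication by π has kernel (π^(ℓ-1)), so (π) corresponds to the residues modulo π^(ℓ-1).
  count-⟨π⟩ : NumClasses (⟨_⟩ R π) _≡_ μ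
  count-⟨π⟩ = (λ i → π * D.enum i) , (λ i → D.enum i , *-comm π _) ,
    (λ i j eq → D.injective (let (s , d≡) = annihilator (difference eq) l ℕ.≤-refl in
      s , trans (sym (cancel-difference (D.enum j) (D.enum i))) (cong (D.enum j +_) d≡))) ,
    λ { x (r , refl) → let (s , r≡) = D.enum-index r in D.index r , (begin
        r * π                                                  ≡⟨ cong (_* π) r≡ ⟩
        (D.enum (D.index r) + s * pow π l) * π                 ≡⟨ solve 4 (λ d s y p → (d :+ s :* y) :* p := p :* d :+ s :* (p :* y)) refl _ s (pow π l) π ⟩
        π * D.enum (D.index r) + s * pow π (suc l)             ≡⟨ cong (λ z → π * D.enum (D.index r) + s * z) π^ℓ≡0 ⟩
        π * D.enum (D.index r) + s * 0#                        ≡⟨ solve 2 (λ d s → d :+ s :* con 0 := d) refl _ s ⟩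
        π * D.enum (D.index r)                                 ∎) }
    where
    module D = Enumeration (digits l (ℕ.n≤1+n l))
    difference : ∀ {x y} → π * x ≡ π * y → π * (x + - y) ≡ 0#
    difference {x} {y} eq = begin
      π * (x + - y)         ≡⟨ distribˡ π x (- y) ⟩
      π * x + π * - y       ≡⟨ cong₂ _+_ eq (sym (-‿distribʳ-* π y)) ⟩
      π * y + - (π * y)     ≡⟨ -‿inverseʳ _ ⟩
      0#                    ∎

  count-vectors : ∀ n → NumClasses {Vec Carrier n} (λ _ → ⊤) _≡_ (ρ ℕ.^ n)
  count-vectors n = let (f , _ , f-injective , f-onto) = numClasses-Vec count-all n in
    f , (λ _ → tt) , f-injective , λ x _ → f-onto x (λ _ → tt)

  -- Over a local ring the vectors that are not unimodular are those with all entries in (π).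
  count-unimodular : ∀ n → NumClasses {Vec Carrier n} (Unimodular R) _≡_ (ρ ℕ.^ n ℕ.∸ μ ℕ.^ n)
  count-unimodular n = numClasses-map _≡_ _≡_ id
    (λ {a} ¬all → let (i , ∉) = Fin.¬∀⟶∃¬ n _ (λ i → ⟨π⟩? (lookup a i)) ¬all in
      unit-coordinate⇒unimodular a i (∉⟨π⟩⇒unit ∉))
    (λ _ _ eq → eq) id trans
    (λ a a-uni → let (i , ai-unit) = unimodular⇒unit-coordinate a-uni in
      a , (λ all → unit⇒∉⟨π⟩ ai-unit (all i)) , refl)
    (numClasses-complement (count-vectors n) (λ a → Fin.all? (λ i → ⟨π⟩? (lookup a i))) (numClasses-Vec count-⟨π⟩ n))

  lift-to-side : ∀ {n} (P : Vec Carrier n → Set) (_~_ : Vec Carrier n → Vec Carrier n → Set)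
    {Q : Bool × UVec R n → Set} {m} s →
    (∀ a a-uni → P a → Q (s , a , a-uni)) → (∀ v → Q v → s ≡ proj₁ v × P (proj₁ (proj₂ v))) →
    NumClasses (λ a → Unimodular R a × P a) _~_ m →
    NumClasses Q (λ u v → proj₁ u ≡ proj₁ v × proj₁ (proj₂ u) ~ proj₁ (proj₂ v)) m
  lift-to-side _ _ s PQ QP (f , f-P , f-injective , f-onto) =
    (λ i → s , f i , proj₁ (f-P i)) , (λ i → PQ _ _ (proj₂ (f-P i))) ,
    (λ i j eq → f-injective i j (proj₂ eq)) ,
    λ { v@(_ , a , a-uni) Qv → let (s≡ , Pa) = QP v Qv ; (i , eq) = f-onto a (a-uni , Pa) in i , sym s≡ , eq }

  um-halfSize : ∀ n → HalfSize (Um R n) (ρ ℕ.^ n ℕ.∸ μ ℕ.^ n)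
  um-halfSize n = lift-to-side (λ _ → ⊤) _≡_ true (λ _ _ _ → refl) (λ v eq → sym eq , tt)
    (numClasses-map _≡_ _≡_ id (λ a-uni → a-uni , tt) (λ _ _ eq → eq) id trans
      (λ a p → a , proj₁ p , refl) (count-unimodular n))

  ≢⇒not≡ : ∀ {s s′} → s ≢ s′ → not s ≡ s′
  ≢⇒not≡ {false} {false} ne = contradiction refl ne
  ≢⇒not≡ {false} {true}  _  = refl
  ≢⇒not≡ {true}  {false} _  = refl
  ≢⇒not≡ {true}  {true}  ne = contradiction refl ne

  neighbours : ∀ {n} t (_~_ : Vec Carrier n → Vec Carrier n → Set) s (a : UVec R n) {m} →
    NumClasses (λ b → Unimodular R b × dot R (proj₁ a) b ≡ t) _~_ m →
    NumClasses {Bool × UVec R n} (λ v → s ≢ proj₁ v × dot R (proj₁ a) (proj₁ (proj₂ v)) ≡ t)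
      (λ u v → proj₁ u ≡ proj₁ v × proj₁ (proj₂ u) ~ proj₁ (proj₂ v)) m
  neighbours t _~_ s (a , _) = lift-to-side (λ b → dot R a b ≡ t) _~_ (not s)
    (λ _ _ eq → s≢not-s s , eq) (λ { _ (ne , eq) → ≢⇒not≡ ne , eq })

  -- The free coordinates range over all of Rⁿ: a·b = 1 already makes b unimodular, with a as
  -- witness.
  count-hyperplane : ∀ {n} (a : Vec Carrier (suc n)) i v → lookup a i * v ≡ 1# →
    NumClasses (λ b → Unimodular R b × dot R a b ≡ 1#) _≡_ (ρ ℕ.^ n)
  count-hyperplane {n} a i v av≡1 = numClasses-map _≡_ _≡_ point (λ {b} _ → (a , dot-point b) , dot-point b)
    (λ {b} {b′} _ _ eq → trans (sym (Vec.removeAt-insertAt b i _))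
      (trans (cong (λ c → removeAt c i) eq) (Vec.removeAt-insertAt b′ i _)))
    (cong point) trans
    (λ b p → removeAt b i , tt , point-removeAt b (proj₂ p))
    (count-vectors n)
    where open Hyperplane a i v av≡1 1#

  um-regular : ∀ n → Regular (Um R (suc n)) (ρ ℕ.^ n)
  um-regular n (s , a) = let (i , v , av≡1) = unimodular⇒unit-coordinate (proj₂ a) in
    neighbours 1# _≡_ s a (count-hyperplane (proj₁ a) i v av≡1)

  assoc-trans : ∀ {n} {a b c : Vec Carrier n} → Assoc R a b → Assoc R b c → Assoc R a c
  assoc-trans {a = a} (u , (u′ , uu′) , refl) (v , (v′ , vv′) , refl) = v * u
    , (u′ * v′ , trans (solve 4 (λ u v u′ v′ → v :* u :* (u′ :* v′) := u :* u′ :* (v :* v′)) refl u v u′ v′)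
        (trans (cong₂ _*_ uu′ vv′) (*-identityˡ 1#)))
    , trans (sym (Vec.map-∘ (v *_) (u *_) a)) (Vec.map-cong (λ x → sym (*-assoc v u x)) a)

  -- Units act freely on unimodular vectors. In the count of classes this shows that the entry in
  -- front of a chosen tail is determined by the class.
  unimodular-free : ∀ {n} {u} {a : Vec Carrier n} → Unimodular R a → a ≡ u · a → u ≡ 1#
  unimodular-free {u = u} {a} (c , ca≡1) eq = begin
    u                   ≡⟨ *-identityʳ u ⟨
    u * 1#              ≡⟨ cong (u *_) ca≡1 ⟨
    u * dot R c a       ≡⟨ dot-·ʳ u c a ⟨
    dot R c (u · a)     ≡⟨ cong (dot R c) eq ⟨
    dot R c a           ≡⟨ ca≡1 ⟩
    1#                  ∎

  -- The number of points of the projective space of Rⁿ. The first entry is either a unit,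
  -- normalised to 1 with n free entries after it, or one of μ nonunits in front of a point of
  -- smaller dimension.
  projective-size : ℕ → ℕ
  projective-size zero    = 0
  projective-size (suc n) = ρ ℕ.^ n ℕ.+ μ ℕ.* projective-size n

  -- A class has a unique representative whose first unit entry is 1.
  count-projective : ∀ n → NumClasses {Vec Carrier n} (Unimodular R) (Assoc R) (projective-size n)
  count-projective zero    = (λ ()) , (λ ()) , (λ ()) , λ { [] ([] , eq) → contradiction (sym eq) 1≢0 }
  count-projective (suc n) = numClasses-map (Assoc R) (Assoc R) id
    (λ { {x ∷ a} (inj₁ x-unit) → unit-coordinate⇒unimodular (x ∷ a) zero x-unit
       ; {x ∷ a} (inj₂ (_ , c , ca≡1)) → 0# ∷ c , trans (cong₂ _+_ (zeroˡ x) ca≡1) (+-identityˡ 1#) })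
    (λ _ _ eq → eq) id assoc-trans
    (λ a a-uni → a , classify a a-uni , assoc-refl a)
    (numClasses-⊎ {P = FirstUnit} {Q = FirstNonunit} (Assoc R) apart apart′ count-first-unit count-first-nonunit)
    where
    FirstUnit FirstNonunit : Vec Carrier (suc n) → Set
    FirstUnit (x ∷ a) = IsUnit R x
    FirstNonunit (x ∷ a) = ⟨_⟩ R π x × Unimodular R a

    classify : ∀ a → Unimodular R a → FirstUnit a ⊎ FirstNonunit a
    classify (x ∷ a) xa-uni with unit-or-⟨π⟩ x
    ... | inj₁ x-unit = inj₁ x-unit
    ... | inj₂ x∈ with unimodular⇒unit-coordinate xa-uni
    ...   | zero  , x-unit  = inj₁ x-unit
    ...   | suc i , ai-unit = inj₂ (x∈ , unit-coordinate⇒unimodular a i ai-unit)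

    apart : ∀ {a b} → FirstUnit a → FirstNonunit b → ¬ Assoc R a b
    apart {x ∷ a} {.(u * x) ∷ _} (y , xy≡1) (ux∈ , _) (u , (v , uv≡1) , refl) = unit⇒∉⟨π⟩
      (y * v , trans (solve 4 (λ u x y v → u :* x :* (y :* v) := x :* y :* (u :* v)) refl u x y v)
        (trans (cong₂ _*_ xy≡1 uv≡1) (*-identityˡ 1#))) ux∈

    apart′ : ∀ {a b} → FirstUnit a → FirstNonunit b → ¬ Assoc R b a
    apart′ {_ ∷ _} {y ∷ b} ux-unit (y∈ , _) (u , _ , refl) = unit⇒∉⟨π⟩ ux-unit (⟨π⟩-* u y∈)

    count-first-unit : NumClasses FirstUnit (Assoc R) (ρ ℕ.^ n)
    count-first-unit = numClasses-map _≡_ (Assoc R) (1# ∷_) (λ _ → 1# , *-identityˡ 1#)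
      (λ {a} {b} _ _ → λ { (u , _ , eq) → sym (begin
        b              ≡⟨ proj₂ (Vec.∷-injective eq) ⟩
        u · a          ≡⟨ cong (_· a) (trans (sym (*-identityʳ u)) (sym (proj₁ (Vec.∷-injective eq)))) ⟩
        1# · a         ≡⟨ trans (Vec.map-cong *-identityˡ a) (Vec.map-id a) ⟩
        a              ∎) })
      (λ { {a} refl → assoc-refl (1# ∷ a) }) assoc-trans
      (λ { (x ∷ a) (y , xy≡1) → y · a , tt , y , (x , trans (*-comm y x) xy≡1) ,
             cong (_∷ y · a) (sym (trans (*-comm y x) xy≡1)) })
      (count-vectors n)

    count-first-nonunit : NumClasses FirstNonunit (Assoc R) (μ ℕ.* projective-size n)
    count-first-nonunit = normal-forms (count-projective n)
      where
      normal-forms : NumClasses {Vec Carrier n} (Unimodular R) (Assoc R) (projective-size n) →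
        NumClasses FirstNonunit (Assoc R) (μ ℕ.* projective-size n)
      normal-forms (f , f-uni , f-injective , f-onto) = numClasses-map _≡_ (Assoc R) (λ { (x , j) → x ∷ f j })
        (λ { {x , j} (x∈ , _) → x∈ , f-uni j })
        (λ { {x , j} {y , k} _ _ (u , u-unit , eq) →
             same x y j k u u-unit (proj₁ (Vec.∷-injective eq)) (proj₂ (Vec.∷-injective eq)) })
        (λ { {x , j} refl → assoc-refl (x ∷ f j) }) assoc-trans
        (λ { (x ∷ a) (x∈ , a-uni) → let (j , u , u-unit , fj≡) = f-onto a a-uni in
             (u * x , j) , (⟨π⟩-* u x∈ , tt) , u , u-unit , cong (u * x ∷_) fj≡ })
        (numClasses-× {Q = λ _ → ⊤} count-⟨π⟩ (id , (λ _ → tt) , (λ _ _ eq → eq) , λ j _ → j , refl))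
        where
        same : ∀ x y j k u → IsUnit R u → y ≡ u * x → f k ≡ u · f j → (x , j) ≡ (y , k)
        same x y j k u u-unit y≡ fk≡ with f-injective j k (u , u-unit , fk≡)
        ... | refl = cong (_, j) (sym (trans y≡ (trans (cong (_* x) (unimodular-free (f-uni j) fk≡)) (*-identityˡ x))))

  um₀-halfSize : ∀ n → HalfSize (Um₀ R n) (projective-size n)
  um₀-halfSize n = lift-to-side (λ _ → ⊤) (Assoc R) true (λ _ _ _ → refl) (λ v eq → sym eq , tt)
    (numClasses-map (Assoc R) (Assoc R) id (λ a-uni → a-uni , tt) (λ _ _ eq → eq) id assoc-trans
      (λ a p → a , proj₁ p , assoc-refl a) (count-projective n))

  map-removeAt : ∀ {n} (f : Carrier → Carrier) (a : Vec Carrier (suc n)) i → removeAt (Vec.map f a) i ≡ Vec.map f (removeAt a i)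
  map-removeAt f (x ∷ a)     zero    = refl
  map-removeAt f (x ∷ y ∷ a) (suc i) = cong (f x ∷_) (map-removeAt f (y ∷ a) i)

  -- For right-hand side 0 the map `point` is linear, so it commutes with scaling and induces a
  -- bijection from the classes over Rⁿ to those in the hyperplane.
  count-projective-hyperplane : ∀ {n} (a : Vec Carrier (suc n)) i v → lookup a i * v ≡ 1# →
    NumClasses (λ b → Unimodular R b × dot R a b ≡ 0#) (Assoc R) (projective-size n)
  count-projective-hyperplane {n} a i v av≡1 = numClasses-map (Assoc R) (Assoc R) point
    (λ {b} b-uni → point-unimodular b-uni , dot-point b)
    (λ { {b} {b′} _ _ (u , u-unit , eq) → u , u-unit , (begin
        b′                                 ≡⟨ Vec.removeAt-insertAt b′ i _ ⟨
        removeAt (point b′) i              ≡⟨ cong (λ c → removeAt c i) eq ⟩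
        removeAt (u · point b) i           ≡⟨ map-removeAt (u *_) (point b) i ⟩
        u · removeAt (point b) i           ≡⟨ cong (u ·_) (Vec.removeAt-insertAt b i _) ⟩
        u · b                              ∎) })
    (λ { {b} (u , u-unit , refl) → u , u-unit , (begin
        insertAt (u · b) i (solved (u · b))    ≡⟨ cong (insertAt (u · b) i) (solved-· u b) ⟩
        insertAt (u · b) i (u * solved b)      ≡⟨ Vec.map-insertAt (u *_) (solved b) b i ⟨
        u · point b                            ∎) })
    assoc-trans
    (λ { b ((c , cb≡1) , ab≡0) → let b≡ = point-removeAt b ab≡0 in
        removeAt b i
      -- A witness for b restricts to one for its free coordinates, because b is `point` of them.
      , (restrict c , trans (sym (dot-restrict c (removeAt b i))) (trans (cong (dot R c) (sym b≡)) cb≡1))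
      , subst (Assoc R b) b≡ (assoc-refl b) })
    (count-projective n)
    where
    open LinearHyperplane a i v av≡1
    solved-· : ∀ u b → solved (u · b) ≡ u * solved b
    solved-· u b = begin
      solved (u · b)                  ≡⟨ solved-linear (u · b) ⟩
      - v * dot R a′ (u · b)          ≡⟨ cong (- v *_) (dot-·ʳ u a′ b) ⟩
      - v * (u * dot R a′ b)          ≡⟨ solve 3 (λ v u d → v :* (u :* d) := u :* (v :* d)) refl (- v) u _ ⟩
      u * (- v * dot R a′ b)          ≡⟨ cong (u *_) (solved-linear b) ⟨
      u * solved b                    ∎

  um₀-regular : ∀ n → Regular (Um₀ R (suc n)) (projective-size n)
  um₀-regular n (s , a) = let (i , v , av≡1) = unimodular⇒unit-coordinate (proj₂ a) in
    neighbours 0# (Assoc R) s a (count-projective-hyperplane (proj₁ a) i v av≡1)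

-- Closed forms of the counts

^-distribʳ-* : ∀ m n k → (m ℕ.* n) ℕ.^ k ≡ m ℕ.^ k ℕ.* n ℕ.^ k
^-distribʳ-* m n zero    = refl
^-distribʳ-* m n (suc k) = trans (cong (m ℕ.* n ℕ.*_) (^-distribʳ-* m n k))
  (ℕ.[m*n]*[o*p]≡[m*o]*[n*p] m n (m ℕ.^ k) (n ℕ.^ k))

-- Truncated subtraction is unsuited to induction, so `total` proves the identity with μ^n moved to
-- the left. Multiplying by q - 1 replaces the division in the closed form.
projective-size-formula : ∀ p μ (h : ℕ → ℕ) → let q = suc p in h 0 ≡ 0 →
  (∀ n → h (suc n) ≡ (q ℕ.* μ) ℕ.^ n ℕ.+ μ ℕ.* h n) →
  ∀ n → h (suc n) ℕ.* (q ℕ.∸ 1) ≡ μ ℕ.^ n ℕ.* (q ℕ.^ suc n ℕ.∸ 1)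
projective-size-formula p μ h h0 hs n = begin
  h (suc n) * p                                       ≡⟨ ℕ.m+n∸n≡m (h (suc n) * p) (μ ^ n) ⟨
  h (suc n) * p + μ ^ n ∸ μ ^ n                       ≡⟨ cong₂ _∸_ (total n) (sym (ℕ.*-identityʳ (μ ^ n))) ⟩
  μ ^ n * q ^ suc n ∸ μ ^ n * 1                       ≡⟨ ℕ.*-distribˡ-∸ (μ ^ n) (q ^ suc n) 1 ⟨
  μ ^ n * (q ^ suc n ∸ 1)                             ∎
  where
  open ≡.≡-Reasoning
  open import Data.Nat using (_+_; _*_; _^_; _∸_)
  open import Data.Nat.Solver using (module +-*-Solver)
  open +-*-Solver
  q = suc p
  total : ∀ n → h (suc n) * p + μ ^ n ≡ μ ^ n * q ^ suc n
  total zero = begin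
    h 1 * p + 1               ≡⟨ cong (λ k → k * p + 1) (hs 0) ⟩
    (1 + μ * h 0) * p + 1     ≡⟨ cong (λ k → (1 + μ * k) * p + 1) h0 ⟩
    (1 + μ * 0) * p + 1       ≡⟨ solve 2 (λ p m → (con 1 :+ m :* con 0) :* p :+ con 1 := con 1 :* ((con 1 :+ p) :* con 1)) refl p μ ⟩
    1 * (q * 1)               ∎
  total (suc n) = begin
    h (suc (suc n)) * p + μ * μ ^ n                                  ≡⟨ cong (λ k → k * p + μ * μ ^ n) (hs (suc n)) ⟩
    ((q * μ) ^ suc n + μ * h (suc n)) * p + μ * μ ^ n                ≡⟨ cong (λ k → (k + μ * h (suc n)) * p + μ * μ ^ n) (^-distribʳ-* q μ (suc n)) ⟩
    (q ^ suc n * (μ * μ ^ n) + μ * h (suc n)) * p + μ * μ ^ n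
      ≡⟨ solve 5 (λ Q m M h p → (Q :* (m :* M) :+ m :* h) :* p :+ m :* M := Q :* (m :* M) :* p :+ m :* (h :* p :+ M)) refl (q ^ suc n) μ (μ ^ n) (h (suc n)) p ⟩
    q ^ suc n * (μ * μ ^ n) * p + μ * (h (suc n) * p + μ ^ n)        ≡⟨ cong (λ k → q ^ suc n * (μ * μ ^ n) * p + μ * k) (total n) ⟩
    q ^ suc n * (μ * μ ^ n) * p + μ * (μ ^ n * q ^ suc n)
      ≡⟨ solve 4 (λ Q m M p → Q :* (m :* M) :* p :+ m :* (M :* Q) := m :* M :* ((con 1 :+ p) :* Q)) refl (q ^ suc n) μ (μ ^ n) p ⟩
    μ * μ ^ n * (q * q ^ suc n)                                      ∎

power-power : ∀ q k n → (q ℕ.^ k) ℕ.^ n ≡ q ℕ.^ (n ℕ.* k)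
power-power q k n = trans (ℕ.^-*-assoc q k n) (cong (q ℕ.^_) (ℕ.*-comm k n))

open import Data.Nat using (_+_; _*_; _∸_; _^_; _≤_; _%_; s≤s)

theorem1p7 : (R : FinCommRing) → IsFiniteValuationRing R →
    (π : FinCommRing.Carrier R) → IsUniformizer R π →
    (q ℓ : ℕ) → ResidueSize R π q → NilDegree R π ℓ → q % 2 ≡ 1 →
    ((n : ℕ) → 2 ≤ n →
    HalfSize (Um R n) (q ^ (n * ℓ) ∸ q ^ (n * (ℓ ∸ 1)))
    × Regular (Um R n) (q ^ ((n ∸ 1) * ℓ))
    × IsCayley (Um R n)
    × Diameter (Um R n) 4)
    ×
    ((n : ℕ) → 3 ≤ n →
    (∃ λ h → HalfSize (Um₀ R n) h
    × h * (q ∸ 1) ≡ q ^ ((n ∸ 1) * (ℓ ∸ 1)) * (q ^ n ∸ 1))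
    × (∃ λ d → Regular (Um₀ R n) d
    × d * (q ∸ 1) ≡ q ^ ((n ∸ 2) * (ℓ ∸ 1)) * (q ^ (n ∸ 1) ∸ 1))
    × IsCayley (Um₀ R n)
    × Diameter (Um₀ R n) 3)
-- Nilpotency degree 0 contradicts 1 ≤ ℓ, and q = 0 or 2 contradicts oddness. For q = 1 the elements
-- 0 and 1 would be congruent modulo π. Hence q ≥ 3 in the last clause.
theorem1p7 R _ π uniformizer q zero residueSize (() , _) q-odd
theorem1p7 R _ π uniformizer zero (suc l) residueSize nilDegree ()
theorem1p7 R _ π uniformizer (suc (suc zero)) (suc l) residueSize nilDegree ()
theorem1p7 R _ π uniformizer (suc zero) (suc l) (f , _ , _ , f-onto) nilDegree q-odd =
  contradiction (≡ᵖ0⇒∈ (K.trans (difference⇒≡ᵖ (residue 1#)) (K.sym (difference⇒≡ᵖ (residue 0#))))) 1∉⟨π⟩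
  where
  open Geometry R π uniformizer (suc l) nilDegree
    using (Carrier; _-_; 0#; 1#; 1∉⟨π⟩; residueRing; difference⇒≡ᵖ; ≡ᵖ0⇒∈)
  module K = CommutativeRing residueRing
  residue : ∀ x → ⟨_⟩ R π (x - f zero)
  residue x with f-onto x x
  ... | zero , eq = eq
theorem1p7 R _ π uniformizer q@(suc (suc (suc q′))) (suc l) residueSize nilDegree q-odd = um , um₀
  where
  open Geometry R π uniformizer (suc l) nilDegree
    using (um-isCayley; um₀-isCayley; um-diameter; um₀-diameter; nontrivial-unit)
  open Counting R π uniformizer l nilDegree residueSize
    using (μ; projective-size; um-halfSize; um-regular; um₀-halfSize; um₀-regular)

  um : (n : ℕ) → 2 ≤ n →
    HalfSize (Um R n) (q ^ (n * suc l) ∸ q ^ (n * l)) × Regular (Um R n) (q ^ ((n ∸ 1) * suc l))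
    × IsCayley (Um R n) × Diameter (Um R n) 4
  um n@(suc (suc m)) _ =
      subst (HalfSize (Um R n)) (cong₂ _∸_ (power-power q (suc l) n) (power-power q l n)) (um-halfSize n)
    , subst (Regular (Um R n)) (power-power q (suc l) (suc m)) (um-regular (suc m))
    , um-isCayley residueSize (suc m)
    , (let (u , u-unit , u≢1) = nontrivial-unit residueSize in um-diameter u u-unit u≢1)
  um (suc zero) (s≤s ())

  formula : ∀ n → projective-size (suc n) * (q ∸ 1) ≡ q ^ (n * l) * (q ^ suc n ∸ 1)
  formula n = trans (projective-size-formula (suc (suc q′)) μ projective-size refl (λ _ → refl) n)
    (cong (_* (q ^ suc n ∸ 1)) (power-power q l n))

  um₀ : (n : ℕ) → 3 ≤ n →
    (∃ λ h → HalfSize (Um₀ R n) h × h * (q ∸ 1) ≡ q ^ ((n ∸ 1) * l) * (q ^ n ∸ 1))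
    × (∃ λ d → Regular (Um₀ R n) d × d * (q ∸ 1) ≡ q ^ ((n ∸ 2) * l) * (q ^ (n ∸ 1) ∸ 1))
    × IsCayley (Um₀ R n) × Diameter (Um₀ R n) 3
  um₀ n@(suc (suc (suc m))) _ =
      (projective-size n , um₀-halfSize n , formula (suc (suc m)))
    , (projective-size (suc (suc m)) , um₀-regular (suc (suc m)) , formula (suc m))
    , um₀-isCayley residueSize (suc (suc m))
    , um₀-diameter
  um₀ (suc zero) (s≤s ())
  um₀ (suc (suc zero)) (s≤s (s≤s ()))
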